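{- Let $T$ be $\mathrm{DLO}$ or $\mathrm{DOAG}$ and $\boldsymbol{M}\models T$. A definable set $D\subseteq\boldsymbol{M}^{(x;y)}$ is stable with respect to $(x;y)$ if and only if $D$ is a finite union of special stable sets. Equivalently, an $L(\boldsymbol{M})$-formula $\varphi(x;y)$ is stable if and only if it is $T$-equivalent to a finite disjunction of formulas of the form $\psi(x)\wedge\theta(y)\wedge\chi(x,y)$ with $\psi,\theta$ arbitrary $L(\boldsymbol{M})$-formulas and $\chi$ a Boolean combination of atomic $L(\boldsymbol{M})$-formulas not containing $<$.
   Context: $\mathrm{DLO}=\mathrm{Th}(\mathbb{R},<)$ in $L=\{<\}$, $\mathrm{DOAG}=\mathrm{Th}(\mathbb{R},+,<)$ in the ordered group language; "definable" means definable with parameters. A definable $D\subseteq\boldsymbol{M}^{(x;y)}$ is unstable with respect to $(x;y)$ if there are $a_i\in\boldsymbol{M}^x$, $b_j\in\boldsymbol{M}^y$ ($i,j<\omega$) with $(a_i,b_j)\in D$ iff $i\le j$; otherwise stable. A set is equationally definable if it is defined by a Boolean combination of atomic formulas with parameters not involving $<$. $D$ is special stable if $D=Z\cap(X\times Y)$ for some definable $X\subseteq\boldsymbol{M}^x$, $Y\subseteq\boldsymbol{M}^y$ and equationally definable $Z\subseteq\boldsymbol{M}^{(x;y)}$. -}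

module Defs where

open import Level using (Level; _⊔_; Lift; 0ℓ) renaming (suc to lsuc)
open import Data.Empty using (⊥; ⊥-elim)
import Data.Empty.Polymorphic as Poly
import Data.Unit.Polymorphic as Poly
open import Data.Nat using (ℕ; suc)
import Data.Nat as ℕ
import Data.Nat.Properties as ℕ
open import Data.Fin using (Fin; lift; _↑ˡ_; _↑ʳ_)
open import Data.List using (List; []; _∷_; foldr)
open import Data.Vec using (Vec; []; _∷_; lookup; _++_)
open import Data.Vec.Relation.Binary.Pointwise.Inductive using (Pointwise; []; _∷_)
open import Data.Product using (Σ-syntax; ∃-syntax; _×_; _,_; uncurry)
open import Data.Sum using (_⊎_; inj₁; inj₂)
open import Data.Rational using (ℚ; 0ℚ; ½; _<_; _≤_; _+_; _-_; -_; _*_; ∣_∣)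
import Data.Rational.Properties as ℚ
open import Data.Rational.Solver using (module +-*-Solver)
open import Function using (id; _∘_; _⇔_)
open import Relation.Nullary using (¬_)
open import Relation.Unary using (Pred; _≐_; _∩_; _⟨×⟩_; ⋃)
open import Relation.Binary using (Rel; IsEquivalence; _Respects₂_)
open import Relation.Binary.PropositionalEquality using (_≡_; refl; sym; subst)

private variable
  c ℓ p : Level
  k m n : ℕ

-- A language is given by its function symbols of each arity;
-- < (and equality) belong to every language.
Language : Set₁
Language = ℕ → Set

-- Terms and formulas with parameters from A and k free variables.
data Term (L : Language) (A : Set c) (k : ℕ) : Set c where
  var : Fin k → Term L A k
  par : A → Term L A k
  fun : L n → Vec (Term L A k) n → Term L A k

infix  8 _≈′_ _<′_
infix  7 ¬′_
infixr 6 _∧′_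
infixr 5 _∨′_
infix  4 ∃′_ ∀′_

data Formula (L : Language) (A : Set c) : ℕ → Set c where
  _≈′_ _<′_ : Term L A k → Term L A k → Formula L A k
  ⊤′ ⊥′     : Formula L A k
  ¬′_       : Formula L A k → Formula L A k
  _∧′_ _∨′_ : Formula L A k → Formula L A k → Formula L A k
  ∃′_ ∀′_   : Formula L A (suc k) → Formula L A k

-- Parameter-free, no free variables.
Sentence : Language → Set
Sentence L = Formula L ⊥ 0

-- Boolean combinations of atomic formulas not involving <.
data Equational {L : Language} {A : Set c} {k : ℕ} : Formula L A k → Set c where
  _≈′_ : ∀ s t → Equational (s ≈′ t)
  ⊤′   : Equational ⊤′
  ⊥′   : Equational ⊥′
  ¬′_  : ∀ {φ} → Equational φ → Equational (¬′ φ)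
  _∧′_ : ∀ {φ ψ} → Equational φ → Equational ψ → Equational (φ ∧′ ψ)
  _∨′_ : ∀ {φ ψ} → Equational φ → Equational ψ → Equational (φ ∨′ ψ)

module _ {L : Language} {A : Set c} where

  mutual
    renameTerm : (Fin m → Fin n) → Term L A m → Term L A n
    renameTerm ρ (var i)    = var (ρ i)
    renameTerm ρ (par a)    = par a
    renameTerm ρ (fun f ts) = fun f (renameTerms ρ ts)

    renameTerms : (Fin m → Fin n) → Vec (Term L A m) k → Vec (Term L A n) k
    renameTerms ρ []       = []
    renameTerms ρ (t ∷ ts) = renameTerm ρ t ∷ renameTerms ρ ts

  rename : (Fin m → Fin n) → Formula L A m → Formula L A n
  rename ρ (s ≈′ t) = renameTerm ρ s ≈′ renameTerm ρ t
  rename ρ (s <′ t) = renameTerm ρ s <′ renameTerm ρ t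
  rename ρ ⊤′       = ⊤′
  rename ρ ⊥′       = ⊥′
  rename ρ (¬′ φ)   = ¬′ rename ρ φ
  rename ρ (φ ∧′ ψ) = rename ρ φ ∧′ rename ρ ψ
  rename ρ (φ ∨′ ψ) = rename ρ φ ∨′ rename ρ ψ
  rename ρ (∃′ φ)   = ∃′ rename (lift 1 ρ) φ
  rename ρ (∀′ φ)   = ∀′ rename (lift 1 ρ) φ

  ⋁′ : List (Formula L A k) → Formula L A k
  ⋁′ = foldr _∨′_ ⊥′

-- Equality of a structure is an equivalence relation compatible with the
-- symbols, rather than _≡_, since quotients are not available.
record Structure (L : Language) c ℓ : Set (lsuc (c ⊔ ℓ)) where
  field
    Carrier       : Set c
    _≈_           : Rel Carrier ℓ
    _≺_           : Rel Carrier ℓ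
    ⟦_⟧ᶠ          : L k → Vec Carrier k → Carrier
    isEquivalence : IsEquivalence _≈_
    ≺-resp-≈      : _≺_ Respects₂ _≈_
    ⟦⟧ᶠ-cong      : (f : L k) {xs ys : Vec Carrier k} →
                    Pointwise _≈_ xs ys → ⟦ f ⟧ᶠ xs ≈ ⟦ f ⟧ᶠ ys

module Semantics {L : Language} (𝑴 : Structure L c ℓ) where
  open Structure 𝑴

  module _ {A : Set p} (ι : A → Carrier) where

    mutual
      evalTerm : Term L A k → Vec Carrier k → Carrier
      evalTerm (var i)    v = lookup v i
      evalTerm (par a)    v = ι a
      evalTerm (fun f ts) v = ⟦ f ⟧ᶠ (evalTerms ts v)

      evalTerms : Vec (Term L A k) n → Vec Carrier k → Vec Carrier n
      evalTerms []       v = []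
      evalTerms (t ∷ ts) v = evalTerm t v ∷ evalTerms ts v

    satisfies : Formula L A k → Pred (Vec Carrier k) (c ⊔ ℓ)
    satisfies (s ≈′ t) v = Lift c (evalTerm s v ≈ evalTerm t v)
    satisfies (s <′ t) v = Lift c (evalTerm s v ≺ evalTerm t v)
    satisfies ⊤′       v = Poly.⊤
    satisfies ⊥′       v = Poly.⊥
    satisfies (¬′ φ)   v = ¬ satisfies φ v
    satisfies (φ ∧′ ψ) v = satisfies φ v × satisfies ψ v
    satisfies (φ ∨′ ψ) v = satisfies φ v ⊎ satisfies ψ v
    satisfies (∃′ φ)   v = Σ[ x ∈ Carrier ] satisfies φ (x ∷ v)
    satisfies (∀′ φ)   v = ∀ (x : Carrier) → satisfies φ (x ∷ v)

  -- The subset of 𝑴ᵏ defined by an L(𝑴)-formula.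
  ⟦_⟧ : Formula L Carrier k → Pred (Vec Carrier k) (c ⊔ ℓ)
  ⟦_⟧ = satisfies id

  Th : Pred (Sentence L) (c ⊔ ℓ)
  Th σ = satisfies ⊥-elim σ []

-- 𝑴 is a model of the set of sentences T.
_⊨_ : {L : Language} → Structure L c ℓ → Pred (Sentence L) p → Set (c ⊔ ℓ ⊔ p)
𝑴 ⊨ T = ∀ σ → T σ → Semantics.Th 𝑴 σ

module Stability {L : Language} (𝑴 : Structure L c ℓ) where
  open Structure 𝑴 using (Carrier)
  open Semantics 𝑴

  -- 𝑴^(x;y), where x and y are tuples of m and n variables.
  Pairs : ℕ → ℕ → Set c
  Pairs m n = Vec Carrier m × Vec Carrier n

  -- In formulas on (x;y), the variables x come first.
  ⟦_⟧₂ : Formula L Carrier (m ℕ.+ n) → Pred (Pairs m n) (c ⊔ ℓ)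
  ⟦ φ ⟧₂ = ⟦ φ ⟧ ∘ uncurry _++_

  Definable : Pred (Vec Carrier k) p → Set (c ⊔ ℓ ⊔ p)
  Definable X = ∃[ φ ] X ≐ ⟦ φ ⟧

  Definable₂ : Pred (Pairs m n) p → Set (c ⊔ ℓ ⊔ p)
  Definable₂ D = ∃[ φ ] D ≐ ⟦ φ ⟧₂

  EquationallyDefinable₂ : Pred (Pairs m n) p → Set (c ⊔ ℓ ⊔ p)
  EquationallyDefinable₂ Z = ∃[ χ ] Equational χ × Z ≐ ⟦ χ ⟧₂

  Unstable : Pred (Pairs m n) p → Set (c ⊔ p)
  Unstable {m} {n} D =
    Σ[ a ∈ (ℕ → Vec Carrier m) ] Σ[ b ∈ (ℕ → Vec Carrier n) ]
      ∀ i j → D (a i , b j) ⇔ i ℕ.≤ j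

  Stable : Pred (Pairs m n) p → Set (c ⊔ p)
  Stable D = ¬ Unstable D

  SpecialStable : Pred (Pairs m n) (c ⊔ ℓ) → Set (lsuc (c ⊔ ℓ))
  SpecialStable {m} {n} D =
    Σ[ X ∈ Pred (Vec Carrier m) (c ⊔ ℓ) ]
    Σ[ Y ∈ Pred (Vec Carrier n) (c ⊔ ℓ) ]
    Σ[ Z ∈ Pred (Pairs m n) (c ⊔ ℓ) ]
      Definable X × Definable Y × EquationallyDefinable₂ Z ×
      D ≐ (Z ∩ (X ⟨×⟩ Y))

  FiniteUnionOfSpecialStable : Pred (Pairs m n) p → Set (lsuc (c ⊔ ℓ) ⊔ p)
  FiniteUnionOfSpecialStable {m} {n} D =
    Σ[ N ∈ ℕ ] Σ[ S ∈ (Fin N → Pred (Pairs m n) (c ⊔ ℓ)) ]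
      (∀ i → SpecialStable (S i)) × D ≐ (⋃[ i ∶ Fin N ] S i)

  StableFormula : ∀ m n → Formula L Carrier (m ℕ.+ n) → Set (c ⊔ ℓ)
  StableFormula m n φ = Stable {m} {n} ⟦ φ ⟧₂

  -- ψ(x) ∧ θ(y) ∧ χ(x,y), with χ equational.
  data SpecialFormula (m n : ℕ) : Formula L Carrier (m ℕ.+ n) → Set c where
    special : (ψ : Formula L Carrier m) (θ : Formula L Carrier n)
              {χ : Formula L Carrier (m ℕ.+ n)} → Equational χ →
              SpecialFormula m n (rename (_↑ˡ n) ψ ∧′ rename (m ↑ʳ_) θ ∧′ χ)

  -- T-equivalence of L(𝑴)-formulas, for 𝑴 a model of T: the universal closure
  -- of φ ↔ ψ is an L(𝑴)-sentence, hence decided by the elementary diagram of 𝑴.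
  Equivalent : Formula L Carrier k → Formula L Carrier k → Set (c ⊔ ℓ)
  Equivalent φ ψ = ∀ v → ⟦ φ ⟧ v ⇔ ⟦ ψ ⟧ v

Eventually : Pred ℕ 0ℓ → Set
Eventually P = ∃[ N ] (∀ i → N ℕ.≤ i → P i)

-- Cauchy sequences of rationals, taken up to _≈ᴿ_.
record ℝ : Set where
  constructor mkℝ
  field
    seq    : ℕ → ℚ
    cauchy : ∀ ε → 0ℚ < ε →
             ∃[ N ] (∀ i j → N ℕ.≤ i → N ℕ.≤ j → ∣ seq i - seq j ∣ < ε)
open ℝ

infix 4 _≈ᴿ_ _<ᴿ_

_≈ᴿ_ : Rel ℝ 0ℓ
x ≈ᴿ y = ∀ ε → 0ℚ < ε → Eventually (λ i → ∣ seq x i - seq y i ∣ < ε)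

_<ᴿ_ : Rel ℝ 0ℓ
x <ᴿ y = ∃[ ε ] 0ℚ < ε × Eventually (λ i → seq x i + ε < seq y i)

open +-*-Solver using (solve; con; _:=_; _:+_; _:-_; :-_; _:*_)

eventually₂ : {P Q R : Pred ℕ 0ℓ} → (∀ i → P i → Q i → R i) →
              Eventually P → Eventually Q → Eventually R
eventually₂ f (M , p) (N , q) = M ℕ.⊔ N , λ i h →
  f i (p i (ℕ.m⊔n≤o⇒m≤o M N h)) (q i (ℕ.m⊔n≤o⇒n≤o M N h))

½-pos : ∀ {ε} → 0ℚ < ε → 0ℚ < ½ * ε
½-pos {ε} 0<ε = subst (_< ½ * ε) (ℚ.*-zeroʳ ½) (ℚ.*-monoʳ-<-pos ½ 0<ε)

halves : ∀ ε → ½ * ε + ½ * ε ≡ ε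
halves = solve 1 (λ e → con ½ :* e :+ con ½ :* e := e) refl

∣∣-add : ∀ {r ε} p q → p + q ≡ r → ∣ p ∣ < ½ * ε → ∣ q ∣ < ½ * ε → ∣ r ∣ < ε
∣∣-add {ε = ε} p q refl p< q< =
  ℚ.≤-<-trans (ℚ.∣p+q∣≤∣p∣+∣q∣ p q) (subst (_ <_) (halves ε) (ℚ.+-mono-< p< q<))

∣∣-neg : ∀ {r ε} p → - p ≡ r → ∣ p ∣ < ε → ∣ r ∣ < ε
∣∣-neg p refl = subst (_< _) (sym (ℚ.∣-p∣≡∣p∣ p))

telescope : ∀ p q r → (p - q) + (q - r) ≡ p - r
telescope = solve 3 (λ p q r → (p :- q) :+ (q :- r) := p :- r) refl

flip-sub : ∀ p q → - (p - q) ≡ q - p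
flip-sub = solve 2 (λ p q → :- (p :- q) := q :- p) refl

+-sub : ∀ p q r s → (p - r) + (q - s) ≡ (p + q) - (r + s)
+-sub = solve 4 (λ p q r s → (p :- r) :+ (q :- s) := (p :+ q) :- (r :+ s)) refl

neg-sub : ∀ p q → - (p - q) ≡ - p - (- q)
neg-sub = solve 2 (λ p q → :- (p :- q) := :- p :- (:- q)) refl

p≤∣p∣ : ∀ p → p ≤ ∣ p ∣
p≤∣p∣ p with ℚ.≤-total 0ℚ p
... | inj₁ 0≤p = ℚ.≤-reflexive (sym (ℚ.0≤p⇒∣p∣≡p 0≤p))
... | inj₂ p≤0 = ℚ.≤-trans p≤0 (ℚ.0≤∣p∣ p)

≈ᴿ-refl : ∀ {x} → x ≈ᴿ x
≈ᴿ-refl {x} ε 0<ε = 0 , λ i _ →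
  subst (λ r → ∣ r ∣ < ε) (sym (ℚ.+-inverseʳ (seq x i))) 0<ε

≈ᴿ-sym : ∀ {x y} → x ≈ᴿ y → y ≈ᴿ x
≈ᴿ-sym {x} {y} x≈y ε 0<ε = let (N , h) = x≈y ε 0<ε in N , λ i N≤i →
  ∣∣-neg (seq x i - seq y i) (flip-sub (seq x i) (seq y i)) (h i N≤i)

≈ᴿ-trans : ∀ {x y z} → x ≈ᴿ y → y ≈ᴿ z → x ≈ᴿ z
≈ᴿ-trans {x} {y} {z} x≈y y≈z ε 0<ε = eventually₂
  (λ i → ∣∣-add (seq x i - seq y i) (seq y i - seq z i)
                (telescope (seq x i) (seq y i) (seq z i)))
  (x≈y (½ * ε) (½-pos 0<ε)) (y≈z (½ * ε) (½-pos 0<ε))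

<ᴿ-respʳ : ∀ {x y z} → y ≈ᴿ z → x <ᴿ y → x <ᴿ z
<ᴿ-respʳ {x} {y} {z} y≈z (ε , 0<ε , x<y) =
  ½ * ε , ½-pos 0<ε , eventually₂ step (y≈z (½ * ε) (½-pos 0<ε)) x<y
  where
  shift : ∀ b c → (b - c) + c ≡ b
  shift = solve 2 (λ b c → (b :- c) :+ c := b) refl
  cancel₁ : ∀ a e → a + e - ½ * e ≡ a + ½ * e
  cancel₁ = solve 2 (λ a e → a :+ e :- con ½ :* e := a :+ con ½ :* e) refl
  cancel₂ : ∀ c e → ½ * e + c - ½ * e ≡ c
  cancel₂ = solve 2 (λ c e → con ½ :* e :+ c :- con ½ :* e := c) refl
  step : ∀ i → ∣ seq y i - seq z i ∣ < ½ * ε → seq x i + ε < seq y i →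
         seq x i + ½ * ε < seq z i
  step i d h = ℚ.<-trans
    (subst (_< seq y i - ½ * ε) (cancel₁ (seq x i) ε)
      (ℚ.+-monoˡ-< (- (½ * ε)) h))
    (subst (seq y i - ½ * ε <_) (cancel₂ (seq z i) ε)
      (ℚ.+-monoˡ-< (- (½ * ε))
        (subst (_< ½ * ε + seq z i) (shift (seq y i) (seq z i))
          (ℚ.+-monoˡ-< (seq z i) (ℚ.≤-<-trans (p≤∣p∣ _) d)))))

<ᴿ-respˡ : ∀ {x y z} → y ≈ᴿ z → y <ᴿ x → z <ᴿ x
<ᴿ-respˡ {x} {y} {z} y≈z (ε , 0<ε , y<x) =
  ½ * ε , ½-pos 0<ε , eventually₂ step (≈ᴿ-sym {y} {z} y≈z (½ * ε) (½-pos 0<ε)) y<x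
  where
  regroup : ∀ c b e → (c - b) + (b + ½ * e) ≡ c + ½ * e
  regroup = solve 3 (λ c b e → (c :- b) :+ (b :+ con ½ :* e) := c :+ con ½ :* e) refl
  collect : ∀ b e → ½ * e + (b + ½ * e) ≡ b + e
  collect = solve 2 (λ b e → con ½ :* e :+ (b :+ con ½ :* e) := b :+ e) refl
  step : ∀ i → ∣ seq z i - seq y i ∣ < ½ * ε → seq y i + ε < seq x i →
         seq z i + ½ * ε < seq x i
  step i d h = ℚ.<-trans
    (subst (_< seq y i + ε) (regroup (seq z i) (seq y i) ε)
      (subst (seq z i - seq y i + (seq y i + ½ * ε) <_) (collect (seq y i) ε)
        (ℚ.+-monoˡ-< (seq y i + ½ * ε) (ℚ.≤-<-trans (p≤∣p∣ _) d))))
    h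

0ᴿ : ℝ
0ᴿ = mkℝ (λ _ → 0ℚ) (λ ε 0<ε → 0 , λ _ _ _ _ → 0<ε)

infix  8 -ᴿ_
infixl 6 _+ᴿ_

-ᴿ_ : ℝ → ℝ
-ᴿ x = mkℝ (λ i → - seq x i) λ ε 0<ε → let (N , h) = cauchy x ε 0<ε in
  N , λ i j N≤i N≤j →
    ∣∣-neg (seq x i - seq x j) (neg-sub (seq x i) (seq x j)) (h i j N≤i N≤j)

_+ᴿ_ : ℝ → ℝ → ℝ
x +ᴿ y = mkℝ (λ i → seq x i + seq y i) λ ε 0<ε →
  let (M , g) = cauchy x (½ * ε) (½-pos 0<ε)
      (N , h) = cauchy y (½ * ε) (½-pos 0<ε)
  in M ℕ.⊔ N , λ i j ≤i ≤j →
    ∣∣-add (seq x i - seq x j) (seq y i - seq y j)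
           (+-sub (seq x i) (seq y i) (seq x j) (seq y j))
           (g i j (ℕ.m⊔n≤o⇒m≤o M N ≤i) (ℕ.m⊔n≤o⇒m≤o M N ≤j))
           (h i j (ℕ.m⊔n≤o⇒n≤o M N ≤i) (ℕ.m⊔n≤o⇒n≤o M N ≤j))

-ᴿ-cong : ∀ {x y} → x ≈ᴿ y → -ᴿ x ≈ᴿ -ᴿ y
-ᴿ-cong {x} {y} x≈y ε 0<ε = let (N , h) = x≈y ε 0<ε in N , λ i N≤i →
  ∣∣-neg (seq x i - seq y i) (neg-sub (seq x i) (seq y i)) (h i N≤i)

+ᴿ-cong : ∀ {x x′ y y′} → x ≈ᴿ x′ → y ≈ᴿ y′ → x +ᴿ y ≈ᴿ x′ +ᴿ y′
+ᴿ-cong {x} {x′} {y} {y′} x≈x′ y≈y′ ε 0<ε = eventually₂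
  (λ i → ∣∣-add (seq x i - seq x′ i) (seq y i - seq y′ i)
                (+-sub (seq x i) (seq y i) (seq x′ i) (seq y′ i)))
  (x≈x′ (½ * ε) (½-pos 0<ε)) (y≈y′ (½ * ε) (½-pos 0<ε))

data TheoryName : Set where
  DLO DOAG : TheoryName

data GroupSymbol : ℕ → Set where
  zeroˢ : GroupSymbol 0
  negˢ  : GroupSymbol 1
  plusˢ : GroupSymbol 2

language : TheoryName → Language
language DLO  = λ _ → ⊥
language DOAG = GroupSymbol

-- (ℝ, <) and (ℝ, 0, -, +, <)
realStructure : (T : TheoryName) → Structure (language T) 0ℓ 0ℓ
realStructure T = record
  { Carrier       = ℝ
  ; _≈_           = _≈ᴿ_
  ; _≺_           = _<ᴿ_
  ; ⟦_⟧ᶠ          = interpret T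
  ; isEquivalence = record
    { refl  = λ {x} → ≈ᴿ-refl {x}
    ; sym   = λ {x} {y} → ≈ᴿ-sym {x} {y}
    ; trans = λ {x} {y} {z} → ≈ᴿ-trans {x} {y} {z}
    }
  ; ≺-resp-≈      = (λ {x} {y} {z} → <ᴿ-respʳ {x} {y} {z})
                  , (λ {x} {y} {z} → <ᴿ-respˡ {x} {y} {z})
  ; ⟦⟧ᶠ-cong      = interpret-cong T
  }
  where
  interpret : ∀ T → language T k → Vec ℝ k → ℝ
  interpret DLO  ()
  interpret DOAG zeroˢ []           = 0ᴿ
  interpret DOAG negˢ  (x ∷ [])     = -ᴿ x
  interpret DOAG plusˢ (x ∷ y ∷ []) = x +ᴿ y

  interpret-cong : ∀ T (f : language T k) {xs ys : Vec ℝ k} →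
                   Pointwise _≈ᴿ_ xs ys → interpret T f xs ≈ᴿ interpret T f ys
  interpret-cong DLO  ()
  interpret-cong DOAG zeroˢ []                        = ≈ᴿ-refl {0ᴿ}
  interpret-cong DOAG negˢ  (_∷_ {x = x} {y = y} e []) = -ᴿ-cong {x} {y} e
  interpret-cong DOAG plusˢ
    (_∷_ {x = x} {y = x′} e (_∷_ {x = y} {y = y′} f [])) = +ᴿ-cong {x} {x′} {y} {y′} e f

theory : (T : TheoryName) → Pred (Sentence (language T)) 0ℓ
theory T = Semantics.Th (realStructure T)

{-# OPTIONS --safe #-}

-- By quantifier elimination φ(x;y) depends only on the signs of finitely many
-- affine forms h(x,y) = f(x) + g(y) + c.  For a sign vector τ realised in φ let
-- ψ(x) and θ(y) say that x, respectively y, can be completed to a point with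
-- sign vector τ, and let χ(x,y) say which of the forms vanish.  If φ is stable,
-- then φ is the disjunction over τ of ψ ∧ θ ∧ χ.  For suppose that (x,y′) and
-- (x′,y) have sign vector τ and that (x,y) has the same vanishing forms.  A form
-- whose signs at (x,y′) and (x,y) differ can be moved by x alone and by y alone
-- while the vanishing forms stay fixed.  Walk from (x,y′) to (x,y), crossing the
-- hyperplanes of such forms one parallel class at a time; membership in φ cannot
-- change at a crossing, since otherwise φ contains a half graph around it.
--
-- A dense linear order need not be a group, but only finitely many of its points
-- matter, so its formulas can be pulled back along an embedding of ℚ that hits
-- these points.  Conversely, every half graph has a subsequence on which a given
-- Boolean combination of equations f(x) = g(y) and of conditions on x or on y
-- alone is symmetric, so such a combination is stable.

module Submission where

open import Defs
open import Algebra.Bundles using (AbelianGroup)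
import Algebra.Properties.AbelianGroup
import Algebra.Properties.CommutativeMonoid.Mult
import Algebra.Properties.CommutativeSemigroup
open import Axiom.ExcludedMiddle using (ExcludedMiddle)
open import Data.Empty using (⊥-elim)
open import Data.Fin as Fin using (Fin; zero; suc; _↑ˡ_; _↑ʳ_)
open import Data.Integer as ℤ using (ℤ; +_; -[1+_]; 0ℤ; 1ℤ; -1ℤ)
import Data.Integer.Properties as ℤ
import Data.Integer.Solver as ℤSolver
open import Data.List as List using (List; []; _∷_; cartesianProduct; cartesianProductWith)
open import Data.List.Membership.Propositional using (_∈_)
open import Data.List.Membership.Propositional.Properties
  using ( ∈-map⁺; ∈-map⁻; ∈-filter⁺; ∈-filter⁻; ∈-++⁺ˡ; ∈-++⁺ʳ; ∈-++⁻; ∈-lookup; ∈-allFin; ∈-upTo⁺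
        ; ∈-cartesianProduct⁺; ∈-cartesianProduct⁻; ∈-cartesianProductWith⁺)
open import Data.List.Relation.Unary.All as All using (All; []; _∷_)
import Data.List.Relation.Unary.All.Properties as All
open import Data.List.Relation.Unary.Any as Any using (here; there)
import Data.List.Relation.Unary.Any.Properties as Any
open import Data.Nat as ℕ using (ℕ; zero; suc)
import Data.Nat.Properties as ℕ
open import Data.Product using (Σ-syntax; ∃-syntax; _×_; _,_; proj₁; proj₂) renaming (swap to ×-swap)
open import Data.Rational as ℚ using (ℚ; 0ℚ; 1ℚ; ½)
import Data.Rational.Properties as ℚ
open import Data.Sum using (_⊎_; inj₁; inj₂; [_,_]′)
open import Data.Unit using (⊤; tt)
open import Data.Vec as Vec using (Vec; []; _∷_; lookup; _++_)
import Data.Vec.Properties as Vec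
open import Data.Vec.Relation.Binary.Pointwise.Inductive using ([]; _∷_; Pointwise-≡⇒≡)
open import Function using (_∘_; id; _⇔_; mk⇔; Equivalence)
open import Level using (Level; _⊔_; 0ℓ; Lift; lift; lower) renaming (suc to lsuc)
open import Relation.Binary
  using ( Rel; Setoid; StrictTotalOrder; IsEquivalence; IsStrictTotalOrder
        ; Trichotomous; tri<; tri≈; tri>)
import Relation.Binary.Construct.Flip.EqAndOrd as Flip
open import Relation.Binary.PropositionalEquality as ≡ using (_≡_; _≢_; refl)
import Relation.Binary.Reasoning.Setoid
open import Relation.Nullary using (¬_; Dec; yes; no; contradiction; ¬?)
open import Relation.Nullary.Decidable using (decidable-stable)
open import Relation.Unary using (Pred; Decidable; _≐_)

open Equivalence using (to; from)
open ℤSolver.+-*-Solver using (con; _:=_; _:+_; _:*_; :-_) renaming (solve to solveℤ)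
open import Algebra.Properties.CommutativeMonoid.Mult
  (AbelianGroup.commutativeMonoid ℚ.+-0-abelianGroup) using () renaming (_×_ to _×ℚ_)

-- The walk takes place in a divisible ordered abelian group, whose elements can be multiplied and
-- divided by integers but not multiplied by one another. The point where a segment meets a
-- hyperplane would require a ratio of two elements, so it need not exist. It is replaced by a point
-- at which every relevant form has a value between its values at the two ends. Such a point is
-- found one coordinate at a time, by the elimination that also yields quantifier elimination, with
-- `Between` in place of equality of signs.
--
-- A half graph needs one direction in x and one in y that leave the vanishing forms alone but move
-- every separating form. These directions are integer vectors, so that any group element can be
-- their scalar. The differences x′ - x and y′ - y show that they exist: if every integer vector
-- killed by the vanishing forms were killed by a separating form, so would be these differences. A
-- generic integer vector then serves all separating forms at once.
--
-- Several hyperplanes may meet at a crossing. Sliding along the crossed one leaves only forms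
-- proportional to it on the plane of the two directions, and these change sign together.

private variable
  a a′ b b′ c d′ ℓ ℓ′ p p′ : Level
  k m n : ℕ

-- Signs and ordered groups

data Sgn : Set where
  neg zer pos : Sgn

infixl 7 _⊗_
_⊗_ : Sgn → Sgn → Sgn
neg ⊗ neg = pos
neg ⊗ zer = zer
neg ⊗ pos = neg
zer ⊗ s   = zer
pos ⊗ s   = s

⊗-cancelˡ : ∀ {r s t} → r ≢ zer → r ⊗ s ≡ r ⊗ t → s ≡ t
⊗-cancelˡ {neg} {neg} {neg} r≢0 e = refl
⊗-cancelˡ {neg} {zer} {zer} r≢0 e = refl
⊗-cancelˡ {neg} {pos} {pos} r≢0 e = refl
⊗-cancelˡ {zer} r≢0 e = contradiction refl r≢0
⊗-cancelˡ {pos} r≢0 e = e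

⊗-zeroʳ : ∀ s → zer ≡ s ⊗ zer
⊗-zeroʳ neg = refl
⊗-zeroʳ zer = refl
⊗-zeroʳ pos = refl

sgnℤ : ℤ → Sgn
sgnℤ (+ 0)       = zer
sgnℤ (+ (suc _)) = pos
sgnℤ -[1+ _ ]    = neg

sgnℤ-≢ : ∀ {a} → a ≢ 0ℤ → sgnℤ a ≢ zer
sgnℤ-≢ {+ 0} a≢0 _ = a≢0 refl

-- Nontrivial divisible ordered abelian groups over a setoid: the common interface of ℚ, to which
-- dense linear orders are pulled back, and of the models of DOAG. To avoid division by zero,
-- `divide n` divides by `suc n`.
record OrderedGroup c ℓ : Set (lsuc (c ⊔ ℓ)) where
  infix 4 _<_
  field
    abelianGroup : AbelianGroup c ℓ
  open AbelianGroup abelianGroup public using (Carrier; _≈_; setoid)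
    renaming ( _∙_ to infixl 6 _+_; ε to 0#; _⁻¹ to infix 8 -_; refl to ≈-refl; sym to ≈-sym; trans to ≈-trans
             ; ∙-cong to +-cong; assoc to +-assoc; comm to +-comm
             ; identityˡ to +-identityˡ; identityʳ to +-identityʳ
             ; inverseˡ to -‿inverseˡ; inverseʳ to -‿inverseʳ; ⁻¹-cong to -‿cong
             ; commutativeMonoid to +-commutativeMonoid
             ; commutativeSemigroup to +-commutativeSemigroup)
  open Algebra.Properties.CommutativeMonoid.Mult +-commutativeMonoid public
    renaming (_×_ to infixr 8 _×′_)
  field
    _<_                : Rel Carrier ℓ
    isStrictTotalOrder : IsStrictTotalOrder _≈_ _<_
    +-monoˡ-<          : ∀ z {x y} → x < y → x + z < y + z
    divide             : ∀ n x → ∃[ y ] suc n ×′ y ≈ x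
    positive           : ∃[ x ] 0# < x

module OrderedGroupProperties (G : OrderedGroup c ℓ) where
  open OrderedGroup G public
  open IsStrictTotalOrder isStrictTotalOrder public using (compare; _≟_)
    renaming (trans to <-trans; irrefl to <-irrefl; <-respˡ-≈ to <-respˡ; <-respʳ-≈ to <-respʳ)
  open Algebra.Properties.AbelianGroup abelianGroup public
    using () renaming (⁻¹-involutive to -‿involutive; ⁻¹-∙-comm to -‿+-comm; ε⁻¹≈ε to -0≈0)
  open Algebra.Properties.CommutativeSemigroup +-commutativeSemigroup public using ()
    renaming (interchange to +-interchange)
  open Relation.Binary.Reasoning.Setoid setoid public

  infixl 6 _-_
  _-_ : Carrier → Carrier → Carrier
  x - y = x + - y

  infixr 7 _•_
  _•_ : ℤ → Carrier → Carrier
  (+ n)    • x = n ×′ x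
  -[1+ n ] • x = - (suc n ×′ x)

  •-congʳ : ∀ a {x y} → x ≈ y → a • x ≈ a • y
  •-congʳ (+ n)    e = ×-congʳ n e
  •-congʳ -[1+ n ] e = -‿cong (×-congʳ (suc n) e)

  •-congˡ : ∀ {a b} x → a ≡ b → a • x ≈ b • x
  •-congˡ x refl = ≈-refl

  +-congˡ : ∀ {x y z} → y ≈ z → x + y ≈ x + z
  +-congˡ = +-cong ≈-refl

  +-congʳ : ∀ {x y z} → y ≈ z → y + x ≈ z + x
  +-congʳ e = +-cong e ≈-refl

  cancel-middle : ∀ x y z → (x + y) - (x + z) ≈ y - z
  cancel-middle x y z = begin
    (x + y) + - (x + z)       ≈⟨ +-congˡ (-‿+-comm x z) ⟨
    (x + y) + (- x + - z)     ≈⟨ +-interchange x y (- x) (- z) ⟩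
    (x + - x) + (y + - z)     ≈⟨ +-congʳ (-‿inverseʳ x) ⟩
    0# + (y + - z)            ≈⟨ +-identityˡ _ ⟩
    y + - z                   ∎

  ⊖-• : ∀ m n x → (m ℤ.⊖ n) • x ≈ m ×′ x - n ×′ x
  ⊖-• zero    zero    x = ≈-sym (-‿inverseʳ 0#)
  ⊖-• zero    (suc n) x = ≈-sym (+-identityˡ _)
  ⊖-• (suc m) zero    x = ≈-sym (≈-trans (+-congˡ -0≈0) (+-identityʳ _))
  ⊖-• (suc m) (suc n) x = begin
    (suc m ℤ.⊖ suc n) • x         ≈⟨ •-congˡ x (ℤ.[1+m]⊖[1+n]≡m⊖n m n) ⟩
    (m ℤ.⊖ n) • x                 ≈⟨ ⊖-• m n x ⟩
    m ×′ x - n ×′ x               ≈⟨ cancel-middle x _ _ ⟨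
    suc m ×′ x - suc n ×′ x       ∎

  •-distribʳ : ∀ a b x → (a ℤ.+ b) • x ≈ a • x + b • x
  •-distribʳ (+ m)    (+ n)    x = ×-homo-+ x m n
  •-distribʳ (+ m)    -[1+ n ] x = ⊖-• m (suc n) x
  •-distribʳ -[1+ m ] (+ n)    x = ≈-trans (⊖-• n (suc m) x) (+-comm _ _)
  •-distribʳ -[1+ m ] -[1+ n ] x = begin
    - (suc (suc (m ℕ.+ n)) ×′ x)        ≈⟨ -‿cong (×-congˡ {x} (≡.cong suc (≡.sym (ℕ.+-suc m n)))) ⟩
    - ((suc m ℕ.+ suc n) ×′ x)          ≈⟨ -‿cong (×-homo-+ x (suc m) (suc n)) ⟩
    - (suc m ×′ x + suc n ×′ x)         ≈⟨ -‿+-comm _ _ ⟨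
    - (suc m ×′ x) + - (suc n ×′ x)     ∎

  •-distribˡ : ∀ a x y → a • (x + y) ≈ a • x + a • y
  •-distribˡ (+ n)    x y = ×-distrib-+ x y n
  •-distribˡ -[1+ n ] x y =
    ≈-trans (-‿cong (×-distrib-+ x y (suc n))) (≈-sym (-‿+-comm _ _))

  -‿• : ∀ a x → (ℤ.- a) • x ≈ - (a • x)
  -‿• (+ 0)       x = ≈-sym -0≈0
  -‿• (+ (suc n)) x = ≈-refl
  -‿• -[1+ n ]    x = ≈-sym (-‿involutive _)

  •-assoc : ∀ a b x → (a ℤ.* b) • x ≈ a • (b • x)
  •-assoc (+ n)    b x = pos-assoc n
    where
    pos-assoc : ∀ n → ((+ n) ℤ.* b) • x ≈ (+ n) • (b • x)
    pos-assoc zero    = •-congˡ x (ℤ.*-zeroˡ b)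
    pos-assoc (suc n) = begin
      (+ suc n ℤ.* b) • x        ≈⟨ •-congˡ x (ℤ.suc-* (+ n) b) ⟩
      (b ℤ.+ + n ℤ.* b) • x      ≈⟨ •-distribʳ b (+ n ℤ.* b) x ⟩
      b • x + (+ n ℤ.* b) • x    ≈⟨ +-congˡ (pos-assoc n) ⟩
      b • x + n ×′ (b • x)       ∎
  •-assoc -[1+ n ] b x = begin
    (-[1+ n ] ℤ.* b) • x           ≈⟨ •-congˡ x (≡.sym (ℤ.neg-distribˡ-* (+ suc n) b)) ⟩
    (ℤ.- (+ suc n ℤ.* b)) • x      ≈⟨ -‿• (+ suc n ℤ.* b) x ⟩
    - ((+ suc n ℤ.* b) • x)        ≈⟨ -‿cong (•-assoc (+ suc n) b x) ⟩
    - (suc n ×′ (b • x))           ∎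

  •-zeroʳ : ∀ a → a • 0# ≈ 0#
  •-zeroʳ a = ≈-trans (≈-sym (•-assoc a 0ℤ 0#)) (•-congˡ 0# (ℤ.*-zeroʳ a))

  1• : ∀ x → 1ℤ • x ≈ x
  1• x = +-identityʳ x

  -1• : ∀ x → -1ℤ • x ≈ - x
  -1• x = -‿cong (1• x)

  infix 7 _∙_
  _∙_ : Vec ℤ n → Vec Carrier n → Carrier
  []      ∙ []      = 0#
  (a ∷ f) ∙ (x ∷ v) = a • x + f ∙ v

  infixl 6 _⊞_
  _⊞_ : Vec ℤ n → Vec ℤ n → Vec ℤ n
  _⊞_ = Vec.zipWith ℤ._+_

  infixr 7 _⊡_
  _⊡_ : ℤ → Vec ℤ n → Vec ℤ n
  a ⊡ f = Vec.map (a ℤ.*_) f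

  ∙-⊞ : ∀ (f g : Vec ℤ n) v → (f ⊞ g) ∙ v ≈ f ∙ v + g ∙ v
  ∙-⊞ []      []      []      = ≈-sym (+-identityˡ 0#)
  ∙-⊞ (a ∷ f) (b ∷ g) (x ∷ v) =
    ≈-trans (+-cong (•-distribʳ a b x) (∙-⊞ f g v)) (+-interchange _ _ _ _)

  ∙-⊡ : ∀ a (f : Vec ℤ n) v → (a ⊡ f) ∙ v ≈ a • (f ∙ v)
  ∙-⊡ a []      []      = ≈-sym (•-zeroʳ a)
  ∙-⊡ a (b ∷ f) (x ∷ v) =
    ≈-trans (+-cong (•-assoc a b x) (∙-⊡ a f v)) (≈-sym (•-distribˡ a _ _))

  𝟘 : Vec ℤ n
  𝟘 = Vec.replicate _ 0ℤ

  unit : Fin n → Vec ℤ n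
  unit zero    = 1ℤ ∷ 𝟘
  unit (suc i) = 0ℤ ∷ unit i

  𝟘-∙ : (v : Vec Carrier n) → 𝟘 ∙ v ≈ 0#
  𝟘-∙ []      = ≈-refl
  𝟘-∙ (x ∷ v) = ≈-trans (+-identityˡ _) (𝟘-∙ v)

  unit-∙ : ∀ (i : Fin n) v → unit i ∙ v ≈ lookup v i
  unit-∙ zero    (x ∷ v) = ≈-trans (+-cong (1• x) (𝟘-∙ v)) (+-identityʳ x)
  unit-∙ (suc i) (x ∷ v) = ≈-trans (+-identityˡ _) (unit-∙ i v)

  infix  8 ⊖_
  infixl 6 _⊕_ _⊝_
  infixr 7 _⊙_
  -- Syntax for a reflective solver: both sides of an identity are normalised to integer coefficient
  -- vectors. With numeral coefficients these agree by `refl`; symbolic coefficients under `_⊙_`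
  -- leave ring identities in ℤ.
  data Expr (n : ℕ) : Set where
    var     : Fin n → Expr n
    𝟎       : Expr n
    _⊕_     : Expr n → Expr n → Expr n
    ⊖_      : Expr n → Expr n
    _⊙_     : ℤ → Expr n → Expr n

  _⊝_ : Expr n → Expr n → Expr n
  s ⊝ t = s ⊕ ⊖ t

  ⟪_⟫ : Expr n → Vec Carrier n → Carrier
  ⟪ var i ⟫ v = lookup v i
  ⟪ 𝟎 ⟫     v = 0#
  ⟪ s ⊕ t ⟫ v = ⟪ s ⟫ v + ⟪ t ⟫ v
  ⟪ ⊖ t ⟫   v = - ⟪ t ⟫ v
  ⟪ a ⊙ t ⟫ v = a • ⟪ t ⟫ v

  normalise : Expr n → Vec ℤ n
  normalise (var i) = unit i
  normalise 𝟎       = 𝟘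
  normalise (s ⊕ t) = normalise s ⊞ normalise t
  normalise (⊖ t)   = -1ℤ ⊡ normalise t
  normalise (a ⊙ t) = a ⊡ normalise t

  normalise-sound : ∀ (t : Expr n) v → ⟪ t ⟫ v ≈ normalise t ∙ v
  normalise-sound (var i) v = ≈-sym (unit-∙ i v)
  normalise-sound 𝟎       v = ≈-sym (𝟘-∙ v)
  normalise-sound (s ⊕ t) v =
    ≈-trans (+-cong (normalise-sound s v) (normalise-sound t v)) (≈-sym (∙-⊞ (normalise s) (normalise t) v))
  normalise-sound (⊖ t)   v =
    ≈-trans (-‿cong (normalise-sound t v))
            (≈-trans (≈-sym (-1• _)) (≈-sym (∙-⊡ -1ℤ (normalise t) v)))
  normalise-sound (a ⊙ t) v =
    ≈-trans (•-congʳ a (normalise-sound t v)) (≈-sym (∙-⊡ a (normalise t) v))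

  ∙-congˡ : ∀ {f g : Vec ℤ n} v → f ≡ g → f ∙ v ≈ g ∙ v
  ∙-congˡ v refl = ≈-refl

  solve : ∀ (s t : Expr n) v → normalise s ≡ normalise t → ⟪ s ⟫ v ≈ ⟪ t ⟫ v
  solve s t v e =
    ≈-trans (normalise-sound s v) (≈-trans (∙-congˡ v e) (≈-sym (normalise-sound t v)))

  Pos : Carrier → Set ℓ
  Pos x = 0# < x

  Pos-resp : ∀ {x y} → x ≈ y → Pos x → Pos y
  Pos-resp = <-respʳ

  Pos-+ : ∀ {x y} → Pos x → Pos y → Pos (x + y)
  Pos-+ {x} {y} 0<x 0<y = <-trans 0<y (<-respˡ (+-identityˡ y) (+-monoˡ-< y 0<x))

  Pos-× : ∀ n {x} → Pos x → Pos (suc n ×′ x)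
  Pos-× zero    0<x = Pos-resp (≈-sym (+-identityʳ _)) 0<x
  Pos-× (suc n) 0<x = Pos-+ 0<x (Pos-× n 0<x)

  <⇒Pos : ∀ {x y} → x < y → Pos (y - x)
  <⇒Pos {x} x<y = <-respˡ (-‿inverseʳ x) (+-monoˡ-< (- x) x<y)

  v₀ : Expr (suc n)
  v₀ = var zero
  v₁ : Expr (suc (suc n))
  v₁ = var (suc zero)
  v₂ : Expr (suc (suc (suc n)))
  v₂ = var (suc (suc zero))
  v₃ : Expr (suc (suc (suc (suc n))))
  v₃ = var (suc (suc (suc zero)))
  v₄ : Expr (suc (suc (suc (suc (suc n)))))
  v₄ = var (suc (suc (suc (suc zero))))
  v₅ : Expr (suc (suc (suc (suc (suc (suc n))))))
  v₅ = var (suc (suc (suc (suc (suc zero)))))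

  Pos⇒< : ∀ {x y} → Pos (y - x) → x < y
  Pos⇒< {x} {y} h = <-respˡ (+-identityˡ x)
    (<-respʳ (solve (v₀ ⊝ v₁ ⊕ v₁) v₀ (y ∷ x ∷ []) refl) (+-monoˡ-< x h))

  •-neg : ∀ a x → a • (- x) ≈ - (a • x)
  •-neg a x = begin
    a • - x             ≈⟨ •-congʳ a (-1• x) ⟨
    a • -1ℤ • x         ≈⟨ •-assoc a -1ℤ x ⟨
    (a ℤ.* -1ℤ) • x     ≈⟨ •-congˡ x (ℤ.*-comm a -1ℤ) ⟩
    (-1ℤ ℤ.* a) • x     ≈⟨ •-assoc -1ℤ a x ⟩
    -1ℤ • a • x         ≈⟨ -1• _ ⟩
    - (a • x)           ∎

  IsSgn : Carrier → Sgn → Set ℓ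
  IsSgn x neg = Pos (- x)
  IsSgn x zer = x ≈ 0#
  IsSgn x pos = Pos x

  IsSgn-resp : ∀ {x y} s → x ≈ y → IsSgn x s → IsSgn y s
  IsSgn-resp neg e = Pos-resp (-‿cong e)
  IsSgn-resp zer e = ≈-trans (≈-sym e)
  IsSgn-resp pos e = Pos-resp e

  sgn : Carrier → Sgn
  sgn x with compare x 0#
  ... | tri< _ _ _ = neg
  ... | tri≈ _ _ _ = zer
  ... | tri> _ _ _ = pos

  sgn-is : ∀ x → IsSgn x (sgn x)
  sgn-is x with compare x 0#
  ... | tri< x<0 _ _ = Pos-resp (+-identityˡ _) (<⇒Pos x<0)
  ... | tri≈ _ x≈0 _ = x≈0
  ... | tri> _ _ x>0 = x>0

  Pos-asym : ∀ {x} → Pos x → ¬ Pos (- x)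
  Pos-asym {x} p q = <-irrefl (≈-sym (-‿inverseʳ x)) (Pos-+ p q)

  Pos-≉0 : ∀ {x} → Pos x → ¬ x ≈ 0#
  Pos-≉0 p e = <-irrefl (≈-sym e) p

  IsSgn-unique : ∀ {x} s t → IsSgn x s → IsSgn x t → s ≡ t
  IsSgn-unique neg neg p q = refl
  IsSgn-unique neg zer p q = contradiction (≈-trans (-‿cong q) -0≈0) (Pos-≉0 p)
  IsSgn-unique neg pos p q = contradiction p (Pos-asym q)
  IsSgn-unique zer neg p q = contradiction (≈-trans (-‿cong p) -0≈0) (Pos-≉0 q)
  IsSgn-unique zer zer p q = refl
  IsSgn-unique zer pos p q = contradiction p (Pos-≉0 q)
  IsSgn-unique pos neg p q = contradiction q (Pos-asym p)
  IsSgn-unique pos zer p q = contradiction q (Pos-≉0 p)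
  IsSgn-unique pos pos p q = refl

  IsSgn⇒sgn : ∀ {x} s → IsSgn x s → sgn x ≡ s
  IsSgn⇒sgn {x} s = IsSgn-unique (sgn x) s (sgn-is x)

  sgn⇒IsSgn : ∀ {x s} → sgn x ≡ s → IsSgn x s
  sgn⇒IsSgn {x} refl = sgn-is x

  sgn-cong : ∀ {x y} → x ≈ y → sgn x ≡ sgn y
  sgn-cong {x} {y} e = IsSgn⇒sgn (sgn y) (IsSgn-resp (sgn y) (≈-sym e) (sgn-is y))

  sgn-zer : ∀ {x y} → sgn x ≡ sgn y → x ≈ 0# → y ≈ 0#
  sgn-zer e x≈0 = sgn⇒IsSgn {s = zer} (≡.trans (≡.sym e) (IsSgn⇒sgn zer x≈0))

  IsSgn-• : ∀ a {x} s → IsSgn x s → IsSgn (a • x) (sgnℤ a ⊗ s)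
  IsSgn-• (+ 0)         s   p = ≈-refl
  IsSgn-• a@(+ (suc n)) neg p = Pos-resp (•-neg a _) (Pos-× n p)
  IsSgn-• a@(+ (suc n)) zer p = ≈-trans (•-congʳ a p) (•-zeroʳ a)
  IsSgn-• (+ (suc n))   pos p = Pos-× n p
  IsSgn-• -[1+ n ]      neg p = Pos-resp (•-neg (+ suc n) _) (Pos-× n p)
  IsSgn-• a@(-[1+ n ])  zer p = ≈-trans (•-congʳ a p) (•-zeroʳ a)
  IsSgn-• -[1+ n ]      pos p = Pos-resp (≈-sym (-‿involutive _)) (Pos-× n p)

  sgn-• : ∀ a x → sgn (a • x) ≡ sgnℤ a ⊗ sgn x
  sgn-• a x = IsSgn⇒sgn _ (IsSgn-• a (sgn x) (sgn-is x))

  -- Signs multiply under `_•_`, and the nonzero sign of `a` can be cancelled.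
  •-torsion-free : ∀ {a x} → a ≢ 0ℤ → a • x ≈ 0# → x ≈ 0#
  •-torsion-free {a} {x} a≢0 e = sgn⇒IsSgn {s = zer} (⊗-cancelˡ (sgnℤ-≢ a≢0)
    (≡.trans (≡.sym (sgn-• a x)) (≡.trans (IsSgn⇒sgn zer e) (⊗-zeroʳ (sgnℤ a)))))

  •-divide : ∀ {a} x → a ≢ 0ℤ → ∃[ y ] a • y ≈ x
  •-divide {+ 0}       x a≢0 = contradiction refl a≢0
  •-divide {+ (suc n)} x a≢0 = divide n x
  •-divide {a@(-[1+ n ])} x a≢0 = let (y , e) = divide n x in
    - y , ≈-trans (-‿cong (•-neg (+ suc n) y)) (≈-trans (-‿involutive _) e)

-- Linear orders

module Comparison (O : StrictTotalOrder a b ℓ) where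
  open StrictTotalOrder O

  cmp : Carrier → Carrier → Sgn
  cmp x y with compare x y
  ... | tri< _ _ _ = neg
  ... | tri≈ _ _ _ = zer
  ... | tri> _ _ _ = pos

  cmp-< : ∀ {x y} → x < y → cmp x y ≡ neg
  cmp-< {x} {y} x<y with compare x y
  ... | tri< _ _ _ = refl
  ... | tri≈ x≮y _ _ = contradiction x<y x≮y
  ... | tri> x≮y _ _ = contradiction x<y x≮y

  cmp-≈ : ∀ {x y} → x ≈ y → cmp x y ≡ zer
  cmp-≈ {x} {y} x≈y with compare x y
  ... | tri< _ x≉y _ = contradiction x≈y x≉y
  ... | tri≈ _ _ _ = refl
  ... | tri> _ x≉y _ = contradiction x≈y x≉y

  cmp-> : ∀ {x y} → y < x → cmp x y ≡ pos
  cmp-> {x} {y} x>y with compare x y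
  ... | tri< _ _ x≯y = contradiction x>y x≯y
  ... | tri≈ _ _ x≯y = contradiction x>y x≯y
  ... | tri> _ _ _ = refl

  <-cmp : ∀ {x y} → cmp x y ≡ neg → x < y
  <-cmp {x} {y} e with compare x y
  <-cmp e | tri< x<y _ _ = x<y

  ≈-cmp : ∀ {x y} → cmp x y ≡ zer → x ≈ y
  ≈-cmp {x} {y} e with compare x y
  ≈-cmp e | tri≈ _ x≈y _ = x≈y

  >-cmp : ∀ {x y} → cmp x y ≡ pos → y < x
  >-cmp {x} {y} e with compare x y
  >-cmp e | tri> _ _ x>y = x>y

  cmp-cong : ∀ {x x′ y y′} → x ≈ x′ → y ≈ y′ → cmp x y ≡ cmp x′ y′
  cmp-cong {x} {x′} {y} {y′} e f with compare x y
  ... | tri< x<y _ _ = ≡.sym (cmp-< (<-respˡ-≈ e (<-respʳ-≈ f x<y)))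
  ... | tri≈ _ x≈y _ = ≡.sym (cmp-≈ (Eq.trans (Eq.sym e) (Eq.trans x≈y f)))
  ... | tri> _ _ x>y = ≡.sym (cmp-> (<-respˡ-≈ f (<-respʳ-≈ e x>y)))

  ≮-<-trans : ∀ {x y z} → ¬ y < x → y < z → x < z
  ≮-<-trans {x} {y} y≮x y<z with compare x y
  ... | tri< x<y _ _ = trans x<y y<z
  ... | tri≈ _ x≈y _ = <-respˡ-≈ (Eq.sym x≈y) y<z
  ... | tri> _ _ y<x = contradiction y<x y≮x

  -- Maximality is stated as the absence of a larger key, so ties are harmless, and the same lemma
  -- over the flipped order yields a least element.
  greatest : ∀ {X : Set c} {P : Pred X p} → Decidable P → (key : X → Carrier) (xs : List X) →
             (∀ {x} → x ∈ xs → ¬ P x) ⊎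
             (∃[ z ] z ∈ xs × P z × (∀ {x} → x ∈ xs → P x → ¬ key z < key x))
  greatest P? key [] = inj₁ λ ()
  greatest P? key (x ∷ xs) with P? x | greatest P? key xs
  ... | no ¬Px | inj₁ none = inj₁ λ { (here refl) → ¬Px ; (there i) → none i }
  ... | no ¬Px | inj₂ (z , z∈xs , Pz , top) =
    inj₂ (z , there z∈xs , Pz , λ { (here refl) Px → contradiction Px ¬Px ; (there i) → top i })
  ... | yes Px | inj₁ none =
    inj₂ (x , here refl , Px , λ { (here refl) _ → irrefl Eq.refl ; (there i) Py → contradiction Py (none i) })
  ... | yes Px | inj₂ (z , z∈xs , Pz , top) with key z <? key x
  ...   | yes z<x = inj₂ (x , here refl , Px , λ
          { (here refl) _ → irrefl Eq.refl
          ; (there i) Py x<y → top i Py (trans z<x x<y) })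
  ...   | no z≮x = inj₂ (z , there z∈xs , Pz , λ { (here refl) _ → z≮x ; (there i) → top i })

record DenseLinearOrder a b ℓ : Set (lsuc (a ⊔ b ⊔ ℓ)) where
  field
    strictTotalOrder : StrictTotalOrder a b ℓ
  open StrictTotalOrder strictTotalOrder public
  field
    point : Carrier
    dense : ∀ {x y} → x < y → ∃[ z ] x < z × z < y
    below : ∀ x → ∃[ y ] y < x
    above : ∀ x → ∃[ y ] x < y

module OnePoint {a′ b′ ℓ′} (A : StrictTotalOrder a b ℓ) (B : DenseLinearOrder a′ b′ ℓ′) where
  private
    module A  = StrictTotalOrder A
    module A′ = Comparison A
    module B  = DenseLinearOrder B
    module B′ = Comparison B.strictTotalOrder
    module A° = Comparison (Flip.strictTotalOrder A)

  Partial : Set (a ⊔ a′)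
  Partial = List (A.Carrier × B.Carrier)

  OrderPreserving : Partial → Set (a ⊔ a′)
  OrderPreserving L = ∀ {p q} → p ∈ L → q ∈ L →
    A′.cmp (proj₁ p) (proj₁ q) ≡ B′.cmp (proj₂ p) (proj₂ q)

  -- Cantor's back-and-forth step. If `x` equals a listed point, it receives that point's partner.
  -- Otherwise only the greatest listed point below `x` and the least one above it constrain `y`;
  -- density, or the absence of endpoints if one of them is missing, supplies `y`.
  extend : ∀ L → OrderPreserving L → ∀ x →
           ∃[ y ] (∀ {p} → p ∈ L → A′.cmp (proj₁ p) x ≡ B′.cmp (proj₂ p) y)
  extend L iso x
    with A′.greatest (λ p → proj₁ p A.≟ x) proj₁ L
  ... | inj₂ (z , z∈L , z≈x , _) =
    proj₂ z , λ p∈L → ≡.trans (A′.cmp-cong A.Eq.refl (A.Eq.sym z≈x)) (iso p∈L z∈L)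
  ... | inj₁ none = y , same
    where
    between : ∃[ y ]
      (∀ {p} → p ∈ L → proj₁ p A.< x → proj₂ p B.< y) ×
      (∀ {p} → p ∈ L → x A.< proj₁ p → y B.< proj₂ p)
    lowers : ∀ {z y} → z ∈ L → (∀ {p} → p ∈ L → proj₁ p A.< x → ¬ proj₁ z A.< proj₁ p) →
             proj₂ z B.< y → ∀ {p} → p ∈ L → proj₁ p A.< x → proj₂ p B.< y
    lowers z∈L top z<y p∈L p<x = B′.≮-<-trans
      (λ z<p → top p∈L p<x (A′.<-cmp (≡.trans (iso z∈L p∈L) (B′.cmp-< z<p)))) z<y
    uppers : ∀ {z y} → z ∈ L → (∀ {p} → p ∈ L → x A.< proj₁ p → ¬ proj₁ p A.< proj₁ z) →
             y B.< proj₂ z → ∀ {p} → p ∈ L → x A.< proj₁ p → y B.< proj₂ p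
    uppers {z} {y} z∈L bot y<z {p} p∈L x<p with B.compare y (proj₂ p)
    ... | tri< y<p _ _ = y<p
    ... | tri≈ _ y≈p _ = contradiction
            (A′.<-cmp (≡.trans (iso p∈L z∈L) (B′.cmp-< (B.<-respˡ-≈ y≈p y<z)))) (bot p∈L x<p)
    ... | tri> _ _ p<y = contradiction
            (A′.<-cmp (≡.trans (iso p∈L z∈L) (B′.cmp-< (B.trans p<y y<z)))) (bot p∈L x<p)
    between with A′.greatest (λ p → proj₁ p A.<? x) proj₁ L
               | A°.greatest (λ p → x A.<? proj₁ p) proj₁ L
    ... | inj₁ none< | inj₁ none> =
      B.point , (λ i h → contradiction h (none< i)) , (λ i h → contradiction h (none> i))
    ... | inj₁ none< | inj₂ (w , w∈L , x<w , bot) = let (y , y<w) = B.below (proj₂ w) in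
      y , (λ i h → contradiction h (none< i)) , uppers w∈L bot y<w
    ... | inj₂ (z , z∈L , z<x , top) | inj₁ none> = let (y , z<y) = B.above (proj₂ z) in
      y , lowers z∈L top z<y , (λ i h → contradiction h (none> i))
    ... | inj₂ (z , z∈L , z<x , top) | inj₂ (w , w∈L , x<w , bot) =
      let (y , z<y , y<w) = B.dense (B′.<-cmp
            (≡.trans (≡.sym (iso z∈L w∈L)) (A′.cmp-< (A.trans z<x x<w))))
      in y , lowers z∈L top z<y , uppers w∈L bot y<w
    y = proj₁ between
    same : ∀ {p} → p ∈ L → A′.cmp (proj₁ p) x ≡ B′.cmp (proj₂ p) y
    same {p} p∈L with A.compare (proj₁ p) x
    ... | tri< p<x _ _ = ≡.sym (B′.cmp-< (proj₁ (proj₂ between) p∈L p<x))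
    ... | tri≈ _ p≈x _ = contradiction p≈x (none p∈L)
    ... | tri> _ _ x<p = ≡.sym (B′.cmp-> (proj₂ (proj₂ between) p∈L x<p))

-- Linear forms over an ordered group

module Betweenness (G : OrderedGroup c ℓ) where
  open OrderedGroupProperties G

  strictTotalOrder : StrictTotalOrder c ℓ ℓ
  strictTotalOrder = record { isStrictTotalOrder = isStrictTotalOrder }

  NonNeg : Carrier → Set ℓ
  NonNeg x = Pos x ⊎ x ≈ 0#

  NonNeg-resp : ∀ {x y} → x ≈ y → NonNeg x → NonNeg y
  NonNeg-resp e (inj₁ p) = inj₁ (Pos-resp e p)
  NonNeg-resp e (inj₂ z) = inj₂ (≈-trans (≈-sym e) z)

  Pos-NonNeg-+ : ∀ {x y} → Pos x → NonNeg y → Pos (x + y)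
  Pos-NonNeg-+ p (inj₁ q) = Pos-+ p q
  Pos-NonNeg-+ p (inj₂ z) = Pos-resp (≈-sym (≈-trans (+-congˡ z) (+-identityʳ _))) p

  NonNeg-+ : ∀ {x y} → NonNeg x → NonNeg y → NonNeg (x + y)
  NonNeg-+ (inj₁ p) q = inj₁ (Pos-NonNeg-+ p q)
  NonNeg-+ (inj₂ z) q = NonNeg-resp (≈-sym (≈-trans (+-congʳ z) (+-identityˡ _))) q

  NonNeg-total : ∀ x → NonNeg x ⊎ NonNeg (- x)
  NonNeg-total x with sgn x | sgn-is x
  ... | neg | p = inj₂ (inj₁ p)
  ... | zer | p = inj₁ (inj₂ p)
  ... | pos | p = inj₁ (inj₁ p)

  ≮⇒NonNeg : ∀ {x y} → ¬ x < y → NonNeg (x - y)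
  ≮⇒NonNeg {x} {y} x≮y with compare x y
  ... | tri< x<y _ _ = contradiction x<y x≮y
  ... | tri≈ _ x≈y _ = inj₂ (≈-trans (+-congʳ x≈y) (-‿inverseʳ y))
  ... | tri> _ _ y<x = inj₁ (<⇒Pos y<x)

  NonNeg-• : ∀ n {x} → NonNeg x → NonNeg ((+ n) • x)
  NonNeg-• zero    h = inj₂ ≈-refl
  NonNeg-• (suc n) h = NonNeg-+ h (NonNeg-• n h)

  -- `y₀` lies in the closed interval with endpoints 0 and `y`, on either side of 0. This stands for
  -- `y₀` being `y` times a ratio in [0,1]; integer multiples preserve it, and nonzero ones also
  -- reflect it.
  Between : Carrier → Carrier → Set ℓ
  Between y₀ y = (NonNeg y₀ × NonNeg (y - y₀)) ⊎ (NonNeg (- y₀) × NonNeg (y₀ - y))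

  Between-resp : ∀ {x₀ x y₀ y} → x₀ ≈ y₀ → x ≈ y → Between x₀ x → Between y₀ y
  Between-resp e f (inj₁ (g , h)) =
    inj₁ (NonNeg-resp e g , NonNeg-resp (+-cong f (-‿cong e)) h)
  Between-resp e f (inj₂ (g , h)) =
    inj₂ (NonNeg-resp (-‿cong e) g , NonNeg-resp (+-cong e (-‿cong f)) h)

  Between-neg : ∀ {x₀ x} → Between x₀ x → Between (- x₀) (- x)
  Between-neg {x₀} {x} (inj₁ (g , h)) = inj₂
    (NonNeg-resp (≈-sym (-‿involutive x₀)) g ,
     NonNeg-resp (solve (v₁ ⊝ v₀) (⊖ v₀ ⊝ ⊖ v₁) (x₀ ∷ x ∷ []) refl) h)
  Between-neg {x₀} {x} (inj₂ (g , h)) = inj₁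
    (g , NonNeg-resp (solve (v₀ ⊝ v₁) (⊖ v₁ ⊝ ⊖ v₀) (x₀ ∷ x ∷ []) refl) h)

  Between-×′ : ∀ n {x₀ x} → Between x₀ x → Between ((+ n) • x₀) ((+ n) • x)
  Between-×′ n (inj₁ (g , h)) = inj₁ (NonNeg-• n g ,
    NonNeg-resp (≈-trans (•-distribˡ (+ n) _ _) (+-congˡ (•-neg (+ n) _))) (NonNeg-• n h))
  Between-×′ n (inj₂ (g , h)) = inj₂ (NonNeg-resp (•-neg (+ n) _) (NonNeg-• n g) ,
    NonNeg-resp (≈-trans (•-distribˡ (+ n) _ _) (+-congˡ (•-neg (+ n) _))) (NonNeg-• n h))

  Between-• : ∀ a {x₀ x} → Between x₀ x → Between (a • x₀) (a • x)
  Between-• (+ n)    h = Between-×′ n h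
  Between-• -[1+ n ] h = Between-neg (Between-×′ (suc n) h)

  NonNeg-cancel : ∀ n {x} → NonNeg ((+ suc n) • x) → NonNeg x
  NonNeg-cancel n {x} h with NonNeg-total x
  ... | inj₁ g = g
  ... | inj₂ (inj₂ z) = inj₂ (≈-trans (≈-sym (-‿involutive x)) (≈-trans (-‿cong z) -0≈0))
  ... | inj₂ (inj₁ g) = contradiction
    (Pos-resp (≈-trans (+-congʳ (•-neg (+ suc n) x)) (-‿inverseˡ _)) (Pos-NonNeg-+ (Pos-× n g) h))
    (<-irrefl ≈-refl)

  Between-cancel-×′ : ∀ n {x₀ x} → Between ((+ suc n) • x₀) ((+ suc n) • x) → Between x₀ x
  Between-cancel-×′ n (inj₁ (g , h)) = inj₁ (NonNeg-cancel n g ,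
    NonNeg-cancel n (NonNeg-resp
      (≈-sym (≈-trans (•-distribˡ (+ suc n) _ _) (+-congˡ (•-neg (+ suc n) _)))) h))
  Between-cancel-×′ n (inj₂ (g , h)) = inj₂
    (NonNeg-cancel n (NonNeg-resp (≈-sym (•-neg (+ suc n) _)) g) ,
     NonNeg-cancel n (NonNeg-resp
      (≈-sym (≈-trans (•-distribˡ (+ suc n) _ _) (+-congˡ (•-neg (+ suc n) _)))) h))

  Between-cancel : ∀ {a x₀ x} → a ≢ 0ℤ → Between (a • x₀) (a • x) → Between x₀ x
  Between-cancel {+ 0}       a≢0 h = contradiction refl a≢0
  Between-cancel {+ (suc n)} a≢0 h = Between-cancel-×′ n h
  Between-cancel { -[1+ n ]} a≢0 h = Between-cancel-×′ n
    (Between-resp (-‿involutive _) (-‿involutive _) (Between-neg h))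

  private
    Side : Carrier → Set ℓ
    Side d = NonNeg d ⊎ NonNeg (- d)

    -- A pair `(r₀ , r)` confines `x₀` to the interval with endpoints `r₀` and `r₀ + (x - r)`. With
    -- `d = x - r` this is the lower of the two.
    floor : ∀ {d} → Side d → Carrier → Carrier
    floor     (inj₁ _) r = r
    floor {d} (inj₂ _) r = r + d

    -- If the lower end contributed by `(z₀ , z)` is at least that of `(r₀ , r)`, it also stays
    -- below the upper end of the latter, because `z₀ - r₀` is between 0 and `z - r`. The cases
    -- follow the order of `x`, `r` and `z`.
    floor-between : ∀ {x r r₀ z z₀} (s : Side (x - r)) (t : Side (x - z)) →
      NonNeg (floor t z₀ - floor s r₀) → Between (z₀ - r₀) (z - r) →
      Between (floor t z₀ - r₀) (x - r)
    floor-between {x} {r} {r₀} {z} {z₀} = go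
      where
      V = x ∷ r ∷ r₀ ∷ z ∷ z₀ ∷ []
      go : ∀ (s : Side (x - r)) (t : Side (x - z)) →
        NonNeg (floor t z₀ - floor s r₀) → Between (z₀ - r₀) (z - r) →
        Between (floor t z₀ - r₀) (x - r)
      go (inj₁ hx) (inj₁ hz) m (inj₁ (_ , b)) = inj₁ (m , NonNeg-resp
        (solve ((v₃ ⊝ v₁ ⊝ (v₄ ⊝ v₂)) ⊕ (v₀ ⊝ v₃)) (v₀ ⊝ v₁ ⊝ (v₄ ⊝ v₂)) V
          refl)
        (NonNeg-+ b hz))
      go (inj₁ hx) (inj₁ hz) m (inj₂ (b , _)) = inj₁ (m , NonNeg-+ hx b)
      go (inj₁ hx) (inj₂ hz) m (inj₁ (_ , b)) = inj₁ (m , NonNeg-resp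
        (solve (v₃ ⊝ v₁ ⊝ (v₄ ⊝ v₂)) (v₀ ⊝ v₁ ⊝ (v₄ ⊕ (v₀ ⊝ v₃) ⊝ v₂)) V
          refl)
        b)
      go (inj₁ hx) (inj₂ hz) m (inj₂ (b , _)) = inj₁ (m , NonNeg-resp
        (solve (v₀ ⊝ v₁ ⊕ (⊖ (v₀ ⊝ v₃) ⊕ ⊖ (v₄ ⊝ v₂))) (v₀ ⊝ v₁ ⊝ (v₄ ⊕ (v₀ ⊝ v₃) ⊝ v₂)) V
          refl)
        (NonNeg-+ hx (NonNeg-+ hz b)))
      go (inj₂ hx) (inj₁ hz) m (inj₂ (b , _)) = inj₂ (b , NonNeg-resp
        (solve (v₄ ⊝ (v₂ ⊕ (v₀ ⊝ v₁))) (v₄ ⊝ v₂ ⊝ (v₀ ⊝ v₁)) V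
          refl) m)
      go (inj₂ hx) (inj₁ hz) m (inj₁ (_ , b)) = inj₂
        (NonNeg-resp
          (solve ((v₃ ⊝ v₁ ⊝ (v₄ ⊝ v₂)) ⊕ (v₀ ⊝ v₃ ⊕ ⊖ (v₀ ⊝ v₁))) (⊖ (v₄ ⊝ v₂)) V
            refl)
          (NonNeg-+ b (NonNeg-+ hz hx)) ,
         NonNeg-resp
          (solve (v₄ ⊝ (v₂ ⊕ (v₀ ⊝ v₁))) (v₄ ⊝ v₂ ⊝ (v₀ ⊝ v₁)) V
            refl) m)
      go (inj₂ hx) (inj₂ hz) m (inj₁ (_ , b)) = inj₂
        (NonNeg-resp
          (solve ((v₃ ⊝ v₁ ⊝ (v₄ ⊝ v₂)) ⊕ ⊖ (v₀ ⊝ v₁)) (⊖ (v₄ ⊕ (v₀ ⊝ v₃) ⊝ v₂)) V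
            refl)
          (NonNeg-+ b hx) ,
         NonNeg-resp
          (solve (v₄ ⊕ (v₀ ⊝ v₃) ⊝ (v₂ ⊕ (v₀ ⊝ v₁))) (v₄ ⊕ (v₀ ⊝ v₃) ⊝ v₂ ⊝ (v₀ ⊝ v₁)) V
            refl) m)
      go (inj₂ hx) (inj₂ hz) m (inj₂ (b , _)) = inj₂
        (NonNeg-resp
          (solve (⊖ (v₄ ⊝ v₂) ⊕ ⊖ (v₀ ⊝ v₃)) (⊖ (v₄ ⊕ (v₀ ⊝ v₃) ⊝ v₂)) V
            refl)
          (NonNeg-+ b hz) ,
         NonNeg-resp
          (solve (v₄ ⊕ (v₀ ⊝ v₃) ⊝ (v₂ ⊕ (v₀ ⊝ v₁))) (v₄ ⊕ (v₀ ⊝ v₃) ⊝ v₂ ⊝ (v₀ ⊝ v₁)) V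
            refl) m)

  -- Helly's theorem on the line: the hypothesis makes the intervals that confine `x₀` meet
  -- pairwise, and then the greatest of their lower ends lies in all of them.
  Between-extend : ∀ (L : List (Carrier × Carrier)) →
    (∀ {p q} → p ∈ L → q ∈ L → Between (proj₁ p - proj₁ q) (proj₂ p - proj₂ q)) →
    ∀ x → ∃[ x₀ ] (∀ {p} → p ∈ L → Between (x₀ - proj₁ p) (x - proj₂ p))
  Between-extend L L-between x
    with Comparison.greatest strictTotalOrder {P = λ _ → ⊤} (λ _ → yes tt) level L
    where
    level : Carrier × Carrier → Carrier
    level p = floor (NonNeg-total (x - proj₂ p)) (proj₁ p)
  ... | inj₁ none = 0# , λ i → contradiction tt (none i)
  ... | inj₂ (z , z∈L , _ , top) = floor (NonNeg-total (x - proj₂ z)) (proj₁ z) , λ {p} p∈L →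
    floor-between (NonNeg-total (x - proj₂ p)) (NonNeg-total (x - proj₂ z))
      (≮⇒NonNeg (top p∈L tt)) (L-between z∈L p∈L)

-- Elimination of a variable from affine forms

Form : ∀ {c} → Set c → ℕ → Set c
Form C n = Vec ℤ n × C

-- Two linear theories side by side: forms with constants in C are evaluated
-- through ε₁ on the left and ε₂ on the right, and a relation between their
-- values is propagated one coordinate at a time.
module Extension (G : OrderedGroup c ℓ) {C : Set a}
  (combine : ℤ → C → ℤ → C → C) where
  open OrderedGroupProperties G

  dropHead : Form C (suc n) → Form C n
  dropHead (_ ∷ f , k) = f , k

  -- Cross-multiplication cancels the head variable: `b` times the first form minus `a` times the
  -- second. If both head coefficients are nonzero, the result measures the distance between the two
  -- roots, up to the factor `- (a * b)`.
  eliminate : Form C (suc n) → Form C (suc n) → Form C n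
  eliminate (a ∷ f , k) (b ∷ g , l) = b ⊡ f ⊞ (ℤ.- a) ⊡ g , combine b k a l

  derive : List (Form C (suc n)) → List (Form C n)
  derive H = List.map dropHead H List.++ cartesianProductWith eliminate H H

  value : (C → Carrier) → Form C n → Vec Carrier n → Carrier
  value ε (f , k) v = f ∙ v + ε k

  module _ (ε₁ ε₂ : C → Carrier)
    (ε₁-combine : ∀ b k a l → ε₁ (combine b k a l) ≈ b • ε₁ k - a • ε₁ l)
    (ε₂-combine : ∀ b k a l → ε₂ (combine b k a l) ≈ b • ε₂ k - a • ε₂ l)
    (_~_ : Carrier → Carrier → Set p)
    (~-resp : ∀ {x x′ y y′} → x ≈ x′ → y ≈ y′ → x ~ y → x′ ~ y′)
    (~-• : ∀ z {x y} → x ~ y → (z • x) ~ (z • y))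
    (~-cancel : ∀ {z x y} → z ≢ 0ℤ → (z • x) ~ (z • y) → x ~ y)
    (~-extend : ∀ (L : List (Carrier × Carrier)) →
      (∀ {p q} → p ∈ L → q ∈ L → (proj₁ p - proj₁ q) ~ (proj₂ p - proj₂ q)) →
      ∀ x → ∃[ x′ ] (∀ {p} → p ∈ L → (x′ - proj₁ p) ~ (x - proj₂ p)))
    where

    private
      IsRoot : (C → Carrier) → Vec Carrier n → Form C (suc n) → Carrier → Set ℓ
      IsRoot ε v (a ∷ f , k) r = a • r + value ε (f , k) v ≈ 0#

      root : ∀ ε (v : Vec Carrier n) a f k → a ≢ 0ℤ → ∃[ r ] IsRoot ε v (a ∷ f , k) r
      root ε v a f k a≢0 = let (r , e) = •-divide (- value ε (f , k) v) a≢0 in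
        r , ≈-trans (+-congʳ e) (-‿inverseˡ _)

      value-eliminate : ∀ ε → (∀ b k a l → ε (combine b k a l) ≈ b • ε k - a • ε l) →
        ∀ (v : Vec Carrier n) {a f k b g l r s} →
        IsRoot ε v (a ∷ f , k) r → IsRoot ε v (b ∷ g , l) s →
        value ε (eliminate (a ∷ f , k) (b ∷ g , l)) v ≈ (ℤ.- (a ℤ.* b)) • (r - s)
      value-eliminate ε ε-combine v {a} {f} {k} {b} {g} {l} {r} {s} hr hs = begin
        (b ⊡ f ⊞ (ℤ.- a) ⊡ g) ∙ v + ε (combine b k a l)
          ≈⟨ +-cong (≈-trans (∙-⊞ (b ⊡ f) _ v) (+-cong (∙-⊡ b f v) (∙-⊡ (ℤ.- a) g v)))
                    (ε-combine b k a l) ⟩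
        b • (f ∙ v) + (ℤ.- a) • (g ∙ v) + (b • ε k - a • ε l)
          ≈⟨ solve (b ⊙ v₀ ⊕ (ℤ.- a) ⊙ v₁ ⊕ (b ⊙ v₂ ⊝ a ⊙ v₃))
                   ((b ⊙ (a ⊙ v₄ ⊕ (v₀ ⊕ v₂)) ⊝ a ⊙ (b ⊙ v₅ ⊕ (v₁ ⊕ v₃))) ⊕ (ℤ.- (a ℤ.* b)) ⊙ (v₄ ⊝ v₅))
                   (f ∙ v ∷ g ∙ v ∷ ε k ∷ ε l ∷ r ∷ s ∷ [])
                   (Pointwise-≡⇒≡ (entry 1ℤ 0ℤ 0ℤ 0ℤ 0ℤ 0ℤ ∷ entry 0ℤ 1ℤ 0ℤ 0ℤ 0ℤ 0ℤ ∷ entry 0ℤ 0ℤ 1ℤ 0ℤ 0ℤ 0ℤ ∷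
                               entry 0ℤ 0ℤ 0ℤ 1ℤ 0ℤ 0ℤ ∷ entry 0ℤ 0ℤ 0ℤ 0ℤ 1ℤ 0ℤ ∷ entry 0ℤ 0ℤ 0ℤ 0ℤ 0ℤ 1ℤ ∷ [])) ⟩
        (b • (a • r + (f ∙ v + ε k)) - a • (b • s + (g ∙ v + ε l))) + (ℤ.- (a ℤ.* b)) • (r - s)
          ≈⟨ +-congʳ (+-cong (≈-trans (•-congʳ b hr) (•-zeroʳ b))
                             (-‿cong (≈-trans (•-congʳ a hs) (•-zeroʳ a)))) ⟩
        (0# - 0#) + (ℤ.- (a ℤ.* b)) • (r - s)
          ≈⟨ ≈-trans (+-congʳ (-‿inverseʳ 0#)) (+-identityˡ _) ⟩
        (ℤ.- (a ℤ.* b)) • (r - s) ∎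
        where
        -- As `a` and `b` are variables, the normal forms do not agree by `refl`. Each of the six
        -- coefficients is compared by the ring solver, the `xᵢ` being the entries of unit vectors.
        entry : ∀ x₀ x₁ x₂ x₃ x₄ x₅ → _
        entry = solveℤ 8 (λ a b x₀ x₁ x₂ x₃ x₄ x₅ →
          b :* x₀ :+ (:- a) :* x₁ :+ (b :* x₂ :+ con -1ℤ :* (a :* x₃)) :=
          (b :* (a :* x₄ :+ (x₀ :+ x₂)) :+ con -1ℤ :* (a :* (b :* x₅ :+ (x₁ :+ x₃))))
            :+ (:- (a :* b)) :* (x₄ :+ con -1ℤ :* x₅)) refl a b

      Roots : Vec Carrier n → Vec Carrier n → Form C (suc n) → Carrier × Carrier → Set ℓ
      Roots v w h p = Vec.head (proj₁ h) ≢ 0ℤ × IsRoot ε₁ v h (proj₁ p) × IsRoot ε₂ w h (proj₂ p)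

      -- Each form with nonzero head coefficient is solved for the head variable on both sides. The
      -- paired roots are the points to which `~-extend` is applied, and both directions of the
      -- correspondence with the forms are kept.
      roots : (v w : Vec Carrier n) (H : List (Form C (suc n))) →
        Σ[ L ∈ List (Carrier × Carrier) ]
          (∀ {p} → p ∈ L → ∃[ h ] h ∈ H × Roots v w h p) ×
          (∀ {h} → h ∈ H → Vec.head (proj₁ h) ≢ 0ℤ → ∃[ p ] p ∈ L × Roots v w h p)
      roots v w [] = [] , (λ ()) , (λ ())
      roots v w ((a ∷ f , k) ∷ H) with a ℤ.≟ 0ℤ | roots v w H
      ... | yes a≡0 | L , from , to = L ,
        (λ i → let (h , h∈H , r) = from i in h , there h∈H , r) ,
        λ { (here refl) a≢0 → contradiction a≡0 a≢0 ; (there i) → to i }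
      ... | no a≢0 | L , from , to =
        let (r , hr) = root ε₁ v a f k a≢0
            (s , hs) = root ε₂ w a f k a≢0
        in (r , s) ∷ L ,
        (λ { (here refl) → _ , here refl , a≢0 , hr , hs
           ; (there i) → let (h , h∈H , t) = from i in h , there h∈H , t }) ,
        λ { (here refl) _ → _ , here refl , a≢0 , hr , hs
          ; (there i) b≢0 → let (p , p∈L , t) = to i b≢0 in p , there p∈L , t }

      value-root : ∀ ε (v : Vec Carrier n) {a f k r} x → IsRoot ε v (a ∷ f , k) r →
        a • (x - r) ≈ value ε (a ∷ f , k) (x ∷ v)
      value-root ε v {a} {f} {k} {r} x hr = begin
        a • (x - r)
          ≈⟨ ≈-sym (+-identityʳ _) ⟩
        a • (x - r) + 0#
          ≈⟨ +-cong (≈-trans (•-distribˡ a x _) (+-congˡ (•-neg a r))) (≈-sym hr) ⟩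
        (a • x - a • r) + (a • r + (f ∙ v + ε k))
          ≈⟨ solve (v₀ ⊝ v₁ ⊕ (v₁ ⊕ (v₂ ⊕ v₃))) (v₀ ⊕ v₂ ⊕ v₃)
                   (a • x ∷ a • r ∷ f ∙ v ∷ ε k ∷ []) refl ⟩
        a • x + f ∙ v + ε k ∎

    -- A form with head coefficient `a ≠ 0` equals `a` times the difference between the head
    -- variable and its root, while the eliminated forms control the differences between roots. So
    -- it suffices to place `x′` among the roots on the left as `x` is placed on the right. Forms
    -- with `a = 0` are covered by `dropHead`.
    extend : ∀ (H : List (Form C (suc n))) {v w} →
      (∀ {h} → h ∈ derive H → value ε₁ h v ~ value ε₂ h w) →
      ∀ x → ∃[ x′ ] (∀ {h} → h ∈ H → value ε₁ h (x′ ∷ v) ~ value ε₂ h (x ∷ w))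
    extend H {v} {w} related x = x′ , conclude
      where
      L = proj₁ (roots v w H)

      L-related : ∀ {p q} → p ∈ L → q ∈ L → (proj₁ p - proj₁ q) ~ (proj₂ p - proj₂ q)
      L-related p∈L q∈L with proj₁ (proj₂ (roots v w H)) p∈L | proj₁ (proj₂ (roots v w H)) q∈L
      ... | (a ∷ f , k) , h∈H , a≢0 , r₁ , r₂ | (b ∷ g , l) , h′∈H , b≢0 , s₁ , s₂ =
        ~-cancel {ℤ.- (a ℤ.* b)} -ab≢0 (~-resp
          (value-eliminate ε₁ ε₁-combine v {a} {f} {k} {b} {g} {l} r₁ s₁)
          (value-eliminate ε₂ ε₂-combine w {a} {f} {k} {b} {g} {l} r₂ s₂)
          (related (∈-++⁺ʳ (List.map dropHead H) (∈-cartesianProductWith⁺ eliminate h∈H h′∈H))))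
        where
        -ab≢0 : ℤ.- (a ℤ.* b) ≢ 0ℤ
        -ab≢0 e with ℤ.i*j≡0⇒i≡0∨j≡0 a (ℤ.neg-injective {a ℤ.* b} {0ℤ} e)
        ... | inj₁ a≡0 = a≢0 a≡0
        ... | inj₂ b≡0 = b≢0 b≡0

      x′ = proj₁ (~-extend L L-related x)

      conclude : ∀ {h} → h ∈ H → value ε₁ h (x′ ∷ v) ~ value ε₂ h (x ∷ w)
      conclude {a ∷ f , k} h∈H with a ℤ.≟ 0ℤ
      ... | yes refl = ~-resp (+-congʳ (≈-sym (+-identityˡ _))) (+-congʳ (≈-sym (+-identityˡ _)))
                         (related (∈-++⁺ˡ (∈-map⁺ dropHead h∈H)))
      ... | no a≢0 with proj₂ (proj₂ (roots v w H)) h∈H a≢0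
      ...   | p , p∈L , _ , hr , hs = ~-resp (value-root ε₁ v {a} {f} {k} x′ hr)
                (value-root ε₂ w {a} {f} {k} x hs)
                (~-• a (proj₂ (~-extend L L-related x) p∈L))

-- Integer vectors and their action on tuples

infix 7 _·_
_·_ : Vec ℤ n → Vec ℤ n → ℤ
[]      · []      = 0ℤ
(a ∷ f) · (b ∷ u) = a ℤ.* b ℤ.+ f · u

·-comm : (f u : Vec ℤ n) → f · u ≡ u · f
·-comm []      []      = refl
·-comm (a ∷ f) (b ∷ u) = ≡.cong₂ ℤ._+_ (ℤ.*-comm a b) (·-comm f u)

bounded : ∀ {X : Set a} (f : X → ℕ) (xs : List X) → ∃[ N ] (∀ {x} → x ∈ xs → f x ℕ.≤ N)
bounded f []       = 0 , λ ()
bounded f (x ∷ xs) = let (N , h) = bounded f xs in f x ℕ.⊔ N , λ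
  { (here refl) → ℕ.m≤m⊔n (f x) N ; (there i) → ℕ.≤-trans (h i) (ℕ.m≤n⊔m (f x) N) }

module LinearAlgebra (G : OrderedGroup c ℓ) where
  open OrderedGroupProperties G

  ·-linearˡ : ∀ a b (f g u : Vec ℤ n) → (a ⊡ f ⊞ b ⊡ g) · u ≡ a ℤ.* (f · u) ℤ.+ b ℤ.* (g · u)
  ·-linearˡ a b []      []      []      = solveℤ 2 (λ a b → con 0ℤ := a :* con 0ℤ :+ b :* con 0ℤ) refl a b
  ·-linearˡ a b (x ∷ f) (y ∷ g) (z ∷ u) = ≡.trans
    (≡.cong (λ t → (a ℤ.* x ℤ.+ b ℤ.* y) ℤ.* z ℤ.+ t) (·-linearˡ a b f g u))
    (solveℤ 7 (λ a b x y z s t →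
      (a :* x :+ b :* y) :* z :+ (a :* s :+ b :* t) := a :* (x :* z :+ s) :+ b :* (y :* z :+ t))
      refl a b x y z (f · u) (g · u))

  ·-linearʳ : ∀ a b (f u w : Vec ℤ n) → f · (a ⊡ u ⊞ b ⊡ w) ≡ a ℤ.* (f · u) ℤ.+ b ℤ.* (f · w)
  ·-linearʳ a b f u w = ≡.trans (·-comm f _) (≡.trans (·-linearˡ a b u w f)
    (≡.cong₂ (λ x y → a ℤ.* x ℤ.+ b ℤ.* y) (·-comm u f) (·-comm w f)))

  ·-𝟘 : (f : Vec ℤ n) → f · 𝟘 ≡ 0ℤ
  ·-𝟘 []      = refl
  ·-𝟘 (a ∷ f) = ≡.trans (≡.cong₂ ℤ._+_ (ℤ.*-zeroʳ a) (·-𝟘 f)) refl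

  Kernel : List (Vec ℤ n) → Vec ℤ n → Set
  Kernel F u = ∀ f → f ∈ F → f · u ≡ 0ℤ

  Kernel-linear : ∀ a b {F : List (Vec ℤ n)} {u w} → Kernel F u → Kernel F w → Kernel F (a ⊡ u ⊞ b ⊡ w)
  Kernel-linear a b {u = u} {w} hu hw f f∈F = ≡.trans (·-linearʳ a b f u w)
    (≡.trans (≡.cong₂ (λ x y → a ℤ.* x ℤ.+ b ℤ.* y) (hu f f∈F) (hw f f∈F))
             (≡.cong₂ ℤ._+_ (ℤ.*-zeroʳ a) (ℤ.*-zeroʳ b)))

  private
    vanishing : (f : Vec ℤ n) → (∀ u → f · u ≡ 0ℤ) → ∀ d → f ∙ d ≈ 0#
    vanishing []      h []      = ≈-refl
    vanishing (a ∷ f) h (x ∷ d) = ≈-trans (+-cong (•-congˡ x a≡0) (vanishing f f≡0 d)) (+-identityʳ 0#)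
      where
      a≡0 : a ≡ 0ℤ
      a≡0 = ≡.trans (≡.sym (≡.trans (≡.cong₂ ℤ._+_ (ℤ.*-identityʳ a) (·-𝟘 f)) (ℤ.+-identityʳ a)))
                    (h (1ℤ ∷ 𝟘))
      f≡0 : ∀ u → f · u ≡ 0ℤ
      f≡0 u = ≡.trans (≡.sym (≡.trans (≡.cong (ℤ._+ f · u) (ℤ.*-zeroʳ a)) (ℤ.+-identityˡ (f · u))))
                      (h (0ℤ ∷ u))

  -- Some nonzero multiple of f is a combination of F.  If g takes the value gw ≠ 0
  -- on a vector w in the kernel of F, then g can be eliminated from f using w;
  -- otherwise g does not constrain the kernel of F.
  kernel-vanishing : (∀ {P : Set} → Dec P) → ∀ (F : List (Vec ℤ n)) f →
    (∀ u → Kernel F u → f · u ≡ 0ℤ) → ∀ d → (∀ {g} → g ∈ F → g ∙ d ≈ 0#) → f ∙ d ≈ 0#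
  kernel-vanishing dec []      f h d hd = vanishing f (λ u → h u λ _ ()) d
  kernel-vanishing dec (g ∷ F) f h d hd
    with dec {∃[ w ] Kernel F w × g · w ≢ 0ℤ}
  ... | no ∄w = kernel-vanishing dec F f h′ d (hd ∘ there)
    where
    h′ : ∀ u → Kernel F u → f · u ≡ 0ℤ
    h′ u hu with g · u ℤ.≟ 0ℤ
    ... | yes gu≡0 = h u λ { _ (here refl) → gu≡0 ; f (there i) → hu f i }
    ... | no gu≢0 = contradiction (u , hu , gu≢0) ∄w
  ... | yes (w , hw , gw≢0) = •-torsion-free gw≢0 (begin
    gw • (f ∙ d)                          ≈⟨ +-identityʳ _ ⟨
    gw • (f ∙ d) + 0#                     ≈⟨ +-congˡ (•-zeroʳ (ℤ.- fw)) ⟨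
    gw • (f ∙ d) + (ℤ.- fw) • 0#          ≈⟨ +-congˡ (•-congʳ (ℤ.- fw) (hd (here refl))) ⟨
    gw • (f ∙ d) + (ℤ.- fw) • (g ∙ d)     ≈⟨ +-cong (∙-⊡ gw f d) (∙-⊡ (ℤ.- fw) g d) ⟨
    (gw ⊡ f) ∙ d + ((ℤ.- fw) ⊡ g) ∙ d     ≈⟨ ∙-⊞ (gw ⊡ f) ((ℤ.- fw) ⊡ g) d ⟨
    f′ ∙ d                               ≈⟨ kernel-vanishing dec F f′ h′ d (hd ∘ there) ⟩
    0#                                   ∎)
    where
    gw = g · w
    fw = f · w
    f′ = gw ⊡ f ⊞ (ℤ.- fw) ⊡ g
    h′ : ∀ u → Kernel F u → f′ · u ≡ 0ℤ
    h′ u hu = ≡.trans (·-linearˡ gw (ℤ.- fw) f g u)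
      (≡.trans (solveℤ 4 (λ b c x y → b :* x :+ (:- c) :* y := b :* x :+ (:- y) :* c) refl gw fw (f · u) (g · u))
      (≡.trans (≡.sym (·-linearʳ gw (ℤ.- (g · u)) f u w)) (h u″ λ
        { _ (here refl) → ≡.trans (·-linearʳ gw (ℤ.- (g · u)) g u w)
            (solveℤ 2 (λ b x → b :* x :+ (:- x) :* b := con 0ℤ) refl gw (g · u))
        ; f (there i) → Kernel-linear gw (ℤ.- (g · u)) hu hw f i })))
      where
      u″ = gw ⊡ u ⊞ (ℤ.- (g · u)) ⊡ w

  private
    dominated : ∀ {N x y} → ℤ.∣ y ∣ ℕ.< N → x ≢ 0ℤ → (+ N) ℤ.* x ℤ.+ 1ℤ ℤ.* y ≢ 0ℤ
    dominated {N} {x} {y} y<N x≢0 e = ℕ.<⇒≱ y<N (ℕ.≤-trans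
      (ℕ.m≤m*n N ℤ.∣ x ∣ {{ℕ.≢-nonZero (x≢0 ∘ ℤ.∣i∣≡0⇒i≡0)}})
      (ℕ.≤-reflexive (≡.trans (≡.sym (ℤ.abs-* (+ N) x))
        (≡.trans (≡.cong ℤ.∣_∣ Nx≡-y) (ℤ.∣-i∣≡∣i∣ y)))))
      where
      Nx≡-y : (+ N) ℤ.* x ≡ ℤ.- y
      Nx≡-y = ≡.trans (solveℤ 2 (λ a y → a := (a :+ con 1ℤ :* y) :+ :- y) refl ((+ N) ℤ.* x) y)
        (≡.trans (≡.cong (ℤ._+ ℤ.- y) e) (ℤ.+-identityˡ _))

  -- Finitely many proper subspaces do not cover the kernel. If `u` serves `K` but is killed by `k`,
  -- and `w` is not, then `N u + w` serves both as soon as `N` exceeds every `|l · w|` with `l` in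
  -- `K`: the nonzero `N (l · u)` cannot be cancelled by `l · w`.
  generic : ∀ (F K : List (Vec ℤ n)) → (∀ {k} → k ∈ K → ∃[ u ] Kernel F u × k · u ≢ 0ℤ) →
    ∃[ u ] Kernel F u × (∀ {k} → k ∈ K → k · u ≢ 0ℤ)
  generic F []      h = 𝟘 , (λ f _ → ·-𝟘 f) , λ ()
  generic F (k ∷ K) h with generic F K (h ∘ there) | h (here refl)
  ... | u , hu , K·u≢0 | w , hw , kw≢0 with k · u ℤ.≟ 0ℤ
  ...   | no ku≢0 = u , hu , λ { (here refl) → ku≢0 ; (there i) → K·u≢0 i }
  ...   | yes ku≡0 = (+ N) ⊡ u ⊞ 1ℤ ⊡ w , Kernel-linear (+ N) 1ℤ hu hw , λ
            { (here refl) e → kw≢0 (≡.trans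
                (solveℤ 2 (λ N y → y := N :* con 0ℤ :+ con 1ℤ :* y) refl (+ N) (k · w))
                (≡.trans (≡.cong (λ x → (+ N) ℤ.* x ℤ.+ 1ℤ ℤ.* (k · w)) (≡.sym ku≡0))
                (≡.trans (≡.sym (·-linearʳ (+ N) 1ℤ k u w)) e)))
            ; {l} (there i) e → dominated {N} {l · u} {l · w} (ℕ.s≤s (proj₂ (bounded size K) i)) (K·u≢0 i)
                (≡.trans (≡.sym (·-linearʳ (+ N) 1ℤ l u w)) e) }
    where
    size = λ l → ℤ.∣ l · w ∣
    N = suc (proj₁ (bounded size K))

  infixl 6 _⊞ᵥ_ _⊟ᵥ_
  _⊞ᵥ_ _⊟ᵥ_ : Vec Carrier n → Vec Carrier n → Vec Carrier n
  _⊞ᵥ_ = Vec.zipWith _+_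
  _⊟ᵥ_ = Vec.zipWith _-_

  ∙-⊞ᵥ : ∀ (f : Vec ℤ n) v w → f ∙ (v ⊞ᵥ w) ≈ f ∙ v + f ∙ w
  ∙-⊞ᵥ []      []      []      = ≈-sym (+-identityˡ 0#)
  ∙-⊞ᵥ (a ∷ f) (x ∷ v) (y ∷ w) =
    ≈-trans (+-cong (•-distribˡ a x y) (∙-⊞ᵥ f v w)) (+-interchange _ _ _ _)

  ∙-⊟ᵥ : ∀ (f : Vec ℤ n) v w → f ∙ (v ⊟ᵥ w) ≈ f ∙ v - f ∙ w
  ∙-⊟ᵥ []      []      []      = ≈-sym (-‿inverseʳ 0#)
  ∙-⊟ᵥ (a ∷ f) (x ∷ v) (y ∷ w) = begin
    a • (x - y) + f ∙ (v ⊟ᵥ w)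
      ≈⟨ +-cong (≈-trans (•-distribˡ a x _) (+-congˡ (•-neg a y))) (∙-⊟ᵥ f v w) ⟩
    (a • x - a • y) + (f ∙ v - f ∙ w)
      ≈⟨ +-interchange _ _ _ _ ⟩
    (a • x + f ∙ v) + (- (a • y) - f ∙ w)
      ≈⟨ +-congˡ (-‿+-comm _ _) ⟩
    (a • x + f ∙ v) - (a • y + f ∙ w) ∎

  infixr 7 _⊛_
  _⊛_ : Vec ℤ n → Carrier → Vec Carrier n
  u ⊛ s = Vec.map (_• s) u

  ∙-⊛ : ∀ (f u : Vec ℤ n) s → f ∙ (u ⊛ s) ≈ (f · u) • s
  ∙-⊛ []      []      s = ≈-refl
  ∙-⊛ (a ∷ f) (b ∷ u) s = ≈-trans
    (+-cong (≈-sym (•-assoc a b s)) (∙-⊛ f u s)) (≈-sym (•-distribʳ (a ℤ.* b) (f · u) s))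

-- Crossing hyperplanes

SplitForm : ∀ {c} → Set c → ℕ → ℕ → Set c
SplitForm C m n = Vec ℤ m × Vec ℤ n × C

module Walls (G : OrderedGroup c ℓ) where
  open OrderedGroupProperties G
  open Betweenness G
  open LinearAlgebra G

  Point : ℕ → ℕ → Set c
  Point m n = Vec Carrier m × Vec Carrier n

  linear : SplitForm Carrier m n → Point m n → Carrier
  linear (f , g , _) (x , y) = f ∙ x + g ∙ y

  val : SplitForm Carrier m n → Point m n → Carrier
  val h@(_ , _ , k) p = linear h p + k

  private
    module E = Extension G {C = ℤ} (λ b k a l → b ℤ.* k ℤ.- a ℤ.* l)

    combine-• : ∀ e b k a l → (b ℤ.* k ℤ.- a ℤ.* l) • e ≈ b • k • e - a • l • e
    combine-• e b k a l = ≈-trans (•-distribʳ (b ℤ.* k) (ℤ.- (a ℤ.* l)) e)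
      (+-cong (•-assoc b k e) (≈-trans (-‿• (a ℤ.* l) e) (-‿cong (•-assoc a l e))))

  -- A substitute for scaling u by e / w, which need not act on Carrier.
  rescale : ∀ {e w} → Between e w → ∀ (H : List (Form ℤ n)) u →
    ∃[ u₀ ] (∀ {h} → h ∈ H → Between (E.value (_• e) h u₀) (E.value (_• w) h u))
  rescale e≤w H [] = [] , λ { {[] , k} _ →
    Between-resp (≈-sym (+-identityˡ _)) (≈-sym (+-identityˡ _)) (Between-• k e≤w) }
  rescale {e = e} {w} e≤w H (x ∷ u) =
    let (u₀ , related) = rescale e≤w (E.derive H) u
        (x₀ , related′) = E.extend (_• e) (_• w) (combine-• e) (combine-• w)
          Between Between-resp Between-• Between-cancel Between-extend H related x
    in x₀ ∷ u₀ , related′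

  ++-∙ : ∀ (f : Vec ℤ m) (g : Vec ℤ n) x y → (f Vec.++ g) ∙ (x Vec.++ y) ≈ f ∙ x + g ∙ y
  ++-∙ []      g []      y = ≈-sym (+-identityˡ _)
  ++-∙ (a ∷ f) g (t ∷ x) y = ≈-trans (+-congˡ (++-∙ f g x y)) (≈-sym (+-assoc _ _ _))

  infixl 6 _⊞ₚ_ _⊟ₚ_
  _⊞ₚ_ _⊟ₚ_ : Point m n → Point m n → Point m n
  (x , y) ⊞ₚ (x′ , y′) = x ⊞ᵥ x′ , y ⊞ᵥ y′
  (x , y) ⊟ₚ (x′ , y′) = x ⊟ᵥ x′ , y ⊟ᵥ y′

  val-⊞ₚ : ∀ (h : SplitForm Carrier m n) p q → val h (p ⊞ₚ q) ≈ val h p + linear h q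
  val-⊞ₚ (f , g , k) (x , y) (x′ , y′) = ≈-trans
    (+-congʳ (+-cong (∙-⊞ᵥ f x x′) (∙-⊞ᵥ g y y′)))
    (solve (v₀ ⊕ v₁ ⊕ (v₂ ⊕ v₃) ⊕ v₄) (v₀ ⊕ v₂ ⊕ v₄ ⊕ (v₁ ⊕ v₃))
      (f ∙ x ∷ f ∙ x′ ∷ g ∙ y ∷ g ∙ y′ ∷ k ∷ []) refl)

  linear-⊟ₚ : ∀ (h : SplitForm Carrier m n) p q → linear h (p ⊟ₚ q) ≈ val h p - val h q
  linear-⊟ₚ (f , g , k) (x , y) (x′ , y′) = ≈-trans
    (+-cong (∙-⊟ᵥ f x x′) (∙-⊟ᵥ g y y′))
    (solve (v₀ ⊝ v₁ ⊕ (v₂ ⊝ v₃)) (v₀ ⊕ v₂ ⊕ v₄ ⊝ (v₁ ⊕ v₃ ⊕ v₄))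
      (f ∙ x ∷ f ∙ x′ ∷ g ∙ y ∷ g ∙ y′ ∷ k ∷ []) refl)

  Between-0 : ∀ {y₀ y} → y ≈ 0# → Between y₀ y → y₀ ≈ 0#
  Between-0 {y₀} {y} y≈0 (inj₁ (inj₂ z , _)) = z
  Between-0 {y₀} {y} y≈0 (inj₁ (inj₁ g , h)) = contradiction
    (Pos-resp (≈-trans (solve (v₀ ⊕ (v₁ ⊝ v₀)) v₁ (y₀ ∷ y ∷ []) refl) y≈0) (Pos-NonNeg-+ g h))
    (<-irrefl ≈-refl)
  Between-0 {y₀} {y} y≈0 (inj₂ (inj₂ z , _)) =
    ≈-trans (≈-sym (-‿involutive y₀)) (≈-trans (-‿cong z) -0≈0)
  Between-0 {y₀} {y} y≈0 (inj₂ (inj₁ g , h)) = contradiction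
    (Pos-resp (≈-trans (solve (⊖ v₀ ⊕ (v₀ ⊝ v₁)) (⊖ v₁) (y₀ ∷ y ∷ []) refl)
                       (≈-trans (-‿cong y≈0) -0≈0)) (Pos-NonNeg-+ g h))
    (<-irrefl ≈-refl)

  -- `r` replaces the point where the segment from `p` to `q` meets the hyperplane `k = 0`. It need
  -- not lie on the segment; all that matters is that the forms of `H` take intermediate values
  -- there. The displacement from `p` is `q - p` rescaled by the would-be ratio of `- val k p` to
  -- `val k q - val k p`.
  crossing : ∀ (H : List (SplitForm Carrier m n)) k p q →
    Between (- val k p) (val k q - val k p) →
    ∃[ r ] val k r ≈ 0# × (∀ {h} → h ∈ H → Between (val h r - val h p) (val h q - val h p))
  crossing {m = m} H k p q k-between with rescale k-between (normal ∷ List.map flat H) u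
    where
    flat : SplitForm Carrier _ _ → Form ℤ _
    flat (f , g , _) = f Vec.++ g , 0ℤ
    -- The constant -1 becomes minus the numerator of this ratio on the left and minus its
    -- denominator on the right. On the right the form vanishes at `u`, so by `Between-0` it
    -- vanishes on the left at `u₀`, which puts `r` on the hyperplane.
    normal : Form ℤ _
    normal = proj₁ k Vec.++ proj₁ (proj₂ k) , -1ℤ
    u = proj₁ (q ⊟ₚ p) Vec.++ proj₂ (q ⊟ₚ p)
  ... | u₀ , related with Vec.splitAt m u₀
  ... | x₀ , y₀ , refl = r , k-zero , λ {h@(f , g , _)} h∈H →
        Between-resp (≈-trans (+-identityʳ _) (≈-trans (++-∙ f g x₀ y₀) (≈-sym (step h))))
                     (≈-trans (+-identityʳ _) (≈-trans (++-∙ f g _ _) (linear-⊟ₚ h q p)))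
                     (related (there (∈-map⁺ _ h∈H)))
    where
    r = p ⊞ₚ (x₀ , y₀)
    step : ∀ h → val h r - val h p ≈ linear h (x₀ , y₀)
    step h = ≈-trans (+-congʳ (val-⊞ₚ h p (x₀ , y₀)))
      (solve (v₀ ⊕ v₁ ⊝ v₀) v₁ (val h p ∷ linear h (x₀ , y₀) ∷ []) refl)
    k-linear : linear k (x₀ , y₀) ≈ - val k p
    k-linear = begin
      linear k (x₀ , y₀)
        ≈⟨ ++-∙ (proj₁ k) (proj₁ (proj₂ k)) x₀ y₀ ⟨
      F
        ≈⟨ solve v₀ (v₀ ⊕ -1ℤ ⊙ ⊖ v₁ ⊕ ⊖ v₁) (F ∷ val k p ∷ []) refl ⟩
      F + -1ℤ • (- val k p) + - val k p
        ≈⟨ +-congʳ (Between-0 (begin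
             (proj₁ k Vec.++ proj₁ (proj₂ k)) ∙ _ + -1ℤ • (val k q - val k p)
               ≈⟨ +-cong (≈-trans (++-∙ (proj₁ k) (proj₁ (proj₂ k)) _ _) (linear-⊟ₚ k q p)) (-1• _) ⟩
             (val k q - val k p) - (val k q - val k p)
               ≈⟨ -‿inverseʳ _ ⟩
             0# ∎) (related (here refl))) ⟩
      0# - val k p
        ≈⟨ +-identityˡ _ ⟩
      - val k p ∎
      where
      F = (proj₁ k Vec.++ proj₁ (proj₂ k)) ∙ (x₀ Vec.++ y₀)
    k-zero : val k r ≈ 0#
    k-zero = ≈-trans (val-⊞ₚ k p (x₀ , y₀)) (≈-trans (+-congˡ k-linear) (-‿inverseʳ _))

  IsSgn-between : ∀ {x y z} s → IsSgn x s → IsSgn y s → Between (z - x) (y - x) → IsSgn z s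
  IsSgn-between {x} {y} {z} pos hx hy (inj₁ (g , _)) = Pos-resp
    (solve (v₀ ⊕ (v₂ ⊝ v₀)) v₂ (x ∷ y ∷ z ∷ []) refl) (Pos-NonNeg-+ hx g)
  IsSgn-between {x} {y} {z} pos hx hy (inj₂ (_ , g)) = Pos-resp
    (solve (v₁ ⊕ (v₂ ⊝ v₀ ⊝ (v₁ ⊝ v₀))) v₂ (x ∷ y ∷ z ∷ []) refl) (Pos-NonNeg-+ hy g)
  IsSgn-between {x} {y} {z} neg hx hy (inj₁ (_ , g)) = Pos-resp
    (solve (⊖ v₁ ⊕ (v₁ ⊝ v₀ ⊝ (v₂ ⊝ v₀))) (⊖ v₂) (x ∷ y ∷ z ∷ []) refl) (Pos-NonNeg-+ hy g)
  IsSgn-between {x} {y} {z} neg hx hy (inj₂ (g , _)) = Pos-resp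
    (solve (⊖ v₀ ⊕ ⊖ (v₂ ⊝ v₀)) (⊖ v₂) (x ∷ y ∷ z ∷ []) refl) (Pos-NonNeg-+ hx g)
  IsSgn-between {x} {y} {z} zer hx hy h = begin
    z             ≈⟨ solve v₂ (v₂ ⊝ v₀ ⊕ v₀) (x ∷ y ∷ z ∷ []) refl ⟩
    (z - x) + x   ≈⟨ +-cong (Between-0 (≈-trans (+-cong hy (-‿cong hx)) (-‿inverseʳ 0#)) h) hx ⟩
    0# + 0#       ≈⟨ +-identityˡ 0# ⟩
    0#            ∎

  sgn-between : ∀ {x y z} → sgn x ≡ sgn y → Between (z - x) (y - x) → sgn z ≡ sgn x
  sgn-between {x} {y} e h =
    IsSgn⇒sgn (sgn x) (IsSgn-between (sgn x) (sgn-is x) (sgn⇒IsSgn (≡.sym e)) h)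

  sgn≢zer : ∀ {x} → ¬ x ≈ 0# → sgn x ≢ zer
  sgn≢zer x≉0 e = x≉0 (sgn⇒IsSgn {s = zer} e)

  -- The bound |x| ≤ N ε, written without absolute values.
  Small : ℕ → Carrier → Carrier → Set ℓ
  Small N ε x = NonNeg ((+ N) • ε - x) × NonNeg ((+ N) • ε + x)

  Small-+ : ∀ {M N ε x y} → Small M ε x → Small N ε y → Small (M ℕ.+ N) ε (x + y)
  Small-+ {M} {N} {ε} {x} {y} (g , h) (g′ , h′) =
    NonNeg-resp (≈-trans
      (solve (v₀ ⊝ v₂ ⊕ (v₁ ⊝ v₃)) (v₀ ⊕ v₁ ⊝ (v₂ ⊕ v₃)) V refl)
      (+-congʳ (≈-sym (•-distribʳ (+ M) (+ N) ε)))) (NonNeg-+ g g′) ,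
    NonNeg-resp (≈-trans
      (solve (v₀ ⊕ v₂ ⊕ (v₁ ⊕ v₃)) (v₀ ⊕ v₁ ⊕ (v₂ ⊕ v₃)) V refl)
      (+-congʳ (≈-sym (•-distribʳ (+ M) (+ N) ε)))) (NonNeg-+ h h′)
    where
    V = (+ M) • ε ∷ (+ N) • ε ∷ x ∷ y ∷ []

  Small-×′ : ∀ n {ε x} → Small 1 ε x → Small n ε ((+ n) • x)
  Small-×′ n {ε} {x} (g , h) =
    NonNeg-resp (≈-trans (•-distribˡ (+ n) _ _) (+-cong (•-congʳ (+ n) (1• ε)) (•-neg (+ n) x)))
      (NonNeg-• n g) ,
    NonNeg-resp (≈-trans (•-distribˡ (+ n) _ _) (+-congʳ (•-congʳ (+ n) (1• ε)))) (NonNeg-• n h)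

  Small-neg : ∀ {N ε x} → Small N ε x → Small N ε (- x)
  Small-neg (g , h) = NonNeg-resp (+-congˡ (≈-sym (-‿involutive _))) h , g

  Small-• : ∀ a {ε x} → Small 1 ε x → Small ℤ.∣ a ∣ ε (a • x)
  Small-• (+ n)    h = Small-×′ n h
  Small-• -[1+ n ] h = Small-neg {suc n} (Small-×′ (suc n) h)

  Small-mono : ∀ {M N ε x} → NonNeg ε → M ℕ.≤ N → Small M ε x → Small N ε x
  Small-mono {M} {N} {ε} {x} ε≥0 M≤N (g , h) = grow g , grow h
    where
    grow : ∀ {y} → NonNeg ((+ M) • ε + y) → NonNeg ((+ N) • ε + y)
    grow {y} g = NonNeg-resp (≈-trans (≈-sym (+-assoc _ _ _)) (+-congʳ (≈-trans
      (≈-sym (•-distribʳ (+ (N ℕ.∸ M)) (+ M) ε)) (•-congˡ ε (≡.cong +_ (ℕ.m∸n+n≡m M≤N))))))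
      (NonNeg-+ (NonNeg-• (N ℕ.∸ M) ε≥0) g)

  Small-shrink : ∀ N {ε δ x} → NonNeg (δ - ε) → Small N ε x → Small N δ x
  Small-shrink N {ε} {δ} {x} ε≤δ (g , h) = grow g , grow h
    where
    grow : ∀ {y} → NonNeg ((+ N) • ε + y) → NonNeg ((+ N) • δ + y)
    grow {y} g = NonNeg-resp (≈-trans
      (+-congʳ (≈-trans (•-distribˡ (+ N) δ _) (+-congˡ (•-neg (+ N) ε))))
      (solve (v₀ ⊝ v₁ ⊕ (v₁ ⊕ v₂)) (v₀ ⊕ v₂) ((+ N) • δ ∷ (+ N) • ε ∷ y ∷ []) refl))
      (NonNeg-+ (NonNeg-• N ε≤δ) g)

  Perturbable : ℕ → Carrier → Carrier → Set (c ⊔ ℓ)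
  Perturbable N ε y = ∀ {x} → Small N ε x → sgn (y + x) ≡ sgn y

  -- Take ε to be |y| / (N + 1): a change of at most N ε leaves at least ε of |y|.
  perturb : ∀ N y → ¬ y ≈ 0# → ∃[ ε ] Pos ε × Perturbable N ε y
  perturb N y y≉0 with sgn y in eq | divide N y
  ... | zer | _ = contradiction (sgn⇒IsSgn {s = zer} eq) y≉0
  ... | pos | ε , Nε = ε , Pos-ε , λ {x} (_ , h) → IsSgn⇒sgn pos (Pos-resp
      (≈-trans (≈-sym (+-assoc ε _ x)) (+-congʳ Nε)) (Pos-NonNeg-+ Pos-ε h))
    where
    Pos-ε : Pos ε
    Pos-ε = sgn⇒IsSgn (≡.trans (≡.sym (sgn-• (+ suc N) ε)) (≡.trans (sgn-cong Nε) eq))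
  ... | neg | ε , Nε = - ε , Pos-ε , λ {x} (g , _) → IsSgn⇒sgn neg (Pos-resp
      (begin
        - ε + ((+ N) • - ε - x)      ≈⟨ +-congˡ (+-congʳ (•-neg (+ N) ε)) ⟩
        - ε + (- (N ×′ ε) - x)       ≈⟨ solve (⊖ v₀ ⊕ (⊖ v₁ ⊝ v₂)) (⊖ (v₀ ⊕ v₁ ⊕ v₂))
                                          (ε ∷ N ×′ ε ∷ x ∷ []) refl ⟩
        - (ε + N ×′ ε + x)           ≈⟨ -‿cong (+-congʳ Nε) ⟩
        - (y + x)                    ∎)
      (Pos-NonNeg-+ Pos-ε g))
    where
    Pos-ε : Pos (- ε)
    Pos-ε = sgn⇒IsSgn {s = neg} (≡.trans (≡.sym (sgn-• (+ suc N) ε)) (≡.trans (sgn-cong Nε) eq))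

  -- The smallest of the individual thresholds works for all; for the empty list nontriviality of
  -- the group supplies one.
  perturb-all : ∀ N (ys : List Carrier) →
    ∃[ ε ] Pos ε × (∀ {y} → y ∈ ys → ¬ y ≈ 0# → Perturbable N ε y)
  perturb-all N [] = proj₁ positive , proj₂ positive , λ ()
  perturb-all N (y ∷ ys) with perturb-all N ys | y ≟ 0#
  ... | ε , ε>0 , h | yes y≈0 = ε , ε>0 , λ
    { (here refl) y≉0 → contradiction y≈0 y≉0 ; (there i) → h i }
  ... | ε , ε>0 , h | no y≉0 with perturb N y y≉0
  ... | δ , δ>0 , g with NonNeg-total (δ - ε)
  ... | inj₁ ε≤δ = ε , ε>0 , λ { (here refl) _ s → g (Small-shrink N ε≤δ s) ; (there i) → h i }
  ... | inj₂ δ≤ε = δ , δ>0 , λ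
    { (here refl) _ → g
    ; (there i) y≉0 s → h i y≉0 (Small-shrink N (NonNeg-resp
        (solve (⊖ (v₀ ⊝ v₁)) (v₁ ⊝ v₀) (δ ∷ ε ∷ []) refl) δ≤ε) s) }

  move : Vec ℤ m → Vec ℤ n → Point m n → Carrier → Carrier → Point m n
  move u v (x , y) s t = x ⊞ᵥ u ⊛ s , y ⊞ᵥ v ⊛ t

  val-move : ∀ u v (h : SplitForm Carrier m n) p s t →
    val h (move u v p s t) ≈ val h p + ((proj₁ h · u) • s + (proj₁ (proj₂ h) · v) • t)
  val-move u v h@(f , g , _) p s t =
    ≈-trans (val-⊞ₚ h p (u ⊛ s , v ⊛ t)) (+-congˡ (+-cong (∙-⊛ f u s) (∙-⊛ g v t)))

  Range : Carrier → Carrier → Set ℓ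
  Range ε e = Small 1 ε e

  -- On the plane spanned by u and v near a suitable point of the hyperplane
  -- k = 0, any form either keeps its sign or is proportional to k.
  record Wall (u : Vec ℤ m) (v : Vec ℤ n) (H : List (SplitForm Carrier m n))
    (k : SplitForm Carrier m n) (p₀ : Point m n) : Set (c ⊔ ℓ) where
    slope : SplitForm Carrier m n → ℤ
    slope h = (proj₁ h · u) ℤ.* (proj₁ (proj₂ k) · v)
    field
      ε     : Carrier
      ε-pos : Pos ε
      X     : Carrier → Vec Carrier m
      Y     : Carrier → Vec Carrier n
      flat-or-steep : ∀ {h} → h ∈ H →
        (∃[ s ] s ≢ zer × (∀ {e d} → Range ε e → Range ε d → sgn (val h (X e , Y d)) ≡ s)) ⊎
        (∀ e d → sgn (val h (X e , Y d)) ≡ sgnℤ (slope h) ⊗ sgn (e + d))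
      steep-k : ∀ e d → sgn (val k (X e , Y d)) ≡ sgnℤ (slope k) ⊗ sgn (e + d)
      keep : ∀ {h e d} → h ∈ H → ¬ val h p₀ ≈ 0# → Range ε e → Range ε d →
        sgn (val h (X e , Y d)) ≡ sgn (val h p₀)
      keep-zero : ∀ {h} → h ∈ H → val h p₀ ≈ 0# → proj₁ h · u ≡ 0ℤ → proj₁ (proj₂ h) · v ≡ 0ℤ →
        ∀ e d → val h (X e , Y d) ≈ 0#

  module WallConstruction (u : Vec ℤ m) (v : Vec ℤ n) (H : List (SplitForm Carrier m n))
    (k : SplitForm Carrier m n) (p₀ : Point m n) (k-zero : val k p₀ ≈ 0#) where

    α β : SplitForm Carrier m n → ℤ
    α h = proj₁ h · u
    β h = proj₁ (proj₂ h) · v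

    -- The determinant of the restrictions of `k` and `h` to the plane of `u` and `v`. It is also
    -- the rate of change of `h` in the direction (- β k, α k), along which `k` is constant.
    Δ : SplitForm Carrier m n → ℤ
    Δ h = β h ℤ.* α k ℤ.- α h ℤ.* β k

    private
      first : ∃[ τ ] Pos τ × (∀ {y} → y ∈ List.map (λ h → val h p₀) H → ¬ y ≈ 0# →
                Perturbable (proj₁ (bounded (λ h → ℤ.∣ Δ h ∣) H)) τ y)
      first = perturb-all (proj₁ (bounded (λ h → ℤ.∣ Δ h ∣) H)) (List.map (λ h → val h p₀) H)
      τ = proj₁ first

    -- Moving along the hyperplane k = 0 leaves every other hyperplane through p₀,
    -- except those on which h is proportional to k on the plane (Δ h = 0).
    p₁ : Point m n
    p₁ = move u v p₀ (β k • - τ) (α k • τ)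

    val-p₁ : ∀ h → val h p₁ ≈ val h p₀ + Δ h • τ
    val-p₁ h = ≈-trans (val-move u v h p₀ _ _) (+-congˡ (solve
      (α h ⊙ (β k ⊙ ⊖ v₀) ⊕ β h ⊙ (α k ⊙ v₀)) (Δ h ⊙ v₀) (τ ∷ [])
      (≡.cong (_∷ []) (solveℤ 4 (λ a b c d → a :* (b :* (con -1ℤ :* con 1ℤ)) :+ c :* (d :* con 1ℤ) :=
                  (c :* d :+ :- (a :* b)) :* con 1ℤ) refl (α h) (β k) (β h) (α k)))))

    sgn-p₁ : ∀ {h} → h ∈ H → ¬ val h p₀ ≈ 0# → sgn (val h p₁) ≡ sgn (val h p₀)
    sgn-p₁ {h} h∈H h≉0 = ≡.trans (sgn-cong (val-p₁ h)) (proj₂ (proj₂ first)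
      (∈-map⁺ _ h∈H) h≉0 (Small-mono (inj₁ (proj₁ (proj₂ first)))
        (proj₂ (bounded (λ h → ℤ.∣ Δ h ∣) H) h∈H) (Small-• (Δ h)
        ( inj₂ (≈-trans (+-congʳ (1• τ)) (-‿inverseʳ τ))
        , NonNeg-+ (NonNeg-• 1 (inj₁ (proj₁ (proj₂ first)))) (inj₁ (proj₁ (proj₂ first)))))))

    -- A form that did not vanish at `p₀` kept its sign by the choice of `τ`; one that did now has
    -- the value `Δ h • τ`, which is zero only if `Δ h` is.
    parallel : ∀ {h} → h ∈ H → val h p₁ ≈ 0# → Δ h ≡ 0ℤ
    parallel {h} h∈H h≈0 with val h p₀ ≟ 0# | Δ h ℤ.≟ 0ℤ
    ... | _       | yes Δ≡0 = Δ≡0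
    ... | no h≉0  | _ = contradiction
            (sgn⇒IsSgn {s = zer} (≡.trans (≡.sym (sgn-p₁ h∈H h≉0)) (IsSgn⇒sgn zer h≈0))) h≉0
    ... | yes h₀≈0 | no Δ≢0 = contradiction (•-torsion-free Δ≢0 (begin
            Δ h • τ                ≈⟨ +-identityˡ _ ⟨
            0# + Δ h • τ           ≈⟨ +-congʳ h₀≈0 ⟨
            val h p₀ + Δ h • τ     ≈⟨ val-p₁ h ⟨
            val h p₁               ≈⟨ h≈0 ⟩
            0#                     ∎)) (Pos-≉0 (proj₁ (proj₂ first)))

    k-p₁ : val k p₁ ≈ 0#
    k-p₁ = ≈-trans (val-p₁ k) (≈-trans (+-cong k-zero (•-congˡ τ
      (solveℤ 2 (λ a b → b :* a :+ :- (a :* b) := con 0ℤ) refl (α k) (β k)))) (+-identityˡ 0#))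

    private
      size : SplitForm Carrier m n → ℕ
      size h = ℤ.∣ α h ℤ.* β k ∣ ℕ.+ ℤ.∣ β h ℤ.* α k ∣
      second : ∃[ ε ] Pos ε × (∀ {y} → y ∈ List.map (λ h → val h p₁) H → ¬ y ≈ 0# →
                Perturbable (proj₁ (bounded size H)) ε y)
      second = perturb-all (proj₁ (bounded size H)) (List.map (λ h → val h p₁) H)

    ε : Carrier
    ε = proj₁ second

    ε-pos : Pos ε
    ε-pos = proj₁ (proj₂ second)

    -- The factors `β k` here and `α k` in `Y` are chosen so that `k` takes the value (α k β k)(e +
    -- d). Then the signs of `k` and of all forms proportional to it depend on `e + d` alone.
    X : Carrier → Vec Carrier m
    X e = proj₁ p₁ ⊞ᵥ u ⊛ β k • e

    Y : Carrier → Vec Carrier n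
    Y d = proj₂ p₁ ⊞ᵥ v ⊛ α k • d

    val-XY : ∀ h e d → val h (X e , Y d) ≈ val h p₁ + ((α h ℤ.* β k) • e + (β h ℤ.* α k) • d)
    val-XY h e d = ≈-trans (val-move u v h p₁ _ _)
      (+-congˡ (+-cong (≈-sym (•-assoc (α h) (β k) e)) (≈-sym (•-assoc (β h) (α k) d))))

    flat : ∀ {h e d} → h ∈ H → ¬ val h p₁ ≈ 0# → Range ε e → Range ε d →
           sgn (val h (X e , Y d)) ≡ sgn (val h p₁)
    flat {h} {e} {d} h∈H h≉0 re rd = ≡.trans (sgn-cong (val-XY h e d)) (proj₂ (proj₂ second)
      (∈-map⁺ _ h∈H) h≉0 (Small-mono (inj₁ ε-pos) (proj₂ (bounded size H) h∈H)
        (Small-+ {ℤ.∣ α h ℤ.* β k ∣} {ℤ.∣ β h ℤ.* α k ∣}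
          (Small-• (α h ℤ.* β k) re) (Small-• (β h ℤ.* α k) rd))))

    steep : ∀ {h} e d → Δ h ≡ 0ℤ → val h p₁ ≈ 0# →
            val h (X e , Y d) ≈ (α h ℤ.* β k) • (e + d)
    steep {h} e d Δ≡0 h≈0 = begin
      val h (X e , Y d)
        ≈⟨ val-XY h e d ⟩
      val h p₁ + ((α h ℤ.* β k) • e + (β h ℤ.* α k) • d)
        ≈⟨ ≈-trans (+-congʳ h≈0) (+-identityˡ _) ⟩
      (α h ℤ.* β k) • e + (β h ℤ.* α k) • d
        ≈⟨ +-congˡ (•-congˡ d (ℤ.i-j≡0⇒i≡j (β h ℤ.* α k) (α h ℤ.* β k) Δ≡0)) ⟩
      (α h ℤ.* β k) • e + (α h ℤ.* β k) • d
        ≈⟨ •-distribˡ (α h ℤ.* β k) e d ⟨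
      (α h ℤ.* β k) • (e + d) ∎

    wall : Wall u v H k p₀
    wall = record
      { ε = ε
      ; ε-pos = ε-pos
      ; X = X
      ; Y = Y
      ; flat-or-steep = flat-or-steep
      ; steep-k = λ e d → steep-sgn {k} e d
          (solveℤ 2 (λ a b → b :* a :+ :- (a :* b) := con 0ℤ) refl (α k) (β k)) k-p₁
      ; keep = λ h∈H h≉0 re rd → let p₁≡p₀ = sgn-p₁ h∈H h≉0 in
          ≡.trans (flat h∈H (λ z → h≉0 (sgn-zer p₁≡p₀ z)) re rd) p₁≡p₀
      ; keep-zero = keep-zero
      }
      where
      steep-sgn : ∀ {h} e d → Δ h ≡ 0ℤ → val h p₁ ≈ 0# →
        sgn (val h (X e , Y d)) ≡ sgnℤ (α h ℤ.* β k) ⊗ sgn (e + d)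
      steep-sgn {h} e d Δ≡0 h≈0 =
        ≡.trans (sgn-cong (steep {h} e d Δ≡0 h≈0)) (sgn-• (α h ℤ.* β k) (e + d))

      flat-or-steep : ∀ {h} → h ∈ H →
        (∃[ s ] s ≢ zer × (∀ {e d} → Range ε e → Range ε d → sgn (val h (X e , Y d)) ≡ s)) ⊎
        (∀ e d → sgn (val h (X e , Y d)) ≡ sgnℤ (α h ℤ.* β k) ⊗ sgn (e + d))
      flat-or-steep {h} h∈H with val h p₁ ≟ 0#
      ... | no h≉0 = inj₁ (sgn (val h p₁) , sgn≢zer h≉0 , flat h∈H h≉0)
      ... | yes h≈0 = inj₂ λ e d → steep-sgn {h} e d (parallel h∈H h≈0) h≈0

      keep-zero : ∀ {h} → h ∈ H → val h p₀ ≈ 0# → α h ≡ 0ℤ → β h ≡ 0ℤ →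
        ∀ e d → val h (X e , Y d) ≈ 0#
      keep-zero {h} h∈H h≈0 α≡0 β≡0 e d = ≈-trans
        (steep {h} e d Δ≡0 (≈-trans (val-p₁ h) (≈-trans (+-cong h≈0 (•-congˡ τ Δ≡0)) (+-identityˡ 0#))))
        (•-congˡ (e + d) (≡.trans (≡.cong (ℤ._* β k) α≡0) (ℤ.*-zeroˡ (β k))))
        where
        Δ≡0 : Δ h ≡ 0ℤ
        Δ≡0 = ≡.trans (≡.cong₂ (λ a b → b ℤ.* α k ℤ.- a ℤ.* β k) α≡0 β≡0)
          (solveℤ 2 (λ a b → con 0ℤ :* a :+ :- (con 0ℤ :* b) := con 0ℤ) refl (α k) (β k))

-- Half graphs at a crossing, and the walk across the hyperplanes

HalfGraph : {A : Set a} {B : Set b} → (A × B → Set p) → Set (a ⊔ b ⊔ p)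
HalfGraph {A = A} {B} D = Σ[ x ∈ (ℕ → A) ] Σ[ y ∈ (ℕ → B) ] ∀ i j → D (x i , y j) ⇔ i ℕ.≤ j

infix 4 _≟-Sgn_
_≟-Sgn_ : ∀ (s t : Sgn) → Dec (s ≡ t)
neg ≟-Sgn neg = yes refl
neg ≟-Sgn zer = no λ ()
neg ≟-Sgn pos = no λ ()
zer ≟-Sgn neg = no λ ()
zer ≟-Sgn zer = yes refl
zer ≟-Sgn pos = no λ ()
pos ≟-Sgn neg = no λ ()
pos ≟-Sgn zer = no λ ()
pos ≟-Sgn pos = yes refl

opposite : ∀ {s t} → s ≢ zer → t ≢ zer → s ≢ t → t ≡ neg ⊗ s
opposite {neg} {neg} _ _ s≢t = contradiction refl s≢t
opposite {neg} {zer} _ t≢0 _ = contradiction refl t≢0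
opposite {neg} {pos} _ _ _ = refl
opposite {zer} s≢0 _ _ = contradiction refl s≢0
opposite {pos} {neg} _ _ _ = refl
opposite {pos} {zer} _ t≢0 _ = contradiction refl t≢0
opposite {pos} {pos} _ _ s≢t = contradiction refl s≢t

⊗-involutive : ∀ {r} t → r ≢ zer → r ⊗ (r ⊗ t) ≡ t
⊗-involutive {neg} neg _ = refl
⊗-involutive {neg} zer _ = refl
⊗-involutive {neg} pos _ = refl
⊗-involutive {zer} t r≢0 = contradiction refl r≢0
⊗-involutive {pos} t _ = refl

⊗-neg : ∀ r t → r ⊗ (neg ⊗ t) ≡ neg ⊗ (r ⊗ t)
⊗-neg neg t = refl
⊗-neg zer t = refl
⊗-neg pos t = refl

neg⊗≢zer : ∀ {s} → s ≢ zer → neg ⊗ s ≢ zer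
neg⊗≢zer {neg} _ ()
neg⊗≢zer {zer} s≢0 _ = s≢0 refl
neg⊗≢zer {pos} _ ()

module Core (G : OrderedGroup c ℓ) where
  open OrderedGroupProperties G
  open Betweenness G
  open LinearAlgebra G
  open Walls G

  private
    half : Carrier → Carrier
    half x = proj₁ (divide 1 x)

    half+half : ∀ x → half x + half x ≈ x
    half+half x = ≈-trans (+-congˡ (≈-sym (+-identityʳ _))) (proj₂ (divide 1 x))

    half-pos : ∀ {x} → Pos x → Pos (half x)
    half-pos {x} x>0 = sgn⇒IsSgn
      (≡.trans (≡.sym (sgn-• (+ 2) (half x))) (≡.trans (sgn-cong (proj₂ (divide 1 x))) (IsSgn⇒sgn pos x>0)))

  -- The half graphs come from ε / 2^(2i) - ε / 2^(2j+1), which is positive iff i ≤ j.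
  module HalfGraphs {ε : Carrier} (ε>0 : Pos ε) where

    ε/2^ : ℕ → Carrier
    ε/2^ zero    = ε
    ε/2^ (suc i) = half (ε/2^ i)

    ε/2^-pos : ∀ i → Pos (ε/2^ i)
    ε/2^-pos zero    = ε>0
    ε/2^-pos (suc i) = half-pos (ε/2^-pos i)

    decreasing : ∀ {i j} → i ℕ.≤′ j → NonNeg (ε/2^ i - ε/2^ j)
    decreasing {i} ℕ.≤′-refl = inj₂ (-‿inverseʳ _)
    decreasing {i} {suc j} (ℕ.≤′-step i≤j) = NonNeg-resp
      (≈-trans (+-congʳ (+-congˡ (-‿cong (≈-sym (half+half (ε/2^ j))))))
        (solve (v₀ ⊝ (v₁ ⊕ v₁) ⊕ v₁) (v₀ ⊝ v₁) (ε/2^ i ∷ half (ε/2^ j) ∷ []) refl))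
      (NonNeg-+ (decreasing i≤j) (inj₁ (ε/2^-pos (suc j))))

    strictly-decreasing : ∀ {i j} → i ℕ.< j → Pos (ε/2^ i - ε/2^ j)
    strictly-decreasing {i} {j} i<j = Pos-resp
      (≈-trans (+-congʳ (≈-trans
        (solve v₀ (v₀ ⊕ v₀ ⊝ v₀) (half (ε/2^ i) ∷ []) refl)
        (+-congʳ (half+half (ε/2^ i)))))
        (solve ((v₀ ⊝ v₁) ⊕ (v₁ ⊝ v₂)) (v₀ ⊝ v₂)
          (ε/2^ i ∷ half (ε/2^ i) ∷ ε/2^ j ∷ []) refl))
      (Pos-NonNeg-+ (ε/2^-pos (suc i)) (decreasing (ℕ.≤⇒≤′ i<j)))

    in-range : ∀ i → Range ε (ε/2^ i)
    in-range i = NonNeg-resp (+-congʳ (≈-sym (1• ε))) (decreasing {0} {i} (ℕ.≤⇒≤′ ℕ.z≤n))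
               , NonNeg-+ (NonNeg-• 1 (inj₁ ε>0)) (inj₁ (ε/2^-pos i))

    neg-in-range : ∀ i → Range ε (- ε/2^ i)
    neg-in-range i = Small-neg {1} (in-range i)

    even odd : ℕ → ℕ
    even i = i ℕ.+ i
    odd  i = suc (i ℕ.+ i)

    below-diagonal : ∀ {i j} → i ℕ.≤ j → Pos (ε/2^ (even i) - ε/2^ (odd j))
    below-diagonal {i} {j} i≤j = strictly-decreasing {even i} {odd j} (ℕ.s≤s (ℕ.+-mono-≤ i≤j i≤j))

    above-diagonal : ∀ {i j} → ¬ i ℕ.≤ j → Pos (ε/2^ (odd j) - ε/2^ (even i))
    above-diagonal {i} {j} i≰j = strictly-decreasing {odd j} {even i}
      (ℕ.≤-trans (ℕ.≤-reflexive (≡.cong suc (≡.sym (ℕ.+-suc j j)))) (ℕ.+-mono-≤ (ℕ.≰⇒> i≰j) (ℕ.≰⇒> i≰j)))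

    swap : ∀ x y → x - y ≈ - (y - x)
    swap x y = solve (v₀ ⊝ v₁) (⊖ (v₁ ⊝ v₀)) (x ∷ y ∷ []) refl

    swap′ : ∀ x y → x - y ≈ - y + x
    swap′ x y = +-comm x (- y)

    halfGraph : ∀ {A : Set a} {B : Set b} {D : A × B → Set p} (X : Carrier → A) (Y : Carrier → B) {s} →
      s ≢ zer →
      (∀ {e d} → Range ε e → Range ε d → sgn (e + d) ≡ s → D (X e , Y d)) →
      (∀ {e d} → Range ε e → Range ε d → sgn (e + d) ≡ neg ⊗ s → ¬ D (X e , Y d)) →
      HalfGraph D
    halfGraph X Y {zer} s≢0 inside outside = contradiction refl s≢0
    halfGraph {D = D} X Y {pos} s≢0 inside outside =
      (λ i → X (ε/2^ (even i))) , (λ j → Y (- ε/2^ (odd j))) , λ i j → mk⇔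
        (λ d → only-below i j d)
        (λ i≤j → inside (in-range (even i)) (neg-in-range (odd j)) (IsSgn⇒sgn pos (below-diagonal i≤j)))
      where
      only-below : ∀ i j → D (X (ε/2^ (even i)) , Y (- ε/2^ (odd j))) → i ℕ.≤ j
      only-below i j d with i ℕ.≤? j
      ... | yes i≤j = i≤j
      ... | no  i≰j = contradiction d (outside (in-range (even i)) (neg-in-range (odd j))
              (IsSgn⇒sgn neg (Pos-resp (swap _ _) (above-diagonal i≰j))))
    -- Negating both parameters exchanges the two sides of the wall while keeping the order of the
    -- indices.
    halfGraph {D = D} X Y {neg} s≢0 inside outside =
      (λ i → X (- ε/2^ (even i))) , (λ j → Y (ε/2^ (odd j))) , λ i j → mk⇔
        (λ d → only-below i j d)
        (λ i≤j → inside (neg-in-range (even i)) (in-range (odd j))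
          (IsSgn⇒sgn neg (Pos-resp (≈-trans (swap _ _) (-‿cong (swap′ _ _))) (below-diagonal i≤j))))
      where
      only-below : ∀ i j → D (X (- ε/2^ (even i)) , Y (ε/2^ (odd j))) → i ℕ.≤ j
      only-below i j d with i ℕ.≤? j
      ... | yes i≤j = i≤j
      ... | no  i≰j = contradiction d (outside (neg-in-range (even i)) (in-range (odd j))
              (IsSgn⇒sgn pos (Pos-resp (swap′ _ _) (above-diagonal i≰j))))

  module Claim (dec : ∀ {P : Set p} → Dec P) {D : Point m n → Set p} (H : List (SplitForm Carrier m n))
    (determined : ∀ {x y} → (∀ {h} → h ∈ H → sgn (val h x) ≡ sgn (val h y)) → D x → D y)
    (stable : ¬ HalfGraph D) (r : Point m n) (u : Vec ℤ m) (v : Vec ℤ n)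
    (fixed : ∀ {h} → h ∈ H → val h r ≈ 0# → proj₁ h · u ≡ 0ℤ × proj₁ (proj₂ h) · v ≡ 0ℤ) where

    -- The walk stays among points with exactly the vanishing forms of its goal `r`. Hence a form
    -- with different signs at two such points is nonzero at both, with opposite signs.
    Valid : Point m n → Set (c ⊔ ℓ)
    Valid x = ∀ {h} → h ∈ H → (val h r ≈ 0# → val h x ≈ 0#) × (val h x ≈ 0# → val h r ≈ 0#)

    Mixed : SplitForm Carrier m n → Set c
    Mixed h = h ∈ H × proj₁ h · u ≢ 0ℤ × proj₁ (proj₂ h) · v ≢ 0ℤ

    separating : ∀ {x y} → sgn x ≡ pos × sgn y ≡ neg ⊎ sgn x ≡ neg × sgn y ≡ pos →
      Between (- x) (y - x)
    separating {x} {y} (inj₁ (x>0 , y<0)) = inj₂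
      ( inj₁ (Pos-resp (≈-sym (-‿involutive x)) (sgn⇒IsSgn x>0))
      , inj₁ (Pos-resp (solve (⊖ v₁) (⊖ v₀ ⊝ (v₁ ⊝ v₀)) (x ∷ y ∷ []) refl) (sgn⇒IsSgn {s = neg} y<0)))
    separating {x} {y} (inj₂ (x<0 , y>0)) = inj₁
      ( inj₁ (sgn⇒IsSgn {s = neg} x<0)
      , inj₁ (Pos-resp (solve v₁ (v₁ ⊝ v₀ ⊝ ⊖ v₀) (x ∷ y ∷ []) refl) (sgn⇒IsSgn y>0)))

    opposite-separating : ∀ {x y} → sgn x ≢ zer → sgn y ≡ neg ⊗ sgn x → Between (- x) (y - x)
    opposite-separating {x} {y} x≢0 e with sgn x in eq
    ... | neg = separating (inj₂ (eq , e))
    ... | zer = contradiction refl x≢0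
    ... | pos = separating (inj₁ (eq , e))

    Claim : List (SplitForm Carrier m n) → Set (c ⊔ ℓ ⊔ p)
    Claim K = ∀ {p q} → Valid p → Valid q →
      (∀ {h} → h ∈ H → sgn (val h p) ≡ sgn (val h q) ⊎ h ∈ K) → D p → D q

    nonzero : ∀ {s x} → s ≢ zer → sgn x ≡ s → ¬ x ≈ 0#
    nonzero s≢0 refl x≈0 = s≢0 (IsSgn⇒sgn zer x≈0)

    module Step {k K} (mixed : ∀ {h} → h ∈ k ∷ K → Mixed h) (claim-K : Claim K)
      {p q} (vp : Valid p) (vq : Valid q)
      (same : ∀ {h} → h ∈ H → sgn (val h p) ≡ sgn (val h q) ⊎ h ∈ k ∷ K)
      (p≢0 : sgn (val k p) ≢ zer) (q≡-p : sgn (val k q) ≡ neg ⊗ sgn (val k p))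
      {p₀} (sgn-p₀ : ∀ {h} → h ∈ H → sgn (val h p) ≡ sgn (val h q) → sgn (val h p₀) ≡ sgn (val h p))
      (W : Wall u v H k p₀) where
      open Wall W renaming (keep to keep-p₀)
      open HalfGraphs ε-pos

      -- A nonzero sign survives because the wall is small. A form that vanishes at `p` also
      -- vanishes at `r`, so by `fixed` neither `u` nor `v` moves it.
      keep : ∀ {h e d} → Range ε e → Range ε d →
        h ∈ H → sgn (val h p) ≡ sgn (val h q) → sgn (val h (X e , Y d)) ≡ sgn (val h p)
      keep {h} {e} {d} re rd h∈H p≡q with val h p ≟ 0#
      ... | no h≉0 = ≡.trans (keep-p₀ h∈H (λ z → h≉0 (sgn-zer (sgn-p₀ h∈H p≡q) z)) re rd) (sgn-p₀ h∈H p≡q)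
      ... | yes h≈0 = sgn-cong (≈-trans
              (keep-zero h∈H (sgn-zer (≡.sym (sgn-p₀ h∈H p≡q)) h≈0) (proj₁ αβ) (proj₂ αβ) e d) (≈-sym h≈0))
        where
        αβ = fixed h∈H (proj₂ (vp h∈H) h≈0)

      slope≢0 : ∀ {h} → h ∈ k ∷ K → sgnℤ (slope h) ≢ zer
      slope≢0 {h} h∈K = sgnℤ-≢ λ eq → [ proj₁ (proj₂ (mixed h∈K)) , proj₂ (proj₂ (mixed (here refl))) ]′
                              (ℤ.i*j≡0⇒i≡0∨j≡0 (proj₁ h · u) eq)

      -- No further form vanishes off the wall: one on which `p` and `q` agree keeps its sign, and a
      -- mixed one is either flat and nonzero or a nonzero multiple of `e + d`.
      valid : ∀ {e d} → Range ε e → Range ε d → ¬ e + d ≈ 0# → Valid (X e , Y d)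
      valid {e} {d} re rd e+d≉0 {h} h∈H = forth , back
        where
        forth : val h r ≈ 0# → val h (X e , Y d) ≈ 0#
        forth z = sgn-zer (≡.sym (keep re rd h∈H p≡q)) p≈0
          where
          p≈0 = proj₁ (vp h∈H) z
          p≡q = sgn-cong (≈-trans p≈0 (≈-sym (proj₁ (vq h∈H) z)))
        back : val h (X e , Y d) ≈ 0# → val h r ≈ 0#
        back z with same h∈H | flat-or-steep h∈H
        ... | inj₁ p≡q | _ = proj₂ (vp h∈H) (sgn-zer (keep re rd h∈H p≡q) z)
        ... | inj₂ h∈K | inj₁ (s , s≢0 , flat) = contradiction z (nonzero s≢0 (flat re rd))
        ... | inj₂ h∈K | inj₂ steep = contradiction (⊗-cancelˡ (slope≢0 h∈K)
                (≡.trans (≡.trans (≡.sym (steep e d)) (IsSgn⇒sgn zer z)) (⊗-zeroʳ _))) (sgn≢zer e+d≉0)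

      -- Near the wall the sign of each form is either constant or a function of the sign of
      -- `e + d`, so membership in `D` is constant on each side.
      transport : ∀ {e d e′ d′} → Range ε e → Range ε d → Range ε e′ → Range ε d′ →
        sgn (e + d) ≡ sgn (e′ + d′) → D (X e , Y d) → D (X e′ , Y d′)
      transport {e} {d} {e′} {d′} re rd re′ rd′ eq = determined go
        where
        go : ∀ {h} → h ∈ H → sgn (val h (X e , Y d)) ≡ sgn (val h (X e′ , Y d′))
        go {h} h∈H with flat-or-steep h∈H
        ... | inj₁ (s , _ , flat) = ≡.trans (flat re rd) (≡.sym (flat re′ rd′))
        ... | inj₂ steep = ≡.trans (steep e d)
                (≡.trans (≡.cong (sgnℤ (slope h) ⊗_) eq) (≡.sym (steep e′ d′)))

      σ : Sgn
      σ = sgnℤ (slope k)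

      σ≢0 : σ ≢ zer
      σ≢0 = slope≢0 (here refl)

      -- The side of the wall on which p lies.
      s : Sgn
      s = σ ⊗ sgn (val k p)

      s≢0 : s ≢ zer
      s≢0 e = p≢0 (⊗-cancelˡ {σ} σ≢0 (≡.trans e (⊗-zeroʳ σ)))

      Representative : Sgn → Set (c ⊔ ℓ)
      Representative t = ∃[ e ] ∃[ d ] Range ε e × Range ε d × sgn (e + d) ≡ t

      representative : ∀ t → t ≢ zer → Representative t
      representative neg _ = ε/2^ 1 , - ε/2^ 0 , in-range 1 , neg-in-range 0 ,
        IsSgn⇒sgn neg (Pos-resp (swap _ _) (strictly-decreasing {0} {1} (ℕ.s≤s ℕ.z≤n)))
      representative zer t≢0 = contradiction refl t≢0
      representative pos _ = ε/2^ 0 , - ε/2^ 1 , in-range 0 , neg-in-range 1 ,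
        IsSgn⇒sgn pos (strictly-decreasing {0} {1} (ℕ.s≤s ℕ.z≤n))

      -- On this side `k` has the sign that it has at `p`, so only forms of `K` can separate the two
      -- points and the induction hypothesis applies. `D-far` does the same between the other side
      -- and `q`.
      D-near : ∀ {e d} → Range ε e → Range ε d → sgn (e + d) ≡ s → D p → D (X e , Y d)
      D-near {e} {d} re rd eq = claim-K vp (valid re rd (nonzero s≢0 eq)) λ h∈H → go h∈H (same h∈H)
        where
        go : ∀ {h} → h ∈ H → sgn (val h p) ≡ sgn (val h q) ⊎ h ∈ k ∷ K →
          sgn (val h p) ≡ sgn (val h (X e , Y d)) ⊎ h ∈ K
        go h∈H (inj₁ p≡q)         = inj₁ (≡.sym (keep re rd h∈H p≡q))
        go h∈H (inj₂ (here refl)) = inj₁ (≡.sym (≡.trans (steep-k e d)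
          (≡.trans (≡.cong (σ ⊗_) eq) (⊗-involutive _ σ≢0))))
        go h∈H (inj₂ (there i))   = inj₂ i

      D-far : ∀ {e d} → Range ε e → Range ε d → sgn (e + d) ≡ neg ⊗ s → D (X e , Y d) → D q
      D-far {e} {d} re rd eq = claim-K (valid re rd (nonzero (neg⊗≢zer s≢0) eq)) vq λ h∈H → go h∈H (same h∈H)
        where
        go : ∀ {h} → h ∈ H → sgn (val h p) ≡ sgn (val h q) ⊎ h ∈ k ∷ K →
          sgn (val h (X e , Y d)) ≡ sgn (val h q) ⊎ h ∈ K
        go h∈H (inj₁ p≡q)         = inj₁ (≡.trans (keep re rd h∈H p≡q) p≡q)
        go h∈H (inj₂ (here refl)) = inj₁ (≡.trans (steep-k e d)
          (≡.trans (≡.cong (σ ⊗_) eq) (≡.trans (⊗-neg σ s)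
          (≡.trans (≡.cong (neg ⊗_) (⊗-involutive _ σ≢0)) (≡.sym q≡-p)))))
        go h∈H (inj₂ (there i))   = inj₂ i

      -- One point on each side decides the matter, by `transport`. If `D` held on the near side and
      -- failed on the far side, the wall would carry a half graph.
      through : Representative s → Representative (neg ⊗ s) → D p → D q
      through (e , d , re , rd , eq) (e′ , d′ , re′ , rd′ , eq′) Dp with dec {D (X e′ , Y d′)}
      ... | yes D-w = D-far re′ rd′ eq′ D-w
      ... | no ¬D-w = contradiction
        (halfGraph {D = D} X Y s≢0
          (λ re″ rd″ eq″ → transport re rd re″ rd″ (≡.trans eq (≡.sym eq″)) (D-near re rd eq Dp))
          (λ re″ rd″ eq″ D-w → ¬D-w (transport re″ rd″ re′ rd′ (≡.trans eq″ (≡.sym eq′)) D-w)))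
        stable

      step : D p → D q
      step = through (representative s s≢0) (representative (neg ⊗ s) (neg⊗≢zer s≢0))

    separate : ∀ {k p q} → k ∈ H → Valid p → Valid q → sgn (val k p) ≢ sgn (val k q) →
      sgn (val k p) ≢ zer × sgn (val k q) ≡ neg ⊗ sgn (val k p)
    separate {k} {p} {q} k∈H vp vq p≢q = p≢0 , opposite p≢0 (sgn≢zer (k≉0 ∘ proj₂ (vq k∈H))) p≢q
      where
      k≉0 : ¬ val k r ≈ 0#
      k≉0 z = p≢q (≡.trans (IsSgn⇒sgn zer (proj₁ (vp k∈H) z)) (≡.sym (IsSgn⇒sgn zer (proj₁ (vq k∈H) z))))
      p≢0 : sgn (val k p) ≢ zer
      p≢0 = sgn≢zer (k≉0 ∘ proj₂ (vp k∈H))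

    -- K contains the forms that still separate p from q; each crossing of the
    -- hyperplane of one of them leaves points separated only by the others.
    claim : (K : List (SplitForm Carrier m n)) → (∀ {k} → k ∈ K → Mixed k) → Claim K
    claim [] mixed vp vq same = determined λ h∈H → case-[] (same h∈H)
      where
      case-[] : ∀ {x y} {h : SplitForm Carrier m n} → sgn x ≡ sgn y ⊎ h ∈ [] → sgn x ≡ sgn y
      case-[] (inj₁ e) = e
    claim (k ∷ K) mixed {p} {q} vp vq same with sgn (val k p) ≟-Sgn sgn (val k q)
    ... | yes e = claim K (mixed ∘ there) vp vq λ h∈H → shorten (same h∈H)
      where
      shorten : ∀ {h} → sgn (val h p) ≡ sgn (val h q) ⊎ h ∈ k ∷ K → sgn (val h p) ≡ sgn (val h q) ⊎ h ∈ K
      shorten (inj₁ e)           = inj₁ e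
      shorten (inj₂ (here refl)) = inj₁ e
      shorten (inj₂ (there i))   = inj₂ i
    ... | no p≢q with separate (proj₁ (mixed (here refl))) vp vq p≢q
    ... | p≢0 , q≡-p with crossing H k p q (opposite-separating p≢0 q≡-p)
    ... | p₀ , k-zero , between = Step.step mixed (claim K (mixed ∘ there)) vp vq same p≢0 q≡-p
            (λ h∈H e → sgn-between e (between h∈H)) (WallConstruction.wall u v H k p₀ k-zero)

  -- The walk leads from `(x , y′)` to `(x , y)`, with `(x , y)` as the reference for vanishing. A
  -- separating form changes its sign from `(x , y)` to `(x′ , y)` and from `(x , y)` to `(x , y′)`,
  -- so it is nonzero on `x′ - x` and on `y′ - y`, whereas forms vanishing at `(x , y)` are zero on
  -- both. This yields the integer directions `u` and `v`.
  rectangle : (∀ {P : Set} → Dec P) → (∀ {P : Set p} → Dec P) → {D : Point m n → Set p}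
    (H : List (SplitForm Carrier m n)) →
    (∀ {x y} → (∀ {h} → h ∈ H → sgn (val h x) ≡ sgn (val h y)) → D x → D y) → ¬ HalfGraph D →
    ∀ {x x′ y y′} → (∀ {h} → h ∈ H → sgn (val h (x , y′)) ≡ sgn (val h (x′ , y))) →
    (∀ {h} → h ∈ H → (val h (x , y) ≈ 0# → val h (x , y′) ≈ 0#) × (val h (x , y′) ≈ 0# → val h (x , y) ≈ 0#)) →
    D (x , y′) → D (x , y)
  rectangle dec₀ dec {D} H determined stable {x} {x′} {y} {y′} same zeros =
    Claim.claim dec H determined stable (x , y) u v fixed K mixed zeros
      (λ _ → id , id) compare-signs
    where
    Zero = λ h → val h (x , y) ≟ 0#
    Separating = λ h → ¬? (sgn (val h (x , y′)) ≟-Sgn sgn (val h (x , y)))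
    I = List.filter Zero H
    K = List.filter Separating H
    F₁ = List.map proj₁ I
    F₂ = List.map (λ h → proj₁ (proj₂ h)) I

    x-moves : ∀ {h} → proj₁ h ∙ (x′ ⊟ᵥ x) ≈ val h (x′ , y) - val h (x , y)
    x-moves {h@(f , g , k)} = ≈-trans (∙-⊟ᵥ f x′ x)
      (solve (v₀ ⊝ v₁) (v₀ ⊕ v₂ ⊕ v₃ ⊝ (v₁ ⊕ v₂ ⊕ v₃)) (f ∙ x′ ∷ f ∙ x ∷ g ∙ y ∷ k ∷ [])
        refl)

    y-moves : ∀ {h} → proj₁ (proj₂ h) ∙ (y′ ⊟ᵥ y) ≈ val h (x , y′) - val h (x , y)
    y-moves {h@(f , g , k)} = ≈-trans (∙-⊟ᵥ g y′ y)
      (solve (v₀ ⊝ v₁) (v₂ ⊕ v₀ ⊕ v₃ ⊝ (v₂ ⊕ v₁ ⊕ v₃)) (g ∙ y′ ∷ g ∙ y ∷ f ∙ x ∷ k ∷ [])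
        refl)

    difference : ∀ {a b} → a - b ≈ 0# → a ≈ b
    difference {a} {b} e = begin
      a              ≈⟨ solve v₀ (v₀ ⊝ v₁ ⊕ v₁) (a ∷ b ∷ []) refl ⟩
      (a - b) + b    ≈⟨ +-congʳ e ⟩
      0# + b         ≈⟨ +-identityˡ b ⟩
      b              ∎

    zero-minus-zero : ∀ {a b} → a ≈ 0# → b ≈ 0# → a - b ≈ 0#
    zero-minus-zero a≈0 b≈0 = ≈-trans (+-cong a≈0 (-‿cong b≈0)) (-‿inverseʳ 0#)

    -- The contrapositive of `kernel-vanishing`: it exchanges a direction `d` with entries in the
    -- group for an integer one.
    find : ∀ {n} (F : List (Vec ℤ n)) f d → (∀ {g} → g ∈ F → g ∙ d ≈ 0#) → ¬ f ∙ d ≈ 0# →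
      ∃[ w ] Kernel F w × f · w ≢ 0ℤ
    find F f d hd fd≉0 with dec₀ {∃[ w ] Kernel F w × f · w ≢ 0ℤ}
    ... | yes w = w
    ... | no ∄w = contradiction (kernel-vanishing dec₀ F f
            (λ w hw → decidable-stable (f · w ℤ.≟ 0ℤ) λ fw≢0 → ∄w (w , hw , fw≢0)) d hd) fd≉0

    F₁-vanishes : ∀ {g} → g ∈ F₁ → g ∙ (x′ ⊟ᵥ x) ≈ 0#
    F₁-vanishes i with ∈-map⁻ proj₁ i
    ... | h , h∈I , refl = let (h∈H , h≈0) = ∈-filter⁻ Zero {xs = H} h∈I in
      ≈-trans (x-moves {h}) (zero-minus-zero (sgn-zer (same h∈H) (proj₁ (zeros h∈H) h≈0)) h≈0)

    F₂-vanishes : ∀ {g} → g ∈ F₂ → g ∙ (y′ ⊟ᵥ y) ≈ 0#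
    F₂-vanishes i with ∈-map⁻ (λ h → proj₁ (proj₂ h)) i
    ... | h , h∈I , refl = let (h∈H , h≈0) = ∈-filter⁻ Zero {xs = H} h∈I in
      ≈-trans (y-moves {h}) (zero-minus-zero (proj₁ (zeros h∈H) h≈0) h≈0)

    u-data = generic F₁ (List.map proj₁ K) λ i → let (h , h∈K , eq) = ∈-map⁻ proj₁ i in
      ≡.subst (λ f → ∃[ w ] Kernel F₁ w × f · w ≢ 0ℤ) (≡.sym eq) (find F₁ (proj₁ h) (x′ ⊟ᵥ x) F₁-vanishes
        λ z → let (h∈H , sep) = ∈-filter⁻ Separating {xs = H} h∈K in
          sep (≡.trans (same h∈H) (sgn-cong (difference (≈-trans (≈-sym (x-moves {h})) z)))))
    v-data = generic F₂ (List.map (λ h → proj₁ (proj₂ h)) K) λ i →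
      let (h , h∈K , eq) = ∈-map⁻ (λ h → proj₁ (proj₂ h)) i in
      ≡.subst (λ f → ∃[ w ] Kernel F₂ w × f · w ≢ 0ℤ) (≡.sym eq) (find F₂ (proj₁ (proj₂ h)) (y′ ⊟ᵥ y) F₂-vanishes
        λ z → let (h∈H , sep) = ∈-filter⁻ Separating {xs = H} h∈K in
          sep (sgn-cong (difference (≈-trans (≈-sym (y-moves {h})) z))))
    u = proj₁ u-data
    v = proj₁ v-data

    fixed : ∀ {h} → h ∈ H → val h (x , y) ≈ 0# → proj₁ h · u ≡ 0ℤ × proj₁ (proj₂ h) · v ≡ 0ℤ
    fixed h∈H h≈0 = let h∈I = ∈-filter⁺ Zero h∈H h≈0 in
      proj₁ (proj₂ u-data) _ (∈-map⁺ proj₁ h∈I) , proj₁ (proj₂ v-data) _ (∈-map⁺ (λ h → proj₁ (proj₂ h)) h∈I)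

    mixed : ∀ {k} → k ∈ K → k ∈ H × proj₁ k · u ≢ 0ℤ × proj₁ (proj₂ k) · v ≢ 0ℤ
    mixed k∈K = proj₁ (∈-filter⁻ Separating {xs = H} k∈K) ,
      proj₂ (proj₂ u-data) (∈-map⁺ proj₁ k∈K) , proj₂ (proj₂ v-data) (∈-map⁺ (λ h → proj₁ (proj₂ h)) k∈K)

    compare-signs : ∀ {h} → h ∈ H → sgn (val h (x , y′)) ≡ sgn (val h (x , y)) ⊎ h ∈ K
    compare-signs {h} h∈H with sgn (val h (x , y′)) ≟-Sgn sgn (val h (x , y))
    ... | yes e = inj₁ e
    ... | no sep = inj₂ (∈-filter⁺ Separating h∈H sep)

-- Special formulas from sign vectors

≡⇒⇔ : {A B : Set p} → A ≡ B → A ⇔ B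
≡⇒⇔ refl = mk⇔ id id

module Renaming {L : Language} (𝑴 : Structure L c ℓ) {A : Set p} (ι : A → Structure.Carrier 𝑴) where
  open Structure 𝑴
  open Semantics 𝑴

  mutual
    evalTerm-rename : ∀ (ρ : Fin m → Fin n) {v w} → (∀ i → lookup v (ρ i) ≡ lookup w i) →
      ∀ t → evalTerm ι (renameTerm ρ t) v ≡ evalTerm ι t w
    evalTerm-rename ρ eq (var i)    = eq i
    evalTerm-rename ρ eq (par a)    = refl
    evalTerm-rename ρ eq (fun f ts) = ≡.cong (⟦_⟧ᶠ f) (evalTerms-rename ρ eq ts)

    evalTerms-rename : ∀ (ρ : Fin m → Fin n) {v w} → (∀ i → lookup v (ρ i) ≡ lookup w i) →
      (ts : Vec (Term L A m) k) → evalTerms ι (renameTerms ρ ts) v ≡ evalTerms ι ts w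
    evalTerms-rename ρ eq []       = refl
    evalTerms-rename ρ eq (t ∷ ts) = ≡.cong₂ _∷_ (evalTerm-rename ρ eq t) (evalTerms-rename ρ eq ts)

  lookup-lift : ∀ (ρ : Fin m → Fin n) {v : Vec Carrier n} {w} x → (∀ i → lookup v (ρ i) ≡ lookup w i) →
    ∀ i → lookup (x ∷ v) (Fin.lift 1 ρ i) ≡ lookup (x ∷ w) i
  lookup-lift ρ x eq zero    = refl
  lookup-lift ρ x eq (suc i) = eq i

  satisfies-rename : ∀ (ρ : Fin m → Fin n) {v w} → (∀ i → lookup v (ρ i) ≡ lookup w i) →
    ∀ φ → satisfies ι (rename ρ φ) v ⇔ satisfies ι φ w
  satisfies-rename ρ eq (s ≈′ t) = ≡⇒⇔ (≡.cong₂ (λ a b → Lift c (a ≈ b))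
    (evalTerm-rename ρ eq s) (evalTerm-rename ρ eq t))
  satisfies-rename ρ eq (s <′ t) = ≡⇒⇔ (≡.cong₂ (λ a b → Lift c (a ≺ b))
    (evalTerm-rename ρ eq s) (evalTerm-rename ρ eq t))
  satisfies-rename ρ eq ⊤′       = mk⇔ id id
  satisfies-rename ρ eq ⊥′       = mk⇔ id id
  satisfies-rename ρ eq (¬′ φ)   = let r = satisfies-rename ρ eq φ in
    mk⇔ (_∘ from r) (_∘ to r)
  satisfies-rename ρ eq (φ ∧′ ψ) =
    let r = satisfies-rename ρ eq φ
        s = satisfies-rename ρ eq ψ
    in mk⇔ (λ (a , b) → to r a , to s b) (λ (a , b) → from r a , from s b)
  satisfies-rename ρ eq (φ ∨′ ψ) =
    let r = satisfies-rename ρ eq φ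
        s = satisfies-rename ρ eq ψ
    in mk⇔ [ inj₁ ∘ to r , inj₂ ∘ to s ]′ [ inj₁ ∘ from r , inj₂ ∘ from s ]′
  satisfies-rename ρ eq (∃′ φ)   = mk⇔
    (λ (x , h) → x , to (satisfies-rename _ (lookup-lift ρ x eq) φ) h)
    (λ (x , h) → x , from (satisfies-rename _ (lookup-lift ρ x eq) φ) h)
  satisfies-rename ρ eq (∀′ φ)   = mk⇔
    (λ h x → to (satisfies-rename _ (lookup-lift ρ x eq) φ) (h x))
    (λ h x → from (satisfies-rename _ (lookup-lift ρ x eq) φ) (h x))

module Specials {L : Language} (𝑴 : Structure L c ℓ)
  (isStrictTotalOrder : IsStrictTotalOrder (Structure._≈_ 𝑴) (Structure._≺_ 𝑴)) where
  open Structure 𝑴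
  open Semantics 𝑴
  open Stability 𝑴
  open Renaming 𝑴 id

  strictTotalOrder : StrictTotalOrder c ℓ ℓ
  strictTotalOrder = record { isStrictTotalOrder = isStrictTotalOrder }

  open Comparison strictTotalOrder

  Atom : ℕ → Set c
  Atom k = Term L Carrier k × Term L Carrier k

  eval : Term L Carrier k → Vec Carrier k → Carrier
  eval = evalTerm id

  sign : Atom k → Vec Carrier k → Sgn
  sign (s , t) v = cmp (eval s v) (eval t v)

  signs : List (Atom k) → Vec Carrier k → List Sgn
  signs H v = List.map (λ h → sign h v) H

  SameSigns : List (Atom k) → Vec Carrier k → Vec Carrier k → Set c
  SameSigns H v w = ∀ {h} → h ∈ H → sign h v ≡ sign h w

  atomFormula : Atom k → Sgn → Formula L Carrier k
  atomFormula (s , t) neg = s <′ t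
  atomFormula (s , t) zer = s ≈′ t
  atomFormula (s , t) pos = t <′ s

  atomFormula-correct : ∀ (h : Atom k) r v → ⟦ atomFormula h r ⟧ v ⇔ sign h v ≡ r
  atomFormula-correct h neg v = mk⇔ (cmp-< ∘ lower) (lift ∘ <-cmp)
  atomFormula-correct h zer v = mk⇔ (cmp-≈ ∘ lower) (lift ∘ ≈-cmp)
  atomFormula-correct h pos v = mk⇔ (cmp-> ∘ lower) (lift ∘ >-cmp)

  signFormula : List (Atom k) → List Sgn → Formula L Carrier k
  signFormula (h ∷ H) (r ∷ τ) = atomFormula h r ∧′ signFormula H τ
  signFormula _       _       = ⊤′

  signFormula-correct : ∀ (H : List (Atom k)) v w →
    ⟦ signFormula H (signs H w) ⟧ v ⇔ SameSigns H v w
  signFormula-correct []      v w = mk⇔ (λ _ ()) (λ _ → _)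
  signFormula-correct (h ∷ H) v w =
    let r = atomFormula-correct h (sign h w) v
        s = signFormula-correct H v w
    in mk⇔ (λ { (a , b) (here refl) → to r a ; (a , b) (there i) → to s b i })
           (λ e → from r (e (here refl)) , from s (λ i → e (there i)))

  zeroFormula : List (Atom k) → List Sgn → Formula L Carrier k
  zeroFormula ((s , t) ∷ H) (zer ∷ τ) = (s ≈′ t) ∧′ zeroFormula H τ
  zeroFormula ((s , t) ∷ H) (_   ∷ τ) = ¬′ (s ≈′ t) ∧′ zeroFormula H τ
  zeroFormula _             _         = ⊤′

  zeroFormula-equational : ∀ (H : List (Atom k)) τ → Equational (zeroFormula H τ)
  zeroFormula-equational []            τ         = ⊤′
  zeroFormula-equational (h ∷ H)       []        = ⊤′
  zeroFormula-equational ((s , t) ∷ H) (zer ∷ τ) = (s ≈′ t) ∧′ zeroFormula-equational H τ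
  zeroFormula-equational ((s , t) ∷ H) (neg ∷ τ) = ¬′ (s ≈′ t) ∧′ zeroFormula-equational H τ
  zeroFormula-equational ((s , t) ∷ H) (pos ∷ τ) = ¬′ (s ≈′ t) ∧′ zeroFormula-equational H τ

  SameZeros : List (Atom k) → Vec Carrier k → Vec Carrier k → Set c
  SameZeros H v w = ∀ {h} → h ∈ H → sign h v ≡ zer ⇔ sign h w ≡ zer

  private
    nonzero⇔ : ∀ {s t} → s ≢ zer → t ≢ zer → s ≡ zer ⇔ t ≡ zer
    nonzero⇔ s≢0 t≢0 = mk⇔ (λ e → contradiction e s≢0) (λ e → contradiction e t≢0)

  zeroFormula-correct : ∀ (H : List (Atom k)) v w →
    ⟦ zeroFormula H (signs H w) ⟧ v ⇔ SameZeros H v w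
  zeroFormula-correct []            v w = mk⇔ (λ _ ()) (λ _ → _)
  zeroFormula-correct ((s , t) ∷ H) v w with zeroFormula-correct H v w | sign (s , t) w in eq
  ... | r | neg = mk⇔
    (λ { (a , b) (here refl) → nonzero⇔ (a ∘ lift ∘ ≈-cmp) (λ e → contradiction (≡.trans (≡.sym eq) e) λ ())
       ; (a , b) (there i) → to r b i })
    (λ e → (λ a → contradiction (≡.trans (≡.sym eq) (to (e (here refl)) (cmp-≈ (lower a)))) λ ()) , from r (λ i → e (there i)))
  ... | r | zer = mk⇔
    (λ { (a , b) (here refl) → mk⇔ (λ _ → eq) (λ _ → cmp-≈ (lower a))
       ; (a , b) (there i) → to r b i })
    (λ e → lift (≈-cmp (from (e (here refl)) eq)) , from r (λ i → e (there i)))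
  ... | r | pos = mk⇔
    (λ { (a , b) (here refl) → nonzero⇔ (a ∘ lift ∘ ≈-cmp) (λ e → contradiction (≡.trans (≡.sym eq) e) λ ())
       ; (a , b) (there i) → to r b i })
    (λ e → (λ a → contradiction (≡.trans (≡.sym eq) (to (e (here refl)) (cmp-≈ (lower a)))) λ ()) , from r (λ i → e (there i)))

  signVectors : ℕ → List (List Sgn)
  signVectors zero    = [] ∷ []
  signVectors (suc k) = List.cartesianProductWith _∷_ (neg ∷ zer ∷ pos ∷ []) (signVectors k)

  signs∈signVectors : ∀ (H : List (Atom k)) v → signs H v ∈ signVectors (List.length H)
  signs∈signVectors []      v = here refl
  signs∈signVectors (h ∷ H) v = ∈-cartesianProductWith⁺ _∷_ (sgn∈ (sign h v)) (signs∈signVectors H v)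
    where
    sgn∈ : ∀ s → s ∈ neg ∷ zer ∷ pos ∷ []
    sgn∈ neg = here refl
    sgn∈ zer = there (here refl)
    sgn∈ pos = there (there (here refl))

  ∃ⁿ : ∀ n → Formula L Carrier (n ℕ.+ m) → Formula L Carrier m
  ∃ⁿ zero    φ = φ
  ∃ⁿ (suc n) φ = ∃ⁿ n (∃′ φ)

  ∃ⁿ-correct : ∀ n (φ : Formula L Carrier (n ℕ.+ m)) v →
    ⟦ ∃ⁿ n φ ⟧ v ⇔ (∃[ w ] ⟦ φ ⟧ (w ++ v))
  ∃ⁿ-correct zero    φ v = mk⇔ (λ h → [] , h) (λ { ([] , h) → h })
  ∃ⁿ-correct (suc n) φ v = let r = ∃ⁿ-correct n (∃′ φ) v in mk⇔
    (λ h → let (w , x , h′) = to r h in x ∷ w , h′)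
    (λ { (x ∷ w , h) → from r (w , x , h) })

  -- `∃ⁿ` binds the leading variables, so `y` must be brought to the front before it is quantified
  -- away in `ψ`.
  swap : ∀ m {n} → Fin (m ℕ.+ n) → Fin (n ℕ.+ m)
  swap m {n} = [ n ↑ʳ_ , _↑ˡ m ]′ ∘ Fin.splitAt m

  lookup-swap : ∀ (x : Vec Carrier m) (y : Vec Carrier n) i → lookup (y ++ x) (swap m i) ≡ lookup (x ++ y) i
  lookup-swap {m} x y i = ≡.trans (split (Fin.splitAt m i)) (≡.sym (Vec.lookup-splitAt m x y i))
    where
    split : ∀ s → lookup (y ++ x) ([ _ ↑ʳ_ , _↑ˡ m ]′ s) ≡ [ lookup x , lookup y ]′ s
    split (inj₁ i) = Vec.lookup-++ʳ y x i
    split (inj₂ i) = Vec.lookup-++ˡ y x i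

  ⋁′-correct : ∀ (δs : List (Formula L Carrier k)) v → ⟦ ⋁′ δs ⟧ v ⇔ (∃[ δ ] δ ∈ δs × ⟦ δ ⟧ v)
  ⋁′-correct []       v = mk⇔ (λ ()) (λ ())
  ⋁′-correct (δ ∷ δs) v = let r = ⋁′-correct δs v in mk⇔
    (λ { (inj₁ h) → δ , here refl , h ; (inj₂ h) → let (δ′ , i , h′) = to r h in δ′ , there i , h′ })
    (λ { (_ , here refl , h) → inj₁ h ; (δ′ , there i , h) → inj₂ (from r (δ′ , i , h)) })

  rename-x : ∀ n (ψ : Formula L Carrier m) x (y : Vec Carrier n) → ⟦ rename (_↑ˡ n) ψ ⟧ (x ++ y) ⇔ ⟦ ψ ⟧ x
  rename-x n ψ x y = satisfies-rename (_↑ˡ n) (Vec.lookup-++ˡ x y) ψ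

  rename-y : ∀ m (θ : Formula L Carrier n) (x : Vec Carrier m) y → ⟦ rename (m ↑ʳ_) θ ⟧ (x ++ y) ⇔ ⟦ θ ⟧ y
  rename-y m θ x y = satisfies-rename (m ↑ʳ_) (Vec.lookup-++ʳ x y) θ

  -- What the geometry of 𝑴 has to provide: the cells of the sign conditions H
  -- contained in φ can be cut out of a zero pattern by a rectangle.
  Rectangular : ∀ m n → Formula L Carrier (m ℕ.+ n) → List (Atom (m ℕ.+ n)) → Set (c ⊔ ℓ)
  Rectangular m n φ H = ∀ {v} → ⟦ φ ⟧ v → ∀ {x x′ : Vec Carrier m} {y y′ : Vec Carrier n} →
    SameSigns H (x ++ y′) v → SameSigns H (x′ ++ y) v → SameZeros H (x ++ y) v → ⟦ φ ⟧ (x ++ y)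

  rectangular⇒special : (∀ {ℓ} → ExcludedMiddle ℓ) → ∀ (φ : Formula L Carrier (m ℕ.+ n)) H →
    Rectangular m n φ H →
    Σ[ δs ∈ List (Formula L Carrier (m ℕ.+ n)) ] All (SpecialFormula m n) δs × Equivalent φ (⋁′ δs)
  rectangular⇒special {m} {n} lem φ H rectangular =
    List.map δ 𝒮 , All.map⁺ (All.universal (λ τ → special (ψ τ) (θ τ) (zeroFormula-equational H τ)) 𝒮) ,
    λ v → mk⇔ (forth v) (back v)
    where
    Realised : List Sgn → Set (c ⊔ ℓ)
    Realised τ = ∃[ v ] ⟦ φ ⟧ v × signs H v ≡ τ
    ψ : List Sgn → Formula L Carrier m
    ψ τ = ∃ⁿ n (rename (swap m) (signFormula H τ))
    θ : List Sgn → Formula L Carrier n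
    θ τ = ∃ⁿ m (signFormula H τ)
    δ : List Sgn → Formula L Carrier (m ℕ.+ n)
    δ τ = rename (_↑ˡ n) (ψ τ) ∧′ rename (m ↑ʳ_) (θ τ) ∧′ zeroFormula H τ
    realised? : ∀ τ → Dec (Realised τ)
    realised? τ = lem
    -- Excluded middle decides which of the finitely many sign vectors occur in `φ`; this keeps the
    -- disjunction finite.
    𝒮 = List.filter realised? (signVectors (List.length H))

    forth : ∀ v → ⟦ φ ⟧ v → ⟦ ⋁′ (List.map δ 𝒮) ⟧ v
    forth v h with Vec.splitAt m v
    ... | x , y , refl = from (⋁′-correct (List.map δ 𝒮) v)
      (δ τ , ∈-map⁺ δ (∈-filter⁺ realised? (signs∈signVectors H v) (v , h , refl)) ,
        from (rename-x n (ψ τ) x y) (from (∃ⁿ-correct n _ x)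
          (y , from (satisfies-rename (swap m) (lookup-swap x y) (signFormula H τ)) τ-holds)) ,
        from (rename-y m (θ τ) x y) (from (∃ⁿ-correct m _ y) (x , τ-holds)) ,
        from (zeroFormula-correct H v v) (λ _ → mk⇔ id id))
      where
      τ = signs H v
      τ-holds : ⟦ signFormula H τ ⟧ v
      τ-holds = from (signFormula-correct H v v) (λ _ → refl)

    back : ∀ v → ⟦ ⋁′ (List.map δ 𝒮) ⟧ v → ⟦ φ ⟧ v
    back v h with to (⋁′-correct (List.map δ 𝒮) v) h
    ... | _ , i , h′ with ∈-map⁻ δ i
    ... | τ , j , refl with proj₂ (∈-filter⁻ realised? {xs = signVectors (List.length H)} j) | Vec.splitAt m v
    ... | w , φw , refl | x , y , refl with h′
    ... | hψ , hθ , hχ =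
      let (y′ , h₁) = to (∃ⁿ-correct n _ x) (to (rename-x n (ψ τ) x y) hψ)
          (x′ , h₂) = to (∃ⁿ-correct m _ y) (to (rename-y m (θ τ) x y) hθ)
      in rectangular φw {x} {x′} {y} {y′}
           (to (signFormula-correct H _ w) (to (satisfies-rename (swap m) (lookup-swap x y′) (signFormula H τ)) h₁))
           (to (signFormula-correct H _ w) h₂)
           (to (zeroFormula-correct H _ w) hχ)

-- The theory of the reals

0<1ℚ : 0ℚ ℚ.< 1ℚ
0<1ℚ = ℚ.positive⁻¹ 1ℚ

natural-pos : ∀ n → 0ℚ ℚ.< suc n ×ℚ 1ℚ
natural-pos zero    = 0<1ℚ
natural-pos (suc n) = ℚ.+-mono-<-≤ 0<1ℚ (ℚ.<⇒≤ (natural-pos n))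

×ℚ-* : ∀ n x → n ×ℚ x ≡ (n ×ℚ 1ℚ) ℚ.* x
×ℚ-* zero    x = ≡.sym (ℚ.*-zeroˡ x)
×ℚ-* (suc n) x = ≡.trans (≡.cong₂ ℚ._+_ (≡.sym (ℚ.*-identityˡ x)) (×ℚ-* n x))
  (≡.sym (ℚ.*-distribʳ-+ x 1ℚ (n ×ℚ 1ℚ)))

reciprocal : ∀ n → ∃[ r ] ℚ.Positive r × (suc n ×ℚ 1ℚ) ℚ.* r ≡ 1ℚ
reciprocal n = ℚ.1/_ q {{q≢0}} , ℚ.1/pos⇒pos q {{q>0}} , ℚ.*-inverseʳ q {{q≢0}}
  where
  q = suc n ×ℚ 1ℚ
  q>0 = ℚ.positive (natural-pos n)
  q≢0 = ℚ.pos⇒nonZero q {{q>0}}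

reciprocal-× : ∀ n x → suc n ×ℚ (proj₁ (reciprocal n) ℚ.* x) ≡ x
reciprocal-× n x = let (r , _ , e) = reciprocal n in ≡.trans (×ℚ-* (suc n) (r ℚ.* x))
  (≡.trans (≡.sym (ℚ.*-assoc (suc n ×ℚ 1ℚ) r x)) (≡.trans (≡.cong (ℚ._* x) e) (ℚ.*-identityˡ x)))

ℚ-orderedGroup : OrderedGroup 0ℓ 0ℓ
ℚ-orderedGroup = record
  { abelianGroup       = ℚ.+-0-abelianGroup
  ; _<_                = ℚ._<_
  ; isStrictTotalOrder = ℚ.<-isStrictTotalOrder
  ; +-monoˡ-<          = λ z → ℚ.+-monoˡ-< z
  ; divide             = λ n x → proj₁ (reciprocal n) ℚ.* x , reciprocal-× n x
  ; positive           = 1ℚ , 0<1ℚ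
  }

module Reals where
  open ℝ using (seq; cauchy)
  open OrderedGroupProperties ℚ-orderedGroup
    using (Pos; <⇒Pos; Pos⇒<; Pos-resp; Pos-+; v₀; v₁; v₂; v₃; _⊕_; _⊝_; ⊖_; _⊙_; Expr) renaming (solve to solveℚ)

  ≗⇒≈ᴿ : ∀ x y → (∀ i → seq x i ≡ seq y i) → x ≈ᴿ y
  ≗⇒≈ᴿ x y e ε 0<ε = 0 , λ i _ → ≡.subst (λ q → ℚ.∣ seq x i ℚ.- q ∣ ℚ.< ε) (e i)
    (proj₂ (≈ᴿ-refl {x} ε 0<ε) i ℕ.z≤n)

  ∣∣<⇒< : ∀ {p ε} → ℚ.∣ p ∣ ℚ.< ε → p ℚ.< ε × ℚ.- p ℚ.< ε
  ∣∣<⇒< {p} {ε} h = ℚ.≤-<-trans (p≤∣p∣ p) h ,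
    ℚ.≤-<-trans (p≤∣p∣ (ℚ.- p)) (≡.subst (ℚ._< ε) (≡.sym (ℚ.∣-p∣≡∣p∣ p)) h)

  <⇒∣∣< : ∀ {p ε} → p ℚ.< ε → ℚ.- p ℚ.< ε → ℚ.∣ p ∣ ℚ.< ε
  <⇒∣∣< {p} {ε} h g with ℚ.∣p∣≡p∨∣p∣≡-p p
  ... | inj₁ e = ≡.subst (ℚ._< ε) (≡.sym e) h
  ... | inj₂ e = ≡.subst (ℚ._< ε) (≡.sym e) g

  module _ (x y : ℝ) where

    <ᴿ-irrefl : x ≈ᴿ y → ¬ x <ᴿ y
    <ᴿ-irrefl x≈y (ε , 0<ε , N , h) =
      let (M , g) = x≈y ε 0<ε
          i       = M ℕ.⊔ N
      in ℚ.<-irrefl refl (Pos⇒< {ε} {ε} (Pos-resp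
           (solveℚ (v₀ ⊝ (v₁ ⊕ v₂) ⊕ (v₂ ⊝ ⊖ (v₁ ⊝ v₀))) (v₂ ⊝ v₂)
             (seq y i ∷ seq x i ∷ ε ∷ []) refl)
           (Pos-+ (<⇒Pos (h i (ℕ.m≤n⊔m M N))) (<⇒Pos (proj₂ (∣∣<⇒< (g i (ℕ.m≤m⊔n M N))))))))

    <ᴿ-trans : ∀ z → x <ᴿ y → y <ᴿ z → x <ᴿ z
    <ᴿ-trans z (ε , 0<ε , N , h) (δ , 0<δ , M , g) = ε , 0<ε , M ℕ.⊔ N , λ i ≤i →
      Pos⇒< (Pos-resp (solveℚ (v₀ ⊝ (v₁ ⊕ v₃) ⊕ (v₁ ⊝ v₂) ⊕ v₃) (v₀ ⊝ v₂)
          (seq z i ∷ seq y i ∷ seq x i ℚ.+ ε ∷ δ ∷ []) refl)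
        (Pos-+ (Pos-+ (<⇒Pos (g i (ℕ.m⊔n≤o⇒m≤o M N ≤i))) (<⇒Pos (h i (ℕ.m⊔n≤o⇒n≤o M N ≤i)))) 0<δ))

    -- A gap of at least ε at a single index shrinks by less than ε/2 afterwards, so a gap of ε/2
    -- remains at all later indices.
    <ᴿ-above : ∀ {i N ε} → 0ℚ ℚ.< ε → ¬ seq y i ℚ.- seq x i ℚ.< ε →
      (∀ j → N ℕ.≤ j → ℚ.∣ (seq y i ℚ.- seq x i) ℚ.- (seq y j ℚ.- seq x j) ∣ ℚ.< ½ ℚ.* ε) → x <ᴿ y
    <ᴿ-above {i} {N} {ε} 0<ε far near = ½ ℚ.* ε , ½-pos 0<ε , N , λ j N≤j →
      Pos⇒< (≡.subst Pos (regroup j) (ℚ.+-mono-≤-<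
        (≡.subst (ℚ._≤ seq y i ℚ.- seq x i ℚ.- ε) (ℚ.+-inverseʳ ε) (ℚ.+-monoˡ-≤ (ℚ.- ε) (ℚ.≮⇒≥ far)))
        (<⇒Pos {_} {½ ℚ.* ε} (proj₁ (∣∣<⇒< (near j N≤j))))))
      where
      regroup : ∀ j → (seq y i ℚ.- seq x i ℚ.- ε) ℚ.+ (½ ℚ.* ε ℚ.- ((seq y i ℚ.- seq x i) ℚ.- (seq y j ℚ.- seq x j)))
        ≡ seq y j ℚ.- (seq x j ℚ.+ ½ ℚ.* ε)
      regroup j = ≡.trans
        (≡.cong (λ e → (d ℚ.- e) ℚ.+ (½ ℚ.* ε ℚ.- (d ℚ.- (seq y j ℚ.- seq x j)))) (≡.sym (halves ε)))
        (solveℚ (v₀ ⊝ (v₁ ⊕ v₁) ⊕ (v₁ ⊝ (v₀ ⊝ (v₂ ⊝ v₃)))) (v₂ ⊝ (v₃ ⊕ v₁))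
          (d ∷ ½ ℚ.* ε ∷ seq y j ∷ seq x j ∷ []) refl)
        where
        d = seq y i ℚ.- seq x i

  -- Beyond the Cauchy moduli a gap of ε in either direction would already decide the order by
  -- `<ᴿ-above`. The rational comparison at each index is decidable, which removes the double
  -- negation.
  <ᴿ-connected : ∀ x y → ¬ x <ᴿ y → ¬ y <ᴿ x → x ≈ᴿ y
  <ᴿ-connected x y x≮y y≮x ε 0<ε =
    let (N , h) = cauchy (x +ᴿ -ᴿ y) (½ ℚ.* ε) (½-pos 0<ε)
        (M , g) = cauchy (y +ᴿ -ᴿ x) (½ ℚ.* ε) (½-pos 0<ε)
    in M ℕ.⊔ N , λ i ≤i → <⇒∣∣<
      (decide (λ far → y≮x (<ᴿ-above y x {i} {N} 0<ε far λ j N≤j → h i j (ℕ.m⊔n≤o⇒n≤o M N ≤i) N≤j)))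
      (≡.subst (ℚ._< ε) (≡.sym (flip-sub (seq x i) (seq y i)))
        (decide (λ far → x≮y (<ᴿ-above x y {i} {M} 0<ε far λ j M≤j → g i j (ℕ.m⊔n≤o⇒m≤o M N ≤i) M≤j))))
    where
    decide : ∀ {p} → ¬ ¬ p ℚ.< ε → p ℚ.< ε
    decide {p} ¬far with p ℚ.<? ε
    ... | yes p<ε = p<ε
    ... | no far = contradiction far ¬far

  constant : ℚ → ℝ
  constant q = mkℝ (λ _ → q) (λ ε 0<ε → 0 , λ _ _ _ _ → ≡.subst (λ r → ℚ.∣ r ∣ ℚ.< ε) (≡.sym (ℚ.+-inverseʳ q)) 0<ε)

  scale : ∀ n → ℝ → ℝ
  scale n x = mkℝ (λ i → r ℚ.* seq x i) λ ε 0<ε →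
    -- Dividing by n + 1 divides distances by n + 1, so the modulus of `x` is taken at (n + 1) ε.
    let (N , h) = cauchy x (q ℚ.* ε) (≡.subst (ℚ._< q ℚ.* ε) (ℚ.*-zeroʳ q) (ℚ.*-monoʳ-<-pos q {{q>0}} 0<ε))
    in N , λ i j N≤i N≤j → ≡.subst₂ ℚ._<_
         (≡.trans (≡.cong (ℚ._* _) (≡.sym (ℚ.0≤p⇒∣p∣≡p (ℚ.<⇒≤ (ℚ.positive⁻¹ r {{r>0}})))))
           (≡.trans (≡.sym (ℚ.∣p*q∣≡∣p∣*∣q∣ r _)) (≡.cong ℚ.∣_∣ (distrib (seq x i) (seq x j)))))
         (≡.trans (≡.sym (ℚ.*-assoc r q ε)) (≡.trans (≡.cong (ℚ._* ε) (≡.trans (ℚ.*-comm r q) qr≡1)) (ℚ.*-identityˡ ε)))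
         (ℚ.*-monoʳ-<-pos r {{r>0}} (h i j N≤i N≤j))
    where
    r = proj₁ (reciprocal n)
    r>0 = proj₁ (proj₂ (reciprocal n))
    qr≡1 = proj₂ (proj₂ (reciprocal n))
    q = suc n ×ℚ 1ℚ
    q>0 = ℚ.positive (natural-pos n)
    distrib : ∀ a b → r ℚ.* (a ℚ.- b) ≡ r ℚ.* a ℚ.- r ℚ.* b
    distrib a b = ≡.trans (ℚ.*-distribˡ-+ r a (ℚ.- b)) (≡.cong (r ℚ.* a ℚ.+_) (≡.sym (ℚ.neg-distribʳ-* r b)))

  <ᴿ-constant : ∀ x {q} → 0ℚ ℚ.< q → x <ᴿ x +ᴿ constant q
  <ᴿ-constant x {q} 0<q = ½ ℚ.* q , ½-pos 0<q , 0 , λ i _ → Pos⇒< (≡.subst Pos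
    (≡.trans (solveℚ v₁ (v₀ ⊕ (v₁ ⊕ v₁) ⊝ (v₀ ⊕ v₁)) (seq x i ∷ ½ ℚ.* q ∷ []) refl)
             (≡.cong (λ r → seq x i ℚ.+ r ℚ.- (seq x i ℚ.+ ½ ℚ.* q)) (halves q)))
    (½-pos 0<q))

  <ᴿ-dense : ∀ x y → x <ᴿ y → ∃[ z ] x <ᴿ z × z <ᴿ y
  <ᴿ-dense x y (ε , 0<ε , N , h) = x +ᴿ constant (½ ℚ.* ε) , <ᴿ-constant x (½-pos 0<ε) ,
    ½ ℚ.* ε , ½-pos 0<ε , N , λ i N≤i → ≡.subst (ℚ._< seq y i)
      (≡.trans (≡.cong (seq x i ℚ.+_) (≡.sym (halves ε))) (≡.sym (ℚ.+-assoc (seq x i) _ _))) (h i N≤i)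

  <ᴿ-below : ∀ x → ∃[ y ] y <ᴿ x
  <ᴿ-below x = y , <ᴿ-respʳ {y} {y +ᴿ constant 1ℚ} {x}
      (≗⇒≈ᴿ (y +ᴿ constant 1ℚ) x λ i → solveℚ (v₀ ⊝ v₁ ⊕ v₁) v₀ (seq x i ∷ 1ℚ ∷ []) refl)
      (<ᴿ-constant y 0<1ℚ)
    where
    y = x +ᴿ constant (ℚ.- 1ℚ)

  +ᴿ-monoˡ-< : ∀ x y z → x <ᴿ y → x +ᴿ z <ᴿ y +ᴿ z
  +ᴿ-monoˡ-< x y z (ε , 0<ε , N , h) = ε , 0<ε , N , λ i N≤i → Pos⇒< (Pos-resp
    (solveℚ (v₀ ⊝ (v₁ ⊕ v₂)) (v₀ ⊕ v₃ ⊝ (v₁ ⊕ v₃ ⊕ v₂)) (seq y i ∷ seq x i ∷ ε ∷ seq z i ∷ [])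
      refl)
    (<⇒Pos (h i N≤i)))

-- Axioms carried from the reals to all models

x₀ : ∀ {L : Language} {A : Set a} → Term L A (suc n)
x₀ = var zero
x₁ : ∀ {L : Language} {A : Set a} → Term L A (suc (suc n))
x₁ = var (suc zero)
x₂ : ∀ {L : Language} {A : Set a} → Term L A (suc (suc (suc n)))
x₂ = var (suc (suc zero))

infixr 5 _⇒′_
_⇒′_ : ∀ {L : Language} {A : Set a} → Formula L A n → Formula L A n → Formula L A n
φ ⇒′ ψ = ¬′ φ ∨′ ψ

module Transfer (lem : ∀ {ℓ} → ExcludedMiddle ℓ) where

  -- Implication in formulas is coded by negation and disjunction; excluded middle passes from a
  -- function to this coding.
  implies : {A : Set a} {B : Set b} → (A → B) → ¬ A ⊎ B
  implies {A = A} f with lem {P = A}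
  ... | yes a = inj₂ (f a)
  ... | no ¬a = inj₁ ¬a

  modusPonens : {A : Set a} {B : Set b} → ¬ A ⊎ B → A → B
  modusPonens (inj₁ ¬a) a = contradiction a ¬a
  modusPonens (inj₂ b)  a = b

  -- A model of the theory satisfies every sentence that holds in the reals. So each axiom is
  -- written as a sentence, proved for Cauchy sequences, and read off in `𝑴`.
  module Order (T : TheoryName) (𝑴 : Structure (language T) c ℓ) (model : 𝑴 ⊨ theory T) where
    open Structure 𝑴
    open IsEquivalence isEquivalence using () renaming (sym to ≈-sym)

    private
      irreflexive transitive total dense below above inhabited : Sentence (language T)
      irreflexive = ∀′ ∀′ ¬′ (x₁ ≈′ x₀ ∧′ x₁ <′ x₀)
      transitive  = ∀′ ∀′ ∀′ (x₂ <′ x₁ ∧′ x₁ <′ x₀) ⇒′ x₂ <′ x₀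
      total       = ∀′ ∀′ x₁ <′ x₀ ∨′ x₁ ≈′ x₀ ∨′ x₀ <′ x₁
      dense       = ∀′ ∀′ x₁ <′ x₀ ⇒′ (∃′ x₂ <′ x₀ ∧′ x₀ <′ x₁)
      below       = ∀′ ∃′ x₀ <′ x₁
      above       = ∀′ ∃′ x₁ <′ x₀
      inhabited   = ∃′ ⊤′

    irrefl : ∀ {x y} → x ≈ y → ¬ x ≺ y
    irrefl {x} {y} x≈y x≺y = model irreflexive
      (λ x y (e , h) → Reals.<ᴿ-irrefl x y (lower e) (lower h)) x y (lift x≈y , lift x≺y)

    trans : ∀ {x y z} → x ≺ y → y ≺ z → x ≺ z
    trans {x} {y} {z} x≺y y≺z = lower (modusPonens (model transitive
      (λ x y z → implies λ (g , h) → lift (Reals.<ᴿ-trans x y z (lower g) (lower h))) x y z)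
      (lift x≺y , lift y≺z))

    compare : Trichotomous _≈_ _≺_
    compare x y with model total (λ x y → ℝ-total x y) x y
      where
      ℝ-total : ∀ x y → Lift 0ℓ (x <ᴿ y) ⊎ Lift 0ℓ (x ≈ᴿ y) ⊎ Lift 0ℓ (y <ᴿ x)
      ℝ-total x y with lem {P = x <ᴿ y} | lem {P = y <ᴿ x}
      ... | yes x<y | _ = inj₁ (lift x<y)
      ... | no x≮y | yes y<x = inj₂ (inj₂ (lift y<x))
      ... | no x≮y | no y≮x = inj₂ (inj₁ (lift (Reals.<ᴿ-connected x y x≮y y≮x)))
    ... | inj₁ (lift x≺y) = tri< x≺y (λ x≈y → irrefl x≈y x≺y)
            (λ y≺x → irrefl (IsEquivalence.refl isEquivalence) (trans x≺y y≺x))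
    ... | inj₂ (inj₁ (lift x≈y)) = tri≈ (irrefl x≈y) x≈y (irrefl (≈-sym x≈y))
    ... | inj₂ (inj₂ (lift y≺x)) = tri> (λ x≺y → irrefl (IsEquivalence.refl isEquivalence) (trans x≺y y≺x))
            (λ x≈y → irrefl (≈-sym x≈y) y≺x) y≺x

    isStrictTotalOrder : IsStrictTotalOrder _≈_ _≺_
    isStrictTotalOrder = record
      { isStrictPartialOrder = record
        { isEquivalence = isEquivalence
        ; irrefl        = irrefl
        ; trans         = trans
        ; <-resp-≈      = ≺-resp-≈
        }
      ; compare = compare
      }

    dense-≺ : ∀ {x y} → x ≺ y → ∃[ z ] x ≺ z × z ≺ y
    dense-≺ {x} {y} x≺y = let (z , g , h) = modusPonens (in-𝑴 x y) (lift x≺y) in z , lower g , lower h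
      where
      in-𝑴 = model dense λ x y → implies λ h →
        let (z , f , g) = Reals.<ᴿ-dense x y (lower h) in z , lift f , lift g

    below-≺ : ∀ x → ∃[ y ] y ≺ x
    below-≺ x = let (y , h) = in-𝑴 x in y , lower h
      where
      in-𝑴 = model below λ x → let (y , h) = Reals.<ᴿ-below x in y , lift h

    above-≺ : ∀ x → ∃[ y ] x ≺ y
    above-≺ x = let (y , h) = in-𝑴 x in y , lower h
      where
      in-𝑴 = model above λ x → x +ᴿ Reals.constant 1ℚ , lift (Reals.<ᴿ-constant x 0<1ℚ)

    denseLinearOrder : DenseLinearOrder c ℓ ℓ
    denseLinearOrder = record
      { strictTotalOrder = record { isStrictTotalOrder = isStrictTotalOrder }
      ; point = proj₁ (model inhabited (0ᴿ , _))
      ; dense = dense-≺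
      ; below = below-≺
      ; above = above-≺
      }

  module Group (𝑴 : Structure GroupSymbol c ℓ) (model : 𝑴 ⊨ theory DOAG) where
    open Structure 𝑴
    open IsEquivalence isEquivalence using () renaming (refl to ≈-refl; sym to ≈-sym; trans to ≈-trans)

    infixl 9 _+′_
    infix  10 -′_
    infixr 10 _×′_
    _+′_ : ∀ {A : Set a} → Term GroupSymbol A n → Term GroupSymbol A n → Term GroupSymbol A n
    s +′ t = fun plusˢ (s ∷ t ∷ [])

    -′_ : ∀ {A : Set a} → Term GroupSymbol A n → Term GroupSymbol A n
    -′ t = fun negˢ (t ∷ [])

    0′ : ∀ {A : Set a} → Term GroupSymbol A n
    0′ = fun zeroˢ []

    _×′_ : ∀ {A : Set a} → ℕ → Term GroupSymbol A n → Term GroupSymbol A n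
    zero  ×′ t = 0′
    suc k ×′ t = t +′ (k ×′ t)

    private
      associative commutative identity inverse monotone positive : Sentence GroupSymbol
      associative = ∀′ ∀′ ∀′ x₂ +′ x₁ +′ x₀ ≈′ x₂ +′ (x₁ +′ x₀)
      commutative = ∀′ ∀′ x₁ +′ x₀ ≈′ x₀ +′ x₁
      identity    = ∀′ 0′ +′ x₀ ≈′ x₀
      inverse     = ∀′ (-′ x₀) +′ x₀ ≈′ 0′
      monotone    = ∀′ ∀′ ∀′ x₂ <′ x₁ ⇒′ x₂ +′ x₀ <′ x₁ +′ x₀
      positive    = ∃′ 0′ <′ x₀
      divisible : ℕ → Sentence GroupSymbol
      divisible n = ∀′ ∃′ (suc n ×′ x₀) ≈′ x₁

      ×′-ℝ : ∀ n (v : Vec ℝ (suc m)) i →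
        ℝ.seq (Semantics.evalTerm (realStructure DOAG) ⊥-elim (n ×′ x₀) v) i ≡ n ×ℚ ℝ.seq (Vec.head v) i
      ×′-ℝ zero    (x ∷ v) i = refl
      ×′-ℝ (suc n) (x ∷ v) i = ≡.cong (ℝ.seq x i ℚ.+_) (×′-ℝ n (x ∷ v) i)

    infixl 21 _+_
    _+_ : Carrier → Carrier → Carrier
    x + y = ⟦ plusˢ ⟧ᶠ (x ∷ y ∷ [])

    infix 22 -_
    -_ : Carrier → Carrier
    - x = ⟦ negˢ ⟧ᶠ (x ∷ [])

    0# : Carrier
    0# = ⟦ zeroˢ ⟧ᶠ []

    comm : ∀ x y → x + y ≈ y + x
    comm x y = lower (model commutative
      (λ x y → lift (Reals.≗⇒≈ᴿ (x +ᴿ y) (y +ᴿ x) λ i → ℚ.+-comm (ℝ.seq x i) (ℝ.seq y i))) x y)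

    identityˡ : ∀ x → 0# + x ≈ x
    identityˡ x = lower (model identity
      (λ x → lift (Reals.≗⇒≈ᴿ (0ᴿ +ᴿ x) x λ i → ℚ.+-identityˡ (ℝ.seq x i))) x)

    inverseˡ : ∀ x → (- x) + x ≈ 0#
    inverseˡ x = lower (model inverse
      (λ x → lift (Reals.≗⇒≈ᴿ (-ᴿ x +ᴿ x) 0ᴿ λ i → ℚ.+-inverseˡ (ℝ.seq x i))) x)

    abelianGroup : AbelianGroup c ℓ
    abelianGroup = record
      { _∙_ = _+_ ; ε = 0# ; _⁻¹ = -_
      ; isAbelianGroup = record
        { isGroup = record
          { isMonoid = record
            { isSemigroup = record
              { isMagma = record
                { isEquivalence = isEquivalence
                ; ∙-cong = λ e f → ⟦⟧ᶠ-cong plusˢ (e ∷ f ∷ [])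
                }
              ; assoc = λ x y z → lower (model associative
                  (λ x y z → lift (Reals.≗⇒≈ᴿ (x +ᴿ y +ᴿ z) (x +ᴿ (y +ᴿ z))
                    λ i → ℚ.+-assoc (ℝ.seq x i) (ℝ.seq y i) (ℝ.seq z i))) x y z)
              }
            ; identity = identityˡ , λ x → ≈-trans (comm x 0#) (identityˡ x)
            }
          ; inverse = inverseˡ , λ x → ≈-trans (comm x (- x)) (inverseˡ x)
          ; ⁻¹-cong = λ e → ⟦⟧ᶠ-cong negˢ (e ∷ [])
          }
        ; comm = comm
        }
      }

    open AbelianGroup abelianGroup using (commutativeMonoid)
    open import Algebra.Properties.CommutativeMonoid.Mult commutativeMonoid using () renaming (_×_ to _×ᴹ_)

    evalTerm-×′ : ∀ n {A : Set a} (ι : A → Carrier) (t : Term GroupSymbol A k) v →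
      Semantics.evalTerm 𝑴 ι (n ×′ t) v ≡ n ×ᴹ Semantics.evalTerm 𝑴 ι t v
    evalTerm-×′ zero    ι t v = refl
    evalTerm-×′ (suc n) ι t v = ≡.cong (λ z → Semantics.evalTerm 𝑴 ι t v + z) (evalTerm-×′ n ι t v)

    +-monoˡ-≺ : ∀ z {x y} → x ≺ y → (x + z) ≺ (y + z)
    +-monoˡ-≺ z {x} {y} x≺y = lower (modusPonens (in-𝑴 x y z) (lift x≺y))
      where
      in-𝑴 = model monotone λ x y z → implies λ h → lift (Reals.+ᴿ-monoˡ-< x y z (lower h))

    divide : ∀ n x → ∃[ y ] (suc n ×ᴹ y) ≈ x
    divide n x = let (y , e) = in-𝑴 x in
      y , ≡.subst (_≈ x) (evalTerm-×′ (suc n) ⊥-elim x₀ (y ∷ x ∷ [])) (lower e)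
      where
      in-𝑴 = model (divisible n) λ x → Reals.scale n x , lift (Reals.≗⇒≈ᴿ
        (Semantics.evalTerm (realStructure DOAG) ⊥-elim (suc n ×′ x₀) (Reals.scale n x ∷ x ∷ [])) x
        λ i → ≡.trans (×′-ℝ (suc n) (Reals.scale n x ∷ x ∷ []) i) (reciprocal-× n (ℝ.seq x i)))

    orderedGroup : OrderedGroup c ℓ
    orderedGroup = record
      { abelianGroup       = abelianGroup
      ; _<_                = _≺_
      ; isStrictTotalOrder = Order.isStrictTotalOrder DOAG 𝑴 model
      ; +-monoˡ-<          = +-monoˡ-≺
      ; divide             = divide
      ; positive           = let (x , h) = in-𝑴 in x , lower h
      }
      where
      in-𝑴 = model positive (0ᴿ +ᴿ Reals.constant 1ℚ , lift (Reals.<ᴿ-constant 0ᴿ 0<1ℚ))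

-- Back-and-forth and embeddings of the rationals

module _ (O : StrictTotalOrder a b ℓ) where
  open StrictTotalOrder O
  open Comparison O

  cmp-flip : ∀ x y → cmp y x ≡ neg ⊗ cmp x y
  cmp-flip x y with compare x y
  ... | tri< x<y _ _ = cmp-> x<y
  ... | tri≈ _ x≈y _ = cmp-≈ (Eq.sym x≈y)
  ... | tri> _ _ y<x = cmp-< y<x

module BackAndForth (A : StrictTotalOrder a b ℓ) (B : DenseLinearOrder a′ b′ ℓ′) where
  open OnePoint A B public
  private
    module A  = StrictTotalOrder A
    module A′ = Comparison A
    module B  = DenseLinearOrder B
    module B′ = Comparison B.strictTotalOrder

  OrderPreserving-∷ : ∀ {L x y} → OrderPreserving L →
    (∀ {p} → p ∈ L → A′.cmp (proj₁ p) x ≡ B′.cmp (proj₂ p) y) → OrderPreserving ((x , y) ∷ L)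
  OrderPreserving-∷ iso h (here refl) (here refl) =
    ≡.trans (A′.cmp-≈ A.Eq.refl) (≡.sym (B′.cmp-≈ B.Eq.refl))
  OrderPreserving-∷ {x = x} {y} iso h {q = q} (here refl) (there i) = ≡.trans (cmp-flip A (proj₁ q) x)
    (≡.trans (≡.cong (neg ⊗_) (h i)) (≡.sym (cmp-flip B.strictTotalOrder (proj₂ q) y)))
  OrderPreserving-∷ iso h (there i) (here refl) = h i
  OrderPreserving-∷ iso h (there i) (there j)   = iso i j

  extend-all : ∀ L → OrderPreserving L → ∀ xs → ∃[ L′ ] OrderPreserving L′ ×
    (∀ {p} → p ∈ L → p ∈ L′) × (∀ {x} → x ∈ xs → ∃[ y ] (x , y) ∈ L′)
  extend-all L iso []       = L , iso , id , λ ()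
  extend-all L iso (x ∷ xs) =
    let (y , h)                 = extend L iso x
        (L′ , iso′ , L⊆L′ , xs⊆) = extend-all ((x , y) ∷ L) (OrderPreserving-∷ iso h) xs
    in L′ , iso′ , L⊆L′ ∘ there , λ { (here refl) → y , L⊆L′ (here refl) ; (there i) → xs⊆ i }

-- Finite lists that together exhaust ℚ, so that a countable construction can treat one list at each
-- stage; repetitions and unreduced fractions are harmless.
rationals : ℕ → List ℚ
rationals n = cartesianProductWith (λ z d → z ℚ./ suc d)
  (List.map +_ (List.upTo n) List.++ List.map -[1+_] (List.upTo n)) (List.upTo n)

rationals-exhaust : ∀ q → ∃[ N ] q ∈ rationals N
rationals-exhaust q = N , ≡.subst (_∈ rationals N) (ℚ.↥p/↧p≡p q)
  (∈-cartesianProductWith⁺ (λ z d → z ℚ./ suc d) (integer (ℚ.↥ q) (ℕ.m≤m⊔n (suc ℤ.∣ ℚ.↥ q ∣) (ℚ.↧ₙ q))) (∈-upTo⁺ (ℕ.m≤n⊔m (suc ℤ.∣ ℚ.↥ q ∣) (ℚ.↧ₙ q))))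
  where
  N = suc ℤ.∣ ℚ.↥ q ∣ ℕ.⊔ ℚ.↧ₙ q
  integer : ∀ z → ℤ.∣ z ∣ ℕ.< N → z ∈ List.map +_ (List.upTo N) List.++ List.map -[1+_] (List.upTo N)
  integer (+ k)    h = ∈-++⁺ˡ (∈-map⁺ +_ (∈-upTo⁺ h))
  integer -[1+ k ] h = ∈-++⁺ʳ (List.map +_ (List.upTo N)) (∈-map⁺ -[1+_] (∈-upTo⁺ (ℕ.<-trans (ℕ.n<1+n k) h)))

ℚ-strictTotalOrder : StrictTotalOrder 0ℓ 0ℓ 0ℓ
ℚ-strictTotalOrder = Betweenness.strictTotalOrder ℚ-orderedGroup

ℚ-denseLinearOrder : DenseLinearOrder 0ℓ 0ℓ 0ℓ
ℚ-denseLinearOrder = record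
  { strictTotalOrder = ℚ-strictTotalOrder
  ; point = 0ℚ
  ; dense = ℚ.<-dense
  ; below = λ q → q ℚ.+ ℚ.- 1ℚ , ≡.subst (q ℚ.+ ℚ.- 1ℚ ℚ.<_) (ℚ.+-identityʳ q) (ℚ.+-monoʳ-< q (ℚ.neg-antimono-< 0<1ℚ))
  ; above = λ q → q ℚ.+ 1ℚ , ≡.subst (ℚ._< q ℚ.+ 1ℚ) (ℚ.+-identityʳ q) (ℚ.+-monoʳ-< q 0<1ℚ)
  }

module Embedding (B : DenseLinearOrder a b ℓ) where
  private
    module B  = DenseLinearOrder B
    module B′ = Comparison B.strictTotalOrder
    module Q′ = Comparison ℚ-strictTotalOrder
    module Q→B = BackAndForth ℚ-strictTotalOrder B
    module B→Q = BackAndForth B.strictTotalOrder ℚ-denseLinearOrder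

  -- `P` is first matched with rationals, using that ℚ is dense without endpoints. From there only ℚ
  -- has to be exhausted, using the same property of the target. Any two pairs lie in a common
  -- stage, which gives coherence.
  embedding : ∀ (P : List B.Carrier) → Σ[ e ∈ (ℚ → B.Carrier) ]
    (∀ q r → Q′.cmp q r ≡ B′.cmp (e q) (e r)) × (∀ {x} → x ∈ P → ∃[ q ] e q B.≈ x)
  embedding P = e , preserves , hits
    where
    start : ∃[ L ] B→Q.OrderPreserving L × (∀ {p} → p ∈ [] → p ∈ L) × (∀ {x} → x ∈ P → ∃[ y ] (x , y) ∈ L)
    start = B→Q.extend-all [] (λ ()) P

    Stage : Set _
    Stage = ∃[ L ] Q→B.OrderPreserving L

    stage₀-preserving : Q→B.OrderPreserving (List.map ×-swap (proj₁ start))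
    stage₀-preserving i j with ∈-map⁻ ×-swap i | ∈-map⁻ ×-swap j
    ... | _ , i′ , refl | _ , j′ , refl = ≡.sym (proj₁ (proj₂ start) i′ j′)

    stage : ℕ → Stage
    stage zero    = List.map ×-swap (proj₁ start) , stage₀-preserving
    stage (suc n) = let (L′ , iso , _) = Q→B.extend-all (proj₁ (stage n)) (proj₂ (stage n)) (rationals n) in L′ , iso

    stage-step : ∀ n {p} → p ∈ proj₁ (stage n) → p ∈ proj₁ (stage (suc n))
    stage-step n = proj₁ (proj₂ (proj₂ (Q→B.extend-all (proj₁ (stage n)) (proj₂ (stage n)) (rationals n))))

    stage-mono : ∀ {m n p} → m ℕ.≤′ n → p ∈ proj₁ (stage m) → p ∈ proj₁ (stage n)
    stage-mono ℕ.≤′-refl i = i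
    stage-mono (ℕ.≤′-step {n} m≤n) i = stage-step n (stage-mono m≤n i)

    image : ∀ q → ∃[ n ] ∃[ y ] (q , y) ∈ proj₁ (stage n)
    image q = let (n , i) = rationals-exhaust q in
      suc n , proj₂ (proj₂ (proj₂ (Q→B.extend-all (proj₁ (stage n)) (proj₂ (stage n)) (rationals n)))) i

    e : ℚ → B.Carrier
    e q = proj₁ (proj₂ (image q))

    coherent : ∀ {m n p q} → p ∈ proj₁ (stage m) → q ∈ proj₁ (stage n) →
      Q′.cmp (proj₁ p) (proj₁ q) ≡ B′.cmp (proj₂ p) (proj₂ q)
    coherent {m} {n} i j = proj₂ (stage (m ℕ.⊔ n))
      (stage-mono (ℕ.≤⇒≤′ (ℕ.m≤m⊔n m n)) i) (stage-mono (ℕ.≤⇒≤′ (ℕ.m≤n⊔m m n)) j)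

    preserves : ∀ q r → Q′.cmp q r ≡ B′.cmp (e q) (e r)
    preserves q r = coherent {proj₁ (image q)} {proj₁ (image r)} (proj₂ (proj₂ (image q))) (proj₂ (proj₂ (image r)))

    hits : ∀ {x} → x ∈ P → ∃[ q ] e q B.≈ x
    -- A rational may be listed with several partners; order preservation makes them equal up to
    -- `≈`, so `e q` agrees with the point matched at stage 0.
    hits x∈P = let (q , i) = proj₂ (proj₂ (proj₂ start)) x∈P in q , B′.≈-cmp (≡.trans
      (≡.sym (coherent {proj₁ (image q)} {0} (proj₂ (proj₂ (image q))) (∈-map⁺ ×-swap i))) (Q′.cmp-≈ refl))

-- Stability of special sets

Increasing : (ℕ → ℕ) → Set
Increasing σ = ∀ {i j} → i ℕ.< j → σ i ℕ.< σ j

increasing : ∀ {σ} → (∀ i → σ i ℕ.< σ (suc i)) → Increasing σ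
increasing {σ} step {i} i<j = go (ℕ.≤⇒≤′ i<j)
  where
  go : ∀ {j} → suc i ℕ.≤′ j → σ i ℕ.< σ j
  go ℕ.≤′-refl       = step i
  go (ℕ.≤′-step i<j) = ℕ.<-trans (go i<j) (step _)

Increasing-∘ : ∀ {σ τ} → Increasing σ → Increasing τ → Increasing (σ ∘ τ)
Increasing-∘ σ↑ τ↑ i<j = σ↑ (τ↑ i<j)

SymmetricAlong : (ℕ → ℕ → Set p) → (ℕ → ℕ) → Set p
SymmetricAlong R σ = ∀ {i j} → i ℕ.< j → R (σ i) (σ j) ⇔ R (σ j) (σ i)

-- A half graph is nowhere symmetric, whereas Tame relations contain equations
-- and are closed under Boolean operations.
record Tame (R : ℕ → ℕ → Set p) : Set p where
  constructor tame
  field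
    symmetric-subsequence : ∀ σ → Increasing σ → ∃[ τ ] Increasing τ × SymmetricAlong R (σ ∘ τ)

Tame⇒¬halfGraph : {R : ℕ → ℕ → Set p} → Tame R → ¬ (∀ i j → R i j ⇔ i ℕ.≤ j)
Tame⇒¬halfGraph (tame t) h = let (τ , τ↑ , sym) = t id id in
  ℕ.<⇒≱ (τ↑ (ℕ.s≤s ℕ.z≤n))
    (to (h (τ 1) (τ 0)) (to (sym (ℕ.s≤s ℕ.z≤n)) (from (h (τ 0) (τ 1)) (ℕ.<⇒≤ (τ↑ (ℕ.s≤s ℕ.z≤n))))))

Tame-resp : {R : ℕ → ℕ → Set p} {S : ℕ → ℕ → Set p′} → (∀ i j → R i j ⇔ S i j) → Tame R → Tame S
Tame-resp e (tame t) = tame λ σ σ↑ → let (τ , τ↑ , sym) = t σ σ↑ in τ , τ↑ , λ i<j → mk⇔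
  (to (e _ _) ∘ to (sym i<j) ∘ from (e _ _))
  (to (e _ _) ∘ from (sym i<j) ∘ from (e _ _))

Tame-constant : {P : Set p} → Tame (λ _ _ → P)
Tame-constant = tame λ σ σ↑ → id , id , λ _ → mk⇔ id id

Tame-¬ : {R : ℕ → ℕ → Set p} → Tame R → Tame (λ i j → ¬ R i j)
Tame-¬ (tame t) = tame λ σ σ↑ → let (τ , τ↑ , sym) = t σ σ↑ in
  τ , τ↑ , λ i<j → mk⇔ (_∘ from (sym i<j)) (_∘ to (sym i<j))

-- Symmetry passes to further subsequences, so the second relation can be treated inside the
-- subsequence found for the first. This is why `Tame` quantifies over all starting subsequences.
Tame-both : {R : ℕ → ℕ → Set p} {S : ℕ → ℕ → Set p′} → Tame R → Tame S → ∀ σ → Increasing σ →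
  ∃[ τ ] Increasing τ × SymmetricAlong R (σ ∘ τ) × SymmetricAlong S (σ ∘ τ)
Tame-both (tame r) (tame s) σ σ↑ =
  let (τ , τ↑ , symR) = r σ σ↑
      (υ , υ↑ , symS) = s (σ ∘ τ) (Increasing-∘ {σ} {τ} σ↑ τ↑)
  in τ ∘ υ , Increasing-∘ {τ} {υ} τ↑ υ↑ , (λ i<j → symR (υ↑ i<j)) , symS

Tame-× : {R : ℕ → ℕ → Set p} {S : ℕ → ℕ → Set p′} → Tame R → Tame S → Tame (λ i j → R i j × S i j)
Tame-× tameR tameS = tame λ σ σ↑ → let (τ , τ↑ , symR , symS) = Tame-both tameR tameS σ σ↑ in
  τ , τ↑ , λ i<j → mk⇔ (λ (r , s) → to (symR i<j) r , to (symS i<j) s)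
                       (λ (r , s) → from (symR i<j) r , from (symS i<j) s)

Tame-⊎ : {R : ℕ → ℕ → Set p} {S : ℕ → ℕ → Set p′} → Tame R → Tame S → Tame (λ i j → R i j ⊎ S i j)
Tame-⊎ tameR tameS = tame λ σ σ↑ → let (τ , τ↑ , symR , symS) = Tame-both tameR tameS σ σ↑ in
  τ , τ↑ , λ i<j → mk⇔ [ inj₁ ∘ to (symR i<j) , inj₂ ∘ to (symS i<j) ]′
                       [ inj₁ ∘ from (symR i<j) , inj₂ ∘ from (symS i<j) ]′

Tame-∃ : ∀ {N} {R : Fin N → ℕ → ℕ → Set p} → (∀ k → Tame (R k)) → Tame (λ i j → ∃[ k ] R k i j)
Tame-∃ {N = zero}  t = Tame-resp {R = λ _ _ → Fin 0} (λ _ _ → mk⇔ (λ ()) λ { (() , _) }) Tame-constant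
Tame-∃ {N = suc N} t = Tame-resp
  (λ i j → mk⇔ [ zero ,_ , (λ (k , r) → suc k , r) ]′
                λ { (zero , r) → inj₁ r ; (suc k , r) → inj₂ (k , r) })
  (Tame-⊎ (t zero) (Tame-∃ (t ∘ suc)))

module _ (lem : ∀ {ℓ} → ExcludedMiddle ℓ) where

  Frequently : (ℕ → Set p) → Set p
  Frequently P = ∀ N → ∃[ i ] N ℕ.≤ i × P i

  ¬Frequently : {P : ℕ → Set p} → ¬ Frequently P → ∃[ N ] (∀ i → N ℕ.≤ i → ¬ P i)
  ¬Frequently {P = P} rare with lem {P = ∃[ N ] (∀ i → N ℕ.≤ i → ¬ P i)}
  ... | yes h = h
  ... | no ∄N = contradiction often rare
    where
    often : Frequently P
    often N with lem {P = ∃[ i ] N ℕ.≤ i × P i}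
    ... | yes h = h
    ... | no ∄i = contradiction (N , λ i N≤i Pi → ∄i (i , N≤i , Pi)) ∄N

  subsequence : {P : ℕ → Set p} → Frequently P → ∃[ τ ] Increasing τ × (∀ i → P (τ i))
  subsequence {P = P} often = τ , increasing (λ i → proj₁ (proj₂ (often (suc (τ i))))) , τ-P
    where
    τ : ℕ → ℕ
    τ zero    = proj₁ (often 0)
    τ (suc i) = proj₁ (often (suc (τ i)))
    τ-P : ∀ i → P (τ i)
    τ-P zero    = proj₂ (proj₂ (often 0))
    τ-P (suc i) = proj₂ (proj₂ (often (suc (τ i))))

  -- The infinite pigeonhole principle for two classes.
  constant-subsequence : (P : ℕ → Set p) → ∃[ τ ] Increasing τ × (∀ i j → P (τ i) ⇔ P (τ j))
  constant-subsequence P with lem {P = Frequently P}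
  ... | yes often = let (τ , τ↑ , h) = subsequence often in
          τ , τ↑ , λ i j → mk⇔ (λ _ → h j) (λ _ → h i)
  ... | no rare = let (N , h) = ¬Frequently rare in
          N ℕ.+_ , ℕ.+-monoʳ-< N , λ i j →
            mk⇔ (λ x → contradiction x (h _ (ℕ.m≤m+n N i))) (λ x → contradiction x (h _ (ℕ.m≤m+n N j)))

  Tame-left : (P : ℕ → Set p) → Tame (λ i _ → P i)
  Tame-left P = tame λ σ σ↑ → let (τ , τ↑ , h) = constant-subsequence (P ∘ σ) in τ , τ↑ , λ {i} {j} _ → h i j

  Tame-right : (P : ℕ → Set p) → Tame (λ _ j → P j)
  Tame-right P = tame λ σ σ↑ → let (τ , τ↑ , h) = constant-subsequence (P ∘ σ) in τ , τ↑ , λ {i} {j} _ → h j i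

  module _ (S : Setoid c ℓ) where
    open Setoid S renaming (sym to ≈-sym; trans to ≈-trans)

    -- If `f` or `g` takes some value infinitely often, restricting to those indices turns the
    -- equation into a condition on one index, which a further subsequence makes constant. If
    -- neither does, a sparse subsequence makes the equation fail for all pairs of distinct indices.
    Tame-equation : (f g : ℕ → Carrier) → Tame (λ i j → f i ≈ g j)
    Tame-equation f g = tame go
      where
      go : ∀ σ → Increasing σ → ∃[ τ ] Increasing τ × SymmetricAlong (λ i j → f i ≈ g j) (σ ∘ τ)
      go σ σ↑
        with lem {P = ∃[ z ] Frequently (λ i → f (σ i) ≈ z)} | lem {P = ∃[ z ] Frequently (λ i → g (σ i) ≈ z)}
      ... | yes (z , often) | _ =
        let (τ , τ↑ , f≈z) = subsequence often
            (υ , υ↑ , h)   = constant-subsequence (λ i → z ≈ g (σ (τ i)))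
        in τ ∘ υ , Increasing-∘ {τ} {υ} τ↑ υ↑ , λ {i} {j} _ → mk⇔
          (λ e → ≈-trans (f≈z (υ j)) (to (h j i) (≈-trans (≈-sym (f≈z (υ i))) e)))
          (λ e → ≈-trans (f≈z (υ i)) (to (h i j) (≈-trans (≈-sym (f≈z (υ j))) e)))
      ... | no _ | yes (z , often) =
        let (τ , τ↑ , g≈z) = subsequence often
            (υ , υ↑ , h)   = constant-subsequence (λ i → f (σ (τ i)) ≈ z)
        in τ ∘ υ , Increasing-∘ {τ} {υ} τ↑ υ↑ , λ {i} {j} _ → mk⇔
          (λ e → ≈-trans (to (h i j) (≈-trans e (g≈z (υ j)))) (≈-sym (g≈z (υ i))))
          (λ e → ≈-trans (to (h j i) (≈-trans e (g≈z (υ i)))) (≈-sym (g≈z (υ j))))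
      ... | no f-rare | no g-rare = τ , τ↑ , λ i<j → mk⇔
          (λ e → contradiction (≈-sym e) (proj₂ (g-avoids _) _ (M₂≤ i<j)))
          (λ e → contradiction e (proj₂ (f-avoids _) _ (M₁≤ i<j)))
        where
        f-avoids : ∀ n → ∃[ M ] (∀ i → M ℕ.≤ i → ¬ f (σ i) ≈ g (σ n))
        f-avoids n = ¬Frequently λ often → f-rare (g (σ n) , often)
        g-avoids : ∀ n → ∃[ M ] (∀ i → M ℕ.≤ i → ¬ g (σ i) ≈ f (σ n))
        g-avoids n = ¬Frequently λ often → g-rare (f (σ n) , often)
        -- Past this index `f` no longer takes the value of `g` at `n`, nor `g` that of `f`.
        next : ℕ → ℕ
        next n = suc n ℕ.⊔ (proj₁ (f-avoids n) ℕ.⊔ proj₁ (g-avoids n))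
        τ : ℕ → ℕ
        τ zero    = 0
        τ (suc i) = next (τ i)
        τ↑ : Increasing τ
        τ↑ = increasing λ i → ℕ.m≤m⊔n (suc (τ i)) (proj₁ (f-avoids (τ i)) ℕ.⊔ proj₁ (g-avoids (τ i)))
        next≤ : ∀ {i j} → i ℕ.< j → next (τ i) ℕ.≤ τ j
        next≤ {i} {j} i<j with ℕ.m≤n⇒m<n∨m≡n i<j
        ... | inj₁ 1+i<j = ℕ.<⇒≤ (τ↑ 1+i<j)
        ... | inj₂ refl  = ℕ.≤-refl
        M₁≤ : ∀ {i j} → i ℕ.< j → proj₁ (f-avoids (τ i)) ℕ.≤ τ j
        M₁≤ {i} i<j = ℕ.≤-trans (ℕ.≤-trans (ℕ.m≤m⊔n _ (proj₁ (g-avoids (τ i)))) (ℕ.m≤n⊔m (suc (τ i)) _)) (next≤ i<j)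
        M₂≤ : ∀ {i j} → i ℕ.< j → proj₁ (g-avoids (τ i)) ℕ.≤ τ j
        M₂≤ {i} i<j = ℕ.≤-trans (ℕ.≤-trans (ℕ.m≤n⊔m (proj₁ (f-avoids (τ i))) _) (ℕ.m≤n⊔m (suc (τ i)) _)) (next≤ i<j)

  module Unions {L : Language} (𝑴 : Structure L c ℓ) where
    open Structure 𝑴
    open Semantics 𝑴
    open Stability 𝑴
    open Renaming 𝑴 id

    module _ (tame-atom : ∀ {m n} (s t : Term L Carrier (m ℕ.+ n)) (a : ℕ → Vec Carrier m) (b : ℕ → Vec Carrier n) →
                Tame (λ i j → evalTerm id s (a i ++ b j) ≈ evalTerm id t (a i ++ b j))) where

      Tame-equational : ∀ {χ : Formula L Carrier (m ℕ.+ n)} → Equational χ →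
        (a : ℕ → Vec Carrier m) (b : ℕ → Vec Carrier n) → Tame (λ i j → ⟦ χ ⟧₂ (a i , b j))
      Tame-equational {m} {n} (s ≈′ t)  a b = Tame-resp (λ _ _ → mk⇔ lift lower) (tame-atom s t a b)
      Tame-equational {m} {n} ⊤′        a b = Tame-constant
      Tame-equational {m} {n} ⊥′        a b = Tame-constant
      Tame-equational {m} {n} (¬′ χ)    a b = Tame-¬ (Tame-equational {m} {n} χ a b)
      Tame-equational {m} {n} (χ ∧′ χ′) a b = Tame-× (Tame-equational {m} {n} χ a b) (Tame-equational {m} {n} χ′ a b)
      Tame-equational {m} {n} (χ ∨′ χ′) a b = Tame-⊎ (Tame-equational {m} {n} χ a b) (Tame-equational {m} {n} χ′ a b)

      union⇒stable : ∀ {D : Pred (Pairs m n) d′} → FiniteUnionOfSpecialStable D → Stable D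
      union⇒stable {m} {n} {D = D} (N , S , pieces , D⊆S , S⊆D) (a , b , h) = Tame⇒¬halfGraph
        (Tame-resp {S = λ i j → D (a i , b j)} (λ _ _ → mk⇔ S⊆D D⊆S) (Tame-∃ λ k → piece (pieces k))) h
        where
        piece : ∀ {E : Pred (Pairs _ _) _} → SpecialStable E → Tame (λ i j → E (a i , b j))
        piece (X , Y , Z , _ , _ , (χ , equational , Z⊆χ , χ⊆Z) , E⊆ , ⊆E) = Tame-resp (λ _ _ → mk⇔ ⊆E E⊆)
          (Tame-× (Tame-resp (λ _ _ → mk⇔ χ⊆Z Z⊆χ) (Tame-equational {m} {n} equational a b))
                  (Tame-× (Tame-left (X ∘ a)) (Tame-right (Y ∘ b))))

    special⇒union : (isSTO : IsStrictTotalOrder _≈_ _≺_) → ∀ {D : Pred (Pairs m n) d′} {φ} → D ≐ ⟦ φ ⟧₂ →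
      (Σ[ δs ∈ List (Formula L Carrier (m ℕ.+ n)) ] All (SpecialFormula m n) δs × Equivalent φ (⋁′ δs)) →
      FiniteUnionOfSpecialStable D
    special⇒union {m = m} {n} isSTO (D⊆φ , φ⊆D) (δs , specials , equivalent) =
      List.length δs , (λ i → ⟦ List.lookup δs i ⟧₂) , (λ i → piece (All.lookup specials (∈-lookup {xs = δs} i))) ,
      (λ {xy} d → let (δ , i , h) = to (⋁′-correct δs _) (to (equivalent _) (D⊆φ d)) in
         Any.index i , ≡.subst (λ δ → ⟦ δ ⟧₂ xy) (Any.lookup-index i) h) ,
      (λ {xy} (i , h) → φ⊆D (from (equivalent _) (from (⋁′-correct δs _) (List.lookup δs i , ∈-lookup {xs = δs} i , h))))
      where
      open Specials 𝑴 isSTO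
      piece : ∀ {δ} → SpecialFormula m n δ → SpecialStable ⟦ δ ⟧₂
      piece (special ψ θ {χ} equational) = ⟦ ψ ⟧ , ⟦ θ ⟧ , ⟦ χ ⟧₂ , (ψ , id , id) , (θ , id , id) ,
        (χ , equational , id , id) ,
        (λ {xy} (hψ , hθ , hχ) → let (x , y) = xy in
           hχ , to (rename-x n ψ x y) hψ , to (rename-y m θ x y) hθ) ,
        (λ {xy} (hχ , hψ , hθ) → let (x , y) = xy in
           from (rename-x n ψ x y) hψ , from (rename-y m θ x y) hθ , hχ)

-- Dense linear orders

module SplitForms (G : OrderedGroup c ℓ) where
  open OrderedGroupProperties G
  open Betweenness G using (strictTotalOrder)
  open Walls G
  open Comparison strictTotalOrder

  cmp-sgn : ∀ x y → cmp x y ≡ sgn (x - y)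
  cmp-sgn x y with compare x y
  ... | tri< x<y _ _ = ≡.sym (IsSgn⇒sgn neg (Pos-resp
          (solve (v₁ ⊝ v₀) (⊖ (v₀ ⊝ v₁)) (x ∷ y ∷ []) refl) (<⇒Pos x<y)))
  ... | tri≈ _ x≈y _ = ≡.sym (IsSgn⇒sgn zer (≈-trans (+-cong x≈y ≈-refl) (-‿inverseʳ y)))
  ... | tri> _ _ y<x = ≡.sym (IsSgn⇒sgn pos (<⇒Pos y<x))

  difference : SplitForm Carrier m n → SplitForm Carrier m n → SplitForm Carrier m n
  difference (f , g , k) (f′ , g′ , k′) = f ⊞ -1ℤ ⊡ f′ , g ⊞ -1ℤ ⊡ g′ , k - k′

  val-difference : ∀ (h h′ : SplitForm Carrier m n) p → val (difference h h′) p ≈ val h p - val h′ p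
  val-difference (f , g , k) (f′ , g′ , k′) (x , y) = ≈-trans
    (+-congʳ (+-cong (minus f f′ x) (minus g g′ y)))
    (solve (v₀ ⊝ v₁ ⊕ (v₂ ⊝ v₃) ⊕ (v₄ ⊝ v₅)) (v₀ ⊕ v₂ ⊕ v₄ ⊝ (v₁ ⊕ v₃ ⊕ v₅))
      (f ∙ x ∷ f′ ∙ x ∷ g ∙ y ∷ g′ ∙ y ∷ k ∷ k′ ∷ []) refl)
    where
    minus : ∀ {n} (f f′ : Vec ℤ n) x → (f ⊞ -1ℤ ⊡ f′) ∙ x ≈ f ∙ x - f′ ∙ x
    minus f f′ x = ≈-trans (∙-⊞ f (-1ℤ ⊡ f′) x) (+-cong ≈-refl (≈-trans (∙-⊡ -1ℤ f′ x) (-1• _)))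

  coordinate : Fin (m ℕ.+ n) → SplitForm Carrier m n
  coordinate {m} i = [ (λ i → unit i , 𝟘 , 0#) , (λ j → 𝟘 , unit j , 0#) ]′ (Fin.splitAt m i)

  constant : Carrier → SplitForm Carrier m n
  constant k = 𝟘 , 𝟘 , k

  val-coordinate : ∀ i (x : Vec Carrier m) (y : Vec Carrier n) → val (coordinate i) (x , y) ≈ lookup (x ++ y) i
  val-coordinate {m} {n} i x y = ≈-trans (split (Fin.splitAt m i)) (reflexive (≡.sym (Vec.lookup-splitAt m x y i)))
    where
    reflexive : ∀ {a b} → a ≡ b → a ≈ b
    reflexive refl = ≈-refl
    split : ∀ s → val ([ (λ i → unit i , 𝟘 , 0#) , (λ j → 𝟘 , unit j , 0#) ]′ s) (x , y) ≈ [ lookup x , lookup y ]′ s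
    split (inj₁ i) = ≈-trans (+-identityʳ _) (≈-trans (+-cong (unit-∙ i x) (𝟘-∙ y)) (+-identityʳ _))
    split (inj₂ j) = ≈-trans (+-identityʳ _) (≈-trans (+-cong (𝟘-∙ x) (unit-∙ j y)) (+-identityˡ _))

  val-constant : ∀ k (p : Point m n) → val (constant k) p ≈ k
  val-constant k (x , y) = ≈-trans (+-cong (≈-trans (+-cong (𝟘-∙ x) (𝟘-∙ y)) (+-identityʳ 0#)) ≈-refl) (+-identityˡ k)

module DenseOrders (lem : ∀ {ℓ} → ExcludedMiddle ℓ)
  (𝑴 : Structure (language DLO) c ℓ) (model : 𝑴 ⊨ theory DLO) where
  open Structure 𝑴
  open Semantics 𝑴
  open Stability 𝑴
  open Transfer lem
  open Order DLO 𝑴 model using (isStrictTotalOrder; denseLinearOrder)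
  open Specials 𝑴 isStrictTotalOrder
  open Comparison strictTotalOrder
  open IsEquivalence isEquivalence using () renaming (refl to ≈-refl; sym to ≈-sym; trans to ≈-trans)

  private
    Termᴹ : ℕ → Set c
    Termᴹ = Term (language DLO) Carrier

    Formulaᴹ : ℕ → Set c
    Formulaᴹ = Formula (language DLO) Carrier

  Within : List Carrier → Termᴹ k → Set c
  Within C (var i) = Lift c ⊤
  Within C (par a) = a ∈ C

  WithinFormula : List Carrier → Formulaᴹ k → Set c
  WithinFormula C (s ≈′ t) = Within C s × Within C t
  WithinFormula C (s <′ t) = Within C s × Within C t
  WithinFormula C ⊤′       = Lift c ⊤
  WithinFormula C ⊥′       = Lift c ⊤
  WithinFormula C (¬′ φ)   = WithinFormula C φ
  WithinFormula C (φ ∧′ ψ) = WithinFormula C φ × WithinFormula C ψ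
  WithinFormula C (φ ∨′ ψ) = WithinFormula C φ × WithinFormula C ψ
  WithinFormula C (∃′ φ)   = WithinFormula C φ
  WithinFormula C (∀′ φ)   = WithinFormula C φ

  termParameters : Termᴹ k → List Carrier
  termParameters (var i) = []
  termParameters (par a) = a ∷ []

  parameters : Formulaᴹ k → List Carrier
  parameters (s ≈′ t) = termParameters s List.++ termParameters t
  parameters (s <′ t) = termParameters s List.++ termParameters t
  parameters ⊤′       = []
  parameters ⊥′       = []
  parameters (¬′ φ)   = parameters φ
  parameters (φ ∧′ ψ) = parameters φ List.++ parameters ψ
  parameters (φ ∨′ ψ) = parameters φ List.++ parameters ψ
  parameters (∃′ φ)   = parameters φ
  parameters (∀′ φ)   = parameters φ

  within-term : ∀ {C} (t : Termᴹ k) → (∀ {a} → a ∈ termParameters t → a ∈ C) → Within C t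
  within-term (var i) h = lift tt
  within-term (par a) h = h (here refl)

  within : ∀ {C} (φ : Formulaᴹ k) → (∀ {a} → a ∈ parameters φ → a ∈ C) → WithinFormula C φ
  within (s ≈′ t) h = within-term s (h ∘ ∈-++⁺ˡ) , within-term t (h ∘ ∈-++⁺ʳ (termParameters s))
  within (s <′ t) h = within-term s (h ∘ ∈-++⁺ˡ) , within-term t (h ∘ ∈-++⁺ʳ (termParameters s))
  within ⊤′       h = lift tt
  within ⊥′       h = lift tt
  within (¬′ φ)   h = within φ h
  within (φ ∧′ ψ) h = within φ (h ∘ ∈-++⁺ˡ) , within ψ (h ∘ ∈-++⁺ʳ (parameters φ))
  within (φ ∨′ ψ) h = within φ (h ∘ ∈-++⁺ˡ) , within ψ (h ∘ ∈-++⁺ʳ (parameters φ))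
  within (∃′ φ)   h = within φ h
  within (∀′ φ)   h = within φ h

  points : ∀ k → List Carrier → List (Termᴹ k)
  points k C = List.map var (List.allFin k) List.++ List.map par C

  within⇒∈ : ∀ {C} (t : Termᴹ k) → Within C t → t ∈ points k C
  within⇒∈ {k} (var i) _ = ∈-++⁺ˡ (∈-map⁺ var (∈-allFin i))
  within⇒∈ {k} (par a) h = ∈-++⁺ʳ (List.map var (List.allFin k)) (∈-map⁺ par h)

  ∈⇒within : ∀ {C} {t : Termᴹ k} → t ∈ points k C → Within C t
  ∈⇒within {k} i with ∈-++⁻ (List.map var (List.allFin k)) i
  ... | inj₁ j with ∈-map⁻ var j
  ...   | _ , _ , refl = lift tt
  ∈⇒within {k} i | inj₂ j with ∈-map⁻ par j
  ...   | _ , a∈C , refl = a∈C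

  -- Equality of order types over the parameters `C`: terms of this language are just variables and
  -- parameters.
  SameOrder : List Carrier → Vec Carrier k → Vec Carrier k → Set c
  SameOrder C v w = ∀ s t → Within C s → Within C t → sign (s , t) v ≡ sign (s , t) w

  SameOrder-extend : ∀ {C} {v w : Vec Carrier k} → SameOrder C v w →
    ∀ x → ∃[ y ] SameOrder C (x ∷ v) (y ∷ w)
  SameOrder-extend {k} {C} {v} {w} same x = y , same-∷
    where
    module A = BackAndForth strictTotalOrder denseLinearOrder
    L : A.Partial
    L = List.map (λ t → eval t v , eval t w) (points k C)
    L-preserving : A.OrderPreserving L
    L-preserving i j with ∈-map⁻ (λ t → eval t v , eval t w) i | ∈-map⁻ (λ t → eval t v , eval t w) j
    ... | s , s∈ , refl | t , t∈ , refl = same s t (∈⇒within s∈) (∈⇒within t∈)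
    y = proj₁ (A.extend L L-preserving x)
    L′-preserving : A.OrderPreserving ((x , y) ∷ L)
    L′-preserving = A.OrderPreserving-∷ {L} {x} {y} L-preserving (proj₂ (A.extend L L-preserving x))
    locate : ∀ t → Within C t → (eval t (x ∷ v) , eval t (y ∷ w)) ∈ (x , y) ∷ L
    locate (var zero)    h = here refl
    locate (var (suc i)) h = there (∈-map⁺ _ (within⇒∈ (var i) h))
    locate (par a)       h = there (∈-map⁺ _ (within⇒∈ (par a) h))
    same-∷ : SameOrder C (x ∷ v) (y ∷ w)
    same-∷ s t hs ht = L′-preserving (locate s hs) (locate t ht)

  SameOrder-sym : ∀ {C} {v w : Vec Carrier k} → SameOrder C v w → SameOrder C w v
  SameOrder-sym same s t hs ht = ≡.sym (same s t hs ht)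

  -- Quantifier elimination in semantic form: the order type over the parameters decides `φ`, since
  -- a back-and-forth step matches each quantified element.
  transfer : ∀ {C} (φ : Formulaᴹ k) → WithinFormula C φ → ∀ {v w} → SameOrder C v w → ⟦ φ ⟧ v → ⟦ φ ⟧ w
  transfer (s ≈′ t) (hs , ht) same (lift h) =
    lift (≈-cmp (≡.trans (≡.sym (same s t hs ht)) (cmp-≈ h)))
  transfer (s <′ t) (hs , ht) same (lift h) =
    lift (<-cmp (≡.trans (≡.sym (same s t hs ht)) (cmp-< h)))
  transfer ⊤′       h same d = d
  transfer (¬′ φ)   h same d = d ∘ transfer φ h (SameOrder-sym same)
  transfer (φ ∧′ ψ) (h , g) same (d , e) = transfer φ h same d , transfer ψ g same e
  transfer (φ ∨′ ψ) (h , g) same (inj₁ d) = inj₁ (transfer φ h same d)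
  transfer (φ ∨′ ψ) (h , g) same (inj₂ d) = inj₂ (transfer ψ g same d)
  transfer (∃′ φ)   h same (x , d) = let (y , same′) = SameOrder-extend same x in
    y , transfer φ h same′ d
  transfer (∀′ φ)   h same d y =
    let (x , same′) = SameOrder-extend (SameOrder-sym same) y in
    transfer φ h (SameOrder-sym same′) (d x)

  module Pullback (φ : Formulaᴹ (m ℕ.+ n)) {P : List Carrier} (C⊆P : ∀ {a} → a ∈ parameters φ → a ∈ P)
    (e : ℚ → Carrier) (preserves : ∀ q r → Comparison.cmp ℚ-strictTotalOrder q r ≡ cmp (e q) (e r))
    (hits : ∀ {z} → z ∈ P → ∃[ q ] e q ≈ z) where
    open OrderedGroupProperties ℚ-orderedGroup using (sgn; sgn-cong; IsSgn⇒sgn; sgn⇒IsSgn)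
    open Walls ℚ-orderedGroup using (Point; val)
    module ℚ-Forms = SplitForms ℚ-orderedGroup
    C = parameters φ
    H = cartesianProduct (points (m ℕ.+ n) C) (points (m ℕ.+ n) C)
    φ-within : WithinFormula C φ
    φ-within = within φ id

    pre : Carrier → ℚ
    pre z with lem {P = ∃[ q ] e q ≈ z}
    ... | yes (q , _) = q
    -- A default value; `pre` inverts `e` only up to `≈` and only on its image, which contains `P`.
    ... | no _        = 0ℚ

    pre-correct : ∀ {z} → z ∈ P → e (pre z) ≈ z
    pre-correct {z} z∈P with lem {P = ∃[ q ] e q ≈ z}
    ... | yes (q , eq) = eq
    ... | no ∄q        = contradiction (hits z∈P) ∄q

    InP : Vec Carrier k → Set c
    InP z = ∀ i → lookup z i ∈ P

    record _≈ᵉ_ (p : Point m n) (v : Vec Carrier (m ℕ.+ n)) : Set ℓ where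
      constructor pointwise
      field
        at : ∀ i → e (lookup (proj₁ p ++ proj₂ p) i) ≈ lookup v i

    reflexive : ∀ {a b} → a ≡ b → a ≈ b
    reflexive refl = ≈-refl

    image-natural : ∀ ((p , q) : Point m n) → (p , q) ≈ᵉ (Vec.map e p ++ Vec.map e q)
    image-natural (p , q) = pointwise λ i → reflexive (≡.trans (≡.sym (Vec.lookup-map i e (p ++ q)))
      (≡.cong (λ z → lookup z i) (Vec.map-++ e p q)))

    hat-correct : ∀ (p : Vec Carrier m) (q : Vec Carrier n) → InP p → InP q → (Vec.map pre p , Vec.map pre q) ≈ᵉ (p ++ q)
    hat-correct p q hp hq = pointwise λ i → ≈-trans (reflexive (≡.cong e (≡.trans
        (≡.cong (λ z → lookup z i) (≡.sym (Vec.map-++ pre p q))) (Vec.lookup-map i pre (p ++ q)))))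
      (pre-correct (≡.subst (_∈ P) (≡.sym (Vec.lookup-splitAt m p q i)) (split (Fin.splitAt m i))))
      where
      split : ∀ (s : Fin m ⊎ Fin n) → [ lookup p , lookup q ]′ s ∈ P
      split (inj₁ i) = hp i
      split (inj₂ j) = hq j

    form : Termᴹ (m ℕ.+ n) → SplitForm ℚ m n
    form (var i) = ℚ-Forms.coordinate i
    form (par a) = ℚ-Forms.constant (pre a)

    eval-form : ∀ {p v} → p ≈ᵉ v → ∀ t → Within C t → e (val (form t) p) ≈ eval t v
    eval-form {p , q} (pointwise h) (var i) _ = ≈-trans (reflexive (≡.cong e (ℚ-Forms.val-coordinate i p q))) (h i)
    eval-form {p} h (par a) a∈C   = ≈-trans (reflexive (≡.cong e (ℚ-Forms.val-constant (pre a) p))) (pre-correct (C⊆P a∈C))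

    atomForm : Atom (m ℕ.+ n) → SplitForm ℚ m n
    atomForm (s , t) = ℚ-Forms.difference (form s) (form t)

    sgn-form : ∀ {p v} → p ≈ᵉ v → ∀ s t → Within C s → Within C t → sgn (val (atomForm (s , t)) p) ≡ sign (s , t) v
    sgn-form {p} h s t hs ht = ≡.trans (sgn-cong (ℚ-Forms.val-difference (form s) (form t) p))
      (≡.trans (≡.sym (ℚ-Forms.cmp-sgn (val (form s) p) (val (form t) p)))
      (≡.trans (preserves _ _) (cmp-cong (eval-form h s hs) (eval-form h t ht))))

    Ĥ = List.map atomForm H

    atom∈H : ∀ s t → Within C s → Within C t → (s , t) ∈ H
    atom∈H s t hs ht = ∈-cartesianProduct⁺ (within⇒∈ s hs) (within⇒∈ t ht)

    form∈Ĥ : ∀ s t → Within C s → Within C t → atomForm (s , t) ∈ Ĥ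
    form∈Ĥ s t hs ht = ∈-map⁺ atomForm (atom∈H s t hs ht)

    D̂ : Point m n → Set (c ⊔ ℓ)
    D̂ (p , q) = ⟦ φ ⟧ (Vec.map e p ++ Vec.map e q)

    relate : ∀ {p q v w} → p ≈ᵉ v → q ≈ᵉ w → (∀ {h} → h ∈ Ĥ → sgn (val h p) ≡ sgn (val h q)) → ⟦ φ ⟧ v → ⟦ φ ⟧ w
    relate {v = v} {w} hp hq same = transfer φ φ-within {v} {w} λ s t hs ht → ≡.trans
      (≡.sym (sgn-form hp s t hs ht)) (≡.trans (same (form∈Ĥ s t hs ht)) (sgn-form hq s t hs ht))

    -- The point `v` need not come from ℚ: `φ` is first transferred from `v` to `(x , y′)`, which
    -- has the same signs and whose coordinates lie in `P`. The rectangle property in ℚ then applies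
    -- to the preimage `D̂`, and `e` sends a half graph in `D̂` to one in `φ`.
    pullback : StableFormula m n φ → ∀ {v} → ⟦ φ ⟧ v →
      ∀ {x x′ : Vec Carrier m} {y y′ : Vec Carrier n} → InP x → InP x′ → InP y → InP y′ →
      SameSigns H (x ++ y′) v → SameSigns H (x′ ++ y) v → SameZeros H (x ++ y) v → ⟦ φ ⟧ (x ++ y)
    pullback stable {v} φ-v {x} {x′} {y} {y′} x∈P x′∈P y∈P y′∈P signs₁ signs₂ zeros =
      relate (image-natural (x̂ , ŷ)) (hat-correct x y x∈P y∈P) (λ _ → refl)
        (Core.rectangle ℚ-orderedGroup lem lem {D = D̂} Ĥ
          (λ {p} {q} → relate (image-natural p) (image-natural q))
          (λ (a , b , h) → stable (Vec.map e ∘ a , Vec.map e ∘ b , h))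
          {x̂} {x̂′} {ŷ} {ŷ′} same-form zero-form
          (relate (hat-correct x y′ x∈P y′∈P) (image-natural (x̂ , ŷ′)) (λ _ → refl)
            (transfer φ φ-within {v} {x ++ y′} (λ s t hs ht → ≡.sym (signs₁ (atom∈H s t hs ht))) φ-v)))
      where
      x̂ = Vec.map pre x
      x̂′ = Vec.map pre x′
      ŷ = Vec.map pre y
      ŷ′ = Vec.map pre y′

      same-form : ∀ {h} → h ∈ Ĥ → sgn (val h (x̂ , ŷ′)) ≡ sgn (val h (x̂′ , ŷ))
      same-form i with ∈-map⁻ atomForm i
      ... | (s , t) , j , refl =
        let (js , jt) = ∈-cartesianProduct⁻ (points (m ℕ.+ n) C) (points (m ℕ.+ n) C) j
            hs = ∈⇒within js
            ht = ∈⇒within jt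
        in ≡.trans (sgn-form (hat-correct x y′ x∈P y′∈P) s t hs ht) (≡.trans (signs₁ j)
             (≡.trans (≡.sym (signs₂ j)) (≡.sym (sgn-form (hat-correct x′ y x′∈P y∈P) s t hs ht))))

      zero-form : ∀ {h} → h ∈ Ĥ → (val h (x̂ , ŷ) ≡ 0ℚ → val h (x̂ , ŷ′) ≡ 0ℚ) × (val h (x̂ , ŷ′) ≡ 0ℚ → val h (x̂ , ŷ) ≡ 0ℚ)
      zero-form i with ∈-map⁻ atomForm i
      ... | (s , t) , j , refl =
        let (js , jt) = ∈-cartesianProduct⁻ (points (m ℕ.+ n) C) (points (m ℕ.+ n) C) j
            e₁ = sgn-form (hat-correct x y x∈P y∈P) s t (∈⇒within js) (∈⇒within jt)
            e₂ = sgn-form (hat-correct x y′ x∈P y′∈P) s t (∈⇒within js) (∈⇒within jt)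
        in (λ z → sgn⇒IsSgn {s = zer} (≡.trans e₂ (≡.trans (signs₁ j) (to (zeros j)
              (≡.trans (≡.sym e₁) (IsSgn⇒sgn zer z))))))
         , (λ z → sgn⇒IsSgn {s = zer} (≡.trans e₁ (from (zeros j)
              (≡.trans (≡.sym (signs₁ j)) (≡.trans (≡.sym e₂) (IsSgn⇒sgn zer z))))))

  -- The embedding is chosen only after the four tuples are given, but the atoms depend on `φ`
  -- alone; so one list of special formulas serves all points.
  rectangular : ∀ (φ : Formulaᴹ (m ℕ.+ n)) → StableFormula m n φ →
    Rectangular m n φ (cartesianProduct (points (m ℕ.+ n) (parameters φ)) (points (m ℕ.+ n) (parameters φ)))
  rectangular {m} {n} φ stable φ-v {x} {x′} {y} {y′} =
    Pullback.pullback {m} {n} φ C⊆P (proj₁ embedded) (proj₁ (proj₂ embedded)) (proj₂ (proj₂ embedded))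
      stable φ-v {x} {x′} {y} {y′} x∈P x′∈P y∈P y′∈P
    where
    P = Vec.toList x List.++ Vec.toList x′ List.++ Vec.toList y List.++ Vec.toList y′ List.++ parameters φ
    embedded = Embedding.embedding denseLinearOrder P

    lookup∈toList : ∀ (z : Vec Carrier k) i → lookup z i ∈ Vec.toList z
    lookup∈toList (z ∷ zs) zero    = here refl
    lookup∈toList (z ∷ zs) (suc i) = there (lookup∈toList zs i)

    x∈P : ∀ i → lookup x i ∈ P
    x∈P i = ∈-++⁺ˡ (lookup∈toList x i)
    x′∈P : ∀ i → lookup x′ i ∈ P
    x′∈P i = ∈-++⁺ʳ (Vec.toList x) (∈-++⁺ˡ (lookup∈toList x′ i))
    y∈P : ∀ i → lookup y i ∈ P
    y∈P i = ∈-++⁺ʳ (Vec.toList x) (∈-++⁺ʳ (Vec.toList x′) (∈-++⁺ˡ (lookup∈toList y i)))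
    y′∈P : ∀ i → lookup y′ i ∈ P
    y′∈P i = ∈-++⁺ʳ (Vec.toList x) (∈-++⁺ʳ (Vec.toList x′) (∈-++⁺ʳ (Vec.toList y) (∈-++⁺ˡ (lookup∈toList y′ i))))
    C⊆P : ∀ {a} → a ∈ parameters φ → a ∈ P
    C⊆P i = ∈-++⁺ʳ (Vec.toList x) (∈-++⁺ʳ (Vec.toList x′) (∈-++⁺ʳ (Vec.toList y) (∈-++⁺ʳ (Vec.toList y′) i)))

  private
    setoid : Setoid c ℓ
    setoid = record { isEquivalence = isEquivalence }

    one-sided : ∀ (t : Termᴹ (m ℕ.+ n)) →
      (Σ[ f ∈ (Vec Carrier m → Carrier) ] ∀ x (y : Vec Carrier n) → eval t (x ++ y) ≡ f x) ⊎
      (Σ[ g ∈ (Vec Carrier n → Carrier) ] ∀ (x : Vec Carrier m) y → eval t (x ++ y) ≡ g y)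
    one-sided (par a) = inj₁ ((λ _ → a) , λ _ _ → refl)
    one-sided {m} (var i) with Fin.splitAt m i in eq
    ... | inj₁ j = inj₁ ((λ x → lookup x j) , λ x y → ≡.trans (Vec.lookup-splitAt m x y i)
            (≡.cong [ lookup x , lookup y ]′ eq))
    ... | inj₂ j = inj₂ ((λ y → lookup y j) , λ x y → ≡.trans (Vec.lookup-splitAt m x y i)
            (≡.cong [ lookup x , lookup y ]′ eq))

  tame-atom : ∀ (s t : Termᴹ (m ℕ.+ n)) (a : ℕ → Vec Carrier m) (b : ℕ → Vec Carrier n) →
    Tame (λ i j → eval s (a i ++ b j) ≈ eval t (a i ++ b j))
  tame-atom {m} {n} s t a b with one-sided {m} {n} s | one-sided {m} {n} t
  ... | inj₁ (f , hf) | inj₁ (g , hg) = Tame-resp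
    (λ i j → ≡⇒⇔ (≡.sym (≡.cong₂ _≈_ (hf (a i) (b j)) (hg (a i) (b j)))))
    (Tame-left lem (λ i → f (a i) ≈ g (a i)))
  ... | inj₁ (f , hf) | inj₂ (g , hg) = Tame-resp
    (λ i j → ≡⇒⇔ (≡.sym (≡.cong₂ _≈_ (hf (a i) (b j)) (hg (a i) (b j)))))
    (Tame-equation lem setoid (f ∘ a) (g ∘ b))
  ... | inj₂ (f , hf) | inj₁ (g , hg) = Tame-resp
    (λ i j → mk⇔
      (λ e → ≡.subst₂ _≈_ (≡.sym (hf (a i) (b j))) (≡.sym (hg (a i) (b j))) (≈-sym e))
      (λ e → ≈-sym (≡.subst₂ _≈_ (hf (a i) (b j)) (hg (a i) (b j)) e)))
    (Tame-equation lem setoid (g ∘ a) (f ∘ b))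
  ... | inj₂ (f , hf) | inj₂ (g , hg) = Tame-resp
    (λ i j → ≡⇒⇔ (≡.sym (≡.cong₂ _≈_ (hf (a i) (b j)) (hg (a i) (b j)))))
    (Tame-right lem (λ j → f (b j) ≈ g (b j)))

-- Divisible ordered abelian groups

module OrderedGroups (lem : ∀ {ℓ} → ExcludedMiddle ℓ)
  (𝑴 : Structure (language DOAG) c ℓ) (model : 𝑴 ⊨ theory DOAG) where
  open Structure 𝑴 using (⟦_⟧ᶠ; ⟦⟧ᶠ-cong; _≺_)
  open Semantics 𝑴
  open Stability 𝑴
  open Transfer lem
  open Order DOAG 𝑴 model using (isStrictTotalOrder; denseLinearOrder)
  open Group 𝑴 model using (orderedGroup; evalTerm-×′) renaming (_+′_ to _+ᵗ_; -′_ to -ᵗ_; 0′ to 0ᵗ; _×′_ to _×ᵗ_)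
  open Specials 𝑴 isStrictTotalOrder
  open Comparison strictTotalOrder
  open OrderedGroupProperties orderedGroup
  open SplitForms orderedGroup using (cmp-sgn)
  open Walls orderedGroup using (Point; val; ++-∙)

  private
    module E = Extension orderedGroup {C = Carrier} (λ b k a l → b • k - a • l)

  value : Form Carrier k → Vec Carrier k → Carrier
  value = E.value id

  reflexive : ∀ {x y} → x ≡ y → x ≈ y
  reflexive refl = ≈-refl

  termForm : Term GroupSymbol Carrier k → Form Carrier k
  termForm (var i)                   = unit i , 0#
  termForm (par a)                   = 𝟘 , a
  termForm (fun zeroˢ [])            = 𝟘 , 0#
  termForm (fun negˢ (t ∷ []))       = let (f , a) = termForm t in -1ℤ ⊡ f , - a
  termForm (fun plusˢ (s ∷ t ∷ []))  =
    let (f , a) = termForm s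
        (g , b) = termForm t
    in f ⊞ g , a + b

  termForm-correct : ∀ (t : Term GroupSymbol Carrier k) v → eval t v ≈ value (termForm t) v
  termForm-correct (var i) v = ≈-sym (≈-trans (+-identityʳ _) (unit-∙ i v))
  termForm-correct (par a) v = ≈-sym (≈-trans (+-congʳ (𝟘-∙ v)) (+-identityˡ a))
  termForm-correct (fun zeroˢ []) v = ≈-sym (≈-trans (+-congʳ (𝟘-∙ v)) (+-identityˡ 0#))
  termForm-correct (fun negˢ (t ∷ [])) v = let (f , a) = termForm t in begin
    - eval t v                 ≈⟨ -‿cong (termForm-correct t v) ⟩
    - (f ∙ v + a)              ≈⟨ -‿+-comm (f ∙ v) a ⟨
    - (f ∙ v) + - a            ≈⟨ +-congʳ (≈-trans (∙-⊡ -1ℤ f v) (-1• _)) ⟨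
    (-1ℤ ⊡ f) ∙ v + - a        ∎
  termForm-correct (fun plusˢ (s ∷ t ∷ [])) v =
    let (f , a) = termForm s
        (g , b) = termForm t
    in begin
    eval s v + eval t v              ≈⟨ +-cong (termForm-correct s v) (termForm-correct t v) ⟩
    (f ∙ v + a) + (g ∙ v + b)        ≈⟨ +-interchange _ _ _ _ ⟩
    (f ∙ v + g ∙ v) + (a + b)        ≈⟨ +-congʳ (∙-⊞ f g v) ⟨
    (f ⊞ g) ∙ v + (a + b)            ∎

  atomForm : Atom k → Form Carrier k
  atomForm (s , t) =
    let (f , a) = termForm s
        (g , b) = termForm t
    in f ⊞ -1ℤ ⊡ g , a - b

  atomForm-correct : ∀ (h : Atom k) v → sign h v ≡ sgn (value (atomForm h) v)
  atomForm-correct (s , t) v =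
    let (f , a) = termForm s
        (g , b) = termForm t
    in ≡.trans (cmp-sgn (eval s v) (eval t v)) (sgn-cong (begin
      eval s v - eval t v
        ≈⟨ +-cong (termForm-correct s v) (-‿cong (termForm-correct t v)) ⟩
      (f ∙ v + a) - (g ∙ v + b)
        ≈⟨ solve (v₀ ⊕ v₁ ⊝ (v₂ ⊕ v₃)) (v₀ ⊝ v₂ ⊕ (v₁ ⊝ v₃)) (f ∙ v ∷ a ∷ g ∙ v ∷ b ∷ [])
             refl ⟩
      (f ∙ v - g ∙ v) + (a - b)
        ≈⟨ +-congʳ (≈-trans (∙-⊞ f (-1ℤ ⊡ g) v) (+-congˡ (≈-trans (∙-⊡ -1ℤ g v) (-1• _)))) ⟨
      (f ⊞ -1ℤ ⊡ g) ∙ v + (a - b) ∎))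

  infixr 10 _•ᵗ_
  _•ᵗ_ : ℤ → Term GroupSymbol Carrier k → Term GroupSymbol Carrier k
  (+ n)    •ᵗ t = n ×ᵗ t
  -[1+ n ] •ᵗ t = -ᵗ (suc n ×ᵗ t)

  eval-•ᵗ : ∀ a (t : Term GroupSymbol Carrier k) v → eval (a •ᵗ t) v ≈ a • eval t v
  eval-•ᵗ (+ n)    t v = reflexive (evalTerm-×′ n id t v)
  eval-•ᵗ -[1+ n ] t v = -‿cong (reflexive (evalTerm-×′ (suc n) id t v))

  combination : Vec ℤ n → (Fin n → Fin k) → Term GroupSymbol Carrier k
  combination []      ρ = 0ᵗ
  combination (a ∷ f) ρ = (a •ᵗ var (ρ zero)) +ᵗ combination f (ρ ∘ suc)

  eval-combination : ∀ (f : Vec ℤ n) (ρ : Fin n → Fin k) v →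
    eval (combination f ρ) v ≈ f ∙ Vec.tabulate (lookup v ∘ ρ)
  eval-combination []      ρ v = ≈-refl
  eval-combination (a ∷ f) ρ v = +-cong (eval-•ᵗ a (var (ρ zero)) v) (eval-combination f (ρ ∘ suc) v)

  -- Elimination produces forms, whereas the special formulas need atoms of the language; an integer
  -- coefficient is spelt out as a repeated sum.
  formAtom : Form Carrier k → Atom k
  formAtom (f , a) = combination f id +ᵗ par a , 0ᵗ

  formAtom-correct : ∀ (h : Form Carrier k) v → sign (formAtom h) v ≡ sgn (value h v)
  formAtom-correct (f , a) v = ≡.trans (cmp-sgn _ 0#) (sgn-cong (≈-trans
    (≈-trans (+-congˡ -0≈0) (+-identityʳ _))
    (+-congʳ (≈-trans (eval-combination f id v) (reflexive (≡.cong (f ∙_) (Vec.tabulate∘lookup v)))))))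

  -- The one-point step of back-and-forth inside `𝑴`: signs of differences are order comparisons.
  -- The pairs are swapped because the new point is sought on the left.
  sgn-extend : ∀ (L : List (Carrier × Carrier)) →
    (∀ {p q} → p ∈ L → q ∈ L → sgn (proj₁ p - proj₁ q) ≡ sgn (proj₂ p - proj₂ q)) →
    ∀ x → ∃[ x′ ] (∀ {p} → p ∈ L → sgn (x′ - proj₁ p) ≡ sgn (x - proj₂ p))
  sgn-extend L same x = let (x′ , h) = O.extend (List.map ×-swap L) preserving x in
    x′ , λ {p} i → ≡.trans (flipped x′ (proj₁ p))
      (≡.trans (≡.cong (neg ⊗_) (≡.sym (h (∈-map⁺ ×-swap i)))) (≡.sym (flipped x (proj₂ p))))
    where
    module O = OnePoint strictTotalOrder denseLinearOrder
    flipped : ∀ a b → sgn (a - b) ≡ neg ⊗ cmp b a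
    flipped a b = ≡.trans (≡.sym (cmp-sgn a b)) (cmp-flip strictTotalOrder b a)
    preserving : O.OrderPreserving (List.map ×-swap L)
    preserving i j with ∈-map⁻ ×-swap i | ∈-map⁻ ×-swap j
    ... | _ , i′ , refl | _ , j′ , refl = ≡.trans (cmp-sgn _ _) (≡.trans (≡.sym (same i′ j′)) (≡.sym (cmp-sgn _ _)))

  SameSgn : List (Form Carrier k) → Vec Carrier k → Vec Carrier k → Set c
  SameSgn H v w = ∀ h → h ∈ H → sgn (value h v) ≡ sgn (value h w)

  SameSgn-extend : ∀ (H : List (Form Carrier (suc k))) {v w} → SameSgn (E.derive H) v w →
    ∀ x → ∃[ y ] SameSgn H (y ∷ v) (x ∷ w)
  SameSgn-extend H same x = proj₁ extended , λ _ → proj₂ extended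
    where
    extended = E.extend id id (λ _ _ _ _ → ≈-refl) (λ _ _ _ _ → ≈-refl)
      (λ x y → sgn x ≡ sgn y)
      (λ e f eq → ≡.trans (≡.sym (sgn-cong e)) (≡.trans eq (sgn-cong f)))
      (λ z eq → ≡.trans (sgn-• z _) (≡.trans (≡.cong (sgnℤ z ⊗_) eq) (≡.sym (sgn-• z _))))
      (λ {z} z≢0 eq → ⊗-cancelˡ (sgnℤ-≢ z≢0) (≡.trans (≡.sym (sgn-• z _)) (≡.trans eq (sgn-• z _))))
      sgn-extend H (same _) x

  Determines : List (Form Carrier k) → Formula GroupSymbol Carrier k → Set (c ⊔ ℓ)
  Determines H φ = ∀ {v w} → SameSgn H v w → ⟦ φ ⟧ v → ⟦ φ ⟧ w

  -- No quantifier-free formula is built; a finite list of forms whose signs decide `φ` is enough. A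
  -- quantifier replaces the list by its `derive`, over which the quantified element can be matched.
  quantifierElimination : ∀ (φ : Formula GroupSymbol Carrier k) → ∃[ H ] Determines H φ
  quantifierElimination (s ≈′ t) = atomForm (s , t) ∷ [] , λ {v} {w} same (lift e) → lift (≈-cmp
    (≡.trans (atomForm-correct (s , t) w) (≡.trans (≡.sym (same _ (here refl)))
      (≡.trans (≡.sym (atomForm-correct (s , t) v)) (cmp-≈ e)))))
  quantifierElimination (s <′ t) = atomForm (s , t) ∷ [] , λ {v} {w} same (lift e) → lift (<-cmp
    (≡.trans (atomForm-correct (s , t) w) (≡.trans (≡.sym (same _ (here refl)))
      (≡.trans (≡.sym (atomForm-correct (s , t) v)) (cmp-< e)))))
  quantifierElimination ⊤′ = [] , λ _ d → d
  quantifierElimination ⊥′ = [] , λ _ ()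
  quantifierElimination (¬′ φ) = let (H , h) = quantifierElimination φ in
    H , λ same d → d ∘ h (λ f i → ≡.sym (same f i))
  quantifierElimination (φ ∧′ ψ) =
    let (H , h) = quantifierElimination φ
        (I , i) = quantifierElimination ψ
    in H List.++ I , λ same (d , e) → h (λ f j → same f (∈-++⁺ˡ j)) d , i (λ f j → same f (∈-++⁺ʳ H j)) e
  quantifierElimination (φ ∨′ ψ) =
    let (H , h) = quantifierElimination φ
        (I , i) = quantifierElimination ψ
    in H List.++ I , λ same → [ inj₁ ∘ h (λ f j → same f (∈-++⁺ˡ j)) , inj₂ ∘ i (λ f j → same f (∈-++⁺ʳ H j)) ]′
  quantifierElimination (∃′ φ) = let (H , h) = quantifierElimination φ in
    E.derive H , λ same (x , d) →
      let (y , same′) = SameSgn-extend H (λ f i → ≡.sym (same f i)) x in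
      y , h (λ f i → ≡.sym (same′ f i)) d
  quantifierElimination (∀′ φ) = let (H , h) = quantifierElimination φ in
    E.derive H , λ same d y →
      let (x , same′) = SameSgn-extend H same y in h same′ (d x)

  split : Form Carrier (m ℕ.+ n) → SplitForm Carrier m n
  split {m} (f , a) = Vec.take m f , Vec.drop m f , a

  val-split : ∀ (h : Form Carrier (m ℕ.+ n)) x y → val (split h) (x , y) ≈ value h (x ++ y)
  val-split {m} (f , a) x y = +-congʳ (≈-trans (≈-sym (++-∙ (Vec.take m f) (Vec.drop m f) x y))
    (reflexive (≡.cong (_∙ (x ++ y)) (Vec.take++drop≡id m f))))

  rectangular : ∀ (φ : Formula GroupSymbol Carrier (m ℕ.+ n)) → StableFormula m n φ →
    Rectangular m n φ (List.map formAtom (proj₁ (quantifierElimination φ)))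
  rectangular {m} {n} φ stable {v} φ-v {x} {x′} {y} {y′} signs₁ signs₂ zeros with quantifierElimination φ
  ... | H , determines = Core.rectangle orderedGroup lem lem {D = ⟦ φ ⟧₂} (List.map split H)
        (λ same → determines λ h i → ≡.trans (≡.sym (sgn-split h _)) (≡.trans (same (∈-map⁺ split i)) (sgn-split h _)))
        stable {x} {x′} {y} {y′} same zero-iff
        (determines (λ h i → ≡.trans (≡.sym (formAtom-correct h v))
          (≡.trans (≡.sym (signs₁ (∈-map⁺ formAtom i))) (formAtom-correct h (x ++ y′)))) φ-v)
    where
    sgn-split : ∀ h ((x , y) : Point m n) → sgn (val (split h) (x , y)) ≡ sgn (value h (x ++ y))
    sgn-split h (x , y) = sgn-cong (val-split {m} h x y)
    sgn-atom : ∀ h ((x , y) : Point m n) → sgn (val (split h) (x , y)) ≡ sign (formAtom h) (x ++ y)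
    sgn-atom h (x , y) = ≡.trans (sgn-split h (x , y)) (≡.sym (formAtom-correct h (x ++ y)))
    same : ∀ {h} → h ∈ List.map split H → sgn (val h (x , y′)) ≡ sgn (val h (x′ , y))
    same i with ∈-map⁻ split i
    ... | h , j , refl = ≡.trans (sgn-atom h (x , y′)) (≡.trans (signs₁ (∈-map⁺ formAtom j))
            (≡.trans (≡.sym (signs₂ (∈-map⁺ formAtom j))) (≡.sym (sgn-atom h (x′ , y)))))
    zero-iff : ∀ {h} → h ∈ List.map split H →
      (val h (x , y) ≈ 0# → val h (x , y′) ≈ 0#) × (val h (x , y′) ≈ 0# → val h (x , y) ≈ 0#)
    zero-iff i with ∈-map⁻ split i
    ... | h , j , refl =
      let e₁ = sgn-atom h (x , y)
          e₂ = ≡.trans (sgn-atom h (x , y′)) (signs₁ (∈-map⁺ formAtom j))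
          z  = zeros (∈-map⁺ formAtom j)
      in (λ h≈0 → sgn⇒IsSgn {s = zer} (≡.trans e₂ (to z (≡.trans (≡.sym e₁) (IsSgn⇒sgn zer h≈0)))))
       , (λ h≈0 → sgn⇒IsSgn {s = zer} (≡.trans e₁ (from z (≡.trans (≡.sym e₂) (IsSgn⇒sgn zer h≈0)))))

  tame-atom : ∀ (s t : Term GroupSymbol Carrier (m ℕ.+ n)) (a : ℕ → Vec Carrier m) (b : ℕ → Vec Carrier n) →
    Tame (λ i j → eval s (a i ++ b j) ≈ eval t (a i ++ b j))
  tame-atom {m} {n} s t a b = Tame-resp separated (Tame-equation lem setoid (λ i → f ∙ a i) (λ j → - (g ∙ b j + κ)))
    where
    h = split {m} {n} (atomForm (s , t))
    f = proj₁ h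
    g = proj₁ (proj₂ h)
    κ = proj₂ (proj₂ h)
    sgn-h : ∀ x y → sign (s , t) (x ++ y) ≡ sgn (val h (x , y))
    sgn-h x y = ≡.trans (atomForm-correct (s , t) (x ++ y)) (≡.sym (sgn-cong (val-split {m} (atomForm (s , t)) x y)))
    separated : ∀ i j → (f ∙ a i ≈ - (g ∙ b j + κ)) ⇔ (eval s (a i ++ b j) ≈ eval t (a i ++ b j))
    separated i j = mk⇔
      (λ e → ≈-cmp (≡.trans (sgn-h (a i) (b j)) (IsSgn⇒sgn zer (begin
        f ∙ a i + g ∙ b j + κ              ≈⟨ +-assoc _ _ _ ⟩
        f ∙ a i + (g ∙ b j + κ)            ≈⟨ +-congʳ e ⟩
        - (g ∙ b j + κ) + (g ∙ b j + κ)    ≈⟨ -‿inverseˡ _ ⟩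
        0#                                 ∎))))
      (λ e → begin
        f ∙ a i
          ≈⟨ solve v₀ (v₀ ⊕ v₁ ⊕ v₂ ⊝ (v₁ ⊕ v₂)) (f ∙ a i ∷ g ∙ b j ∷ κ ∷ []) refl ⟩
        (f ∙ a i + g ∙ b j + κ) - (g ∙ b j + κ)
          ≈⟨ +-congʳ (sgn⇒IsSgn {s = zer} (≡.trans (≡.sym (sgn-h (a i) (b j))) (cmp-≈ e))) ⟩
        0# - (g ∙ b j + κ)
          ≈⟨ +-identityˡ _ ⟩
        - (g ∙ b j + κ) ∎)

-- Assembly of both equivalences

module Conclusion (lem : ∀ {ℓ} → ExcludedMiddle ℓ) {L : Language} (𝑴 : Structure L c ℓ)
  (isStrictTotalOrder : IsStrictTotalOrder (Structure._≈_ 𝑴) (Structure._≺_ 𝑴)) where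
  open Structure 𝑴
  open Semantics 𝑴
  open Stability 𝑴
  open Specials 𝑴 isStrictTotalOrder
  open Unions lem 𝑴

  characterisation :
    (∀ {m n} (s t : Term L Carrier (m ℕ.+ n)) (a : ℕ → Vec Carrier m) (b : ℕ → Vec Carrier n) →
      Tame (λ i j → eval s (a i ++ b j) ≈ eval t (a i ++ b j))) →
    (∀ {m n} (φ : Formula L Carrier (m ℕ.+ n)) → StableFormula m n φ → ∃[ H ] Rectangular m n φ H) →
    ∀ m n →
    (∀ (D : Pred (Pairs m n) d′) → Definable₂ D → Stable D ⇔ FiniteUnionOfSpecialStable D) ×
    (∀ (φ : Formula L Carrier (m ℕ.+ n)) → StableFormula m n φ ⇔
      (Σ[ δs ∈ List (Formula L Carrier (m ℕ.+ n)) ] All (SpecialFormula m n) δs × Equivalent φ (⋁′ δs)))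
  characterisation atoms-tame rectangle m n =
    (λ D (φ , D⊆φ , φ⊆D) → mk⇔
      (λ stable → special⇒union isStrictTotalOrder {φ = φ} (D⊆φ , φ⊆D)
        (specialise φ λ (a , b , h) → stable (a , b , λ i j → mk⇔ (to (h i j) ∘ D⊆φ) (φ⊆D ∘ from (h i j)))))
      (union⇒stable atoms-tame)) ,
    (λ φ → mk⇔ (specialise φ)
      (λ δs → union⇒stable atoms-tame {D = ⟦ φ ⟧₂} (special⇒union isStrictTotalOrder {φ = φ} (id , id) δs)))
    where
    specialise : ∀ (φ : Formula L Carrier (m ℕ.+ n)) → StableFormula m n φ →
      Σ[ δs ∈ List (Formula L Carrier (m ℕ.+ n)) ] All (SpecialFormula m n) δs × Equivalent φ (⋁′ δs)
    specialise φ stable = let (H , h) = rectangle φ stable in rectangular⇒special lem φ H λ {v} → h {v}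

open import Data.Nat using (_+_)

theorem4p1 : (∀ {ℓ} → ExcludedMiddle ℓ) →
  ∀ {c ℓ d} (T : TheoryName) (𝑴 : Structure (language T) c ℓ) → 𝑴 ⊨ theory T →
  ∀ (m n : ℕ) →
  let open Structure 𝑴 using (Carrier)
      open Stability 𝑴 in
  (∀ (D : Pred (Pairs m n) d) → Definable₂ D →
     Stable D ⇔ FiniteUnionOfSpecialStable D)
  ×
  (∀ (φ : Formula (language T) Carrier (m + n)) →
     StableFormula m n φ ⇔
     (Σ[ δs ∈ List (Formula (language T) Carrier (m + n)) ]
        All (SpecialFormula m n) δs × Equivalent φ (⋁′ δs)))
theorem4p1 lem DLO 𝑴 model m n = Conclusion.characterisation lem 𝑴
  (Transfer.Order.isStrictTotalOrder lem DLO 𝑴 model)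
  (λ {m} {n} → DenseOrders.tame-atom lem 𝑴 model {m} {n})
  (λ φ stable → _ , λ {v} → DenseOrders.rectangular lem 𝑴 model φ stable {v}) m n
theorem4p1 lem DOAG 𝑴 model m n = Conclusion.characterisation lem 𝑴
  (Transfer.Order.isStrictTotalOrder lem DOAG 𝑴 model)
  (λ {m} {n} → OrderedGroups.tame-atom lem 𝑴 model {m} {n})
  (λ φ stable → _ , λ {v} → OrderedGroups.rectangular lem 𝑴 model φ stable {v}) m n
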